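{- Let $(\mathcal{A},\varphi,\varphi^\prime)$ be an infinitesimal non-commutative probability space, with free, Boolean and monotone cumulants $r_n,b_n,h_n$ and infinitesimal free, Boolean and monotone cumulants $r^\prime_n,b^\prime_n,h^\prime_n$. Then for every $n\ge 1$ and all $a_1,\dots,a_n\in\mathcal{A}$: \begin{align*} b^\prime_n (a_1, \dots, a_n) &= \sum_{\pi\in \mathcal{NC}_{irr}(n)} \partial r_\pi(a_1, \dots, a_n),\\ r^\prime_n (a_1, \dots, a_n) &= \sum_{\pi\in \mathcal{NC}_{irr}(n)} (-1)^{|\pi|-1} \partial b_\pi(a_1, \dots, a_n),\\ b^\prime_n (a_1, \dots, a_n) &= \sum_{\pi\in \mathcal{NC}_{irr}(n)} \frac{1}{\tau(\pi)!}\partial h_\pi(a_1, \dots, a_n),\\ r^\prime_n (a_1, \dots, a_n) &= \sum_{\pi\in \mathcal{NC}_{irr}(n)} \frac{(-1)^{|\pi|-1}}{\tau(\pi)!} \partial h_\pi(a_1, \dots, a_n). \end{align*}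
   Context: An infinitesimal non-commutative probability space is a triple $(\mathcal{A},\varphi,\varphi^\prime)$ where $\mathcal{A}$ is a unital complex algebra and $\varphi,\varphi^\prime:\mathcal{A}\to\mathbb{C}$ are linear with $\varphi(1_\mathcal{A})=1$, $\varphi^\prime(1_\mathcal{A})=0$. Write $\varphi_n(a_1,\dots,a_n)=\varphi(a_1\cdots a_n)$ and $\varphi^\prime_n(a_1,\dots,a_n)=\varphi^\prime(a_1\cdots a_n)$. Partitions: $\mathcal{P}(n)$ is the set of partitions of $[n]=\{1,\dots,n\}$, $\mathcal{NC}(n)$ the non-crossing ones, $\mathcal{I}(n)$ the interval partitions (all blocks are intervals), and $\mathcal{NC}_{irr}(n)$ the non-crossing partitions in which $1$ and $n$ lie in the same block. $|\pi|$ is the number of blocks. For $\pi\in\mathcal{NC}(n)$ and a block $V$, let $N(V)$ be the number of blocks $W\in\pi$ with $W\subseteq\{\min V,\min V+1,\dots,\max V\}$ (including $V$), and $\tau(\pi)!:=\prod_{V\in\pi}N(V)$. For a family of multilinear maps $f_m:\mathcal{A}^m\to\mathbb{C}$ and $\pi\in\mathcal{P}(n)$, $f_\pi(a_1,\dots,a_n):=\prod_{V\in\pi}f_{|V|}(a_V)$, where for $V=\{v_1<\dots<v_k\}$, $f_{|V|}(a_V)=f_k(a_{v_1},\dots,a_{v_k})$. For a sequence of pairs $(f_m,f^\prime_m)$ of multilinear maps, $\partial f_\pi(a_1,\dots,a_n):=\sum_{V\in\pi} f^\prime_{|V|}(a_V)\prod_{W\in\pi,W\neq V}f_{|W|}(a_W)$.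 Cumulants are the multilinear maps defined recursively by, for all $n$ and $a_i\in\mathcal{A}$: free $\varphi_n=\sum_{\pi\in\mathcal{NC}(n)}r_\pi$; Boolean $\varphi_n=\sum_{\pi\in\mathcal{I}(n)}b_\pi$; monotone $\varphi_n=\sum_{\pi\in\mathcal{NC}(n)}\frac{1}{\tau(\pi)!}h_\pi$. Infinitesimal cumulants are defined recursively by $\varphi^\prime_n=\sum_{\pi\in\mathcal{NC}(n)}\partial r_\pi$ (free, using pairs $(r_m,r^\prime_m)$), $\varphi^\prime_n=\sum_{\pi\in\mathcal{I}(n)}\partial b_\pi$ (Boolean, pairs $(b_m,b^\prime_m)$), $\varphi^\prime_n=\sum_{\pi\in\mathcal{NC}(n)}\frac{1}{\tau(\pi)!}\partial h_\pi$ (monotone, pairs $(h_m,h^\prime_m)$), all evaluated at $(a_1,\dots,a_n)$. -}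

module Defs where

open import Level using (Level; _⊔_) renaming (suc to lsuc)
open import Data.Nat using (ℕ; zero; suc; _≤ᵇ_; _≡ᵇ_; _⊓_) renaming (_⊔_ to _⊔ℕ_)
import Data.Nat
open import Data.Bool using (Bool; true; false; _∧_; not; if_then_else_)
open import Data.List using (List; []; _∷_; [_]; _++_; map; concatMap; foldr; filterᵇ; length; upTo)
open import Data.Bool.ListAction using (all; any)
open import Data.Product using (_×_; _,_)
open import Relation.Binary.PropositionalEquality using (_≢_)
open import Algebra.Bundles using (CommutativeRing)
open import Algebra.Module.Bundles using (LeftModule)

record UnitalAlgebra {c ℓ : Level} (K : CommutativeRing c ℓ) (a ℓa : Level)
       : Set (c ⊔ ℓ ⊔ lsuc (a ⊔ ℓa)) where
  open CommutativeRing K using (ring) renaming (Carrier to Scalar)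
  field
    module' : LeftModule ring a ℓa
  open LeftModule module' public
  field
    _·_      : Carrierᴹ → Carrierᴹ → Carrierᴹ
    1ᴬ       : Carrierᴹ
    ·-cong   : ∀ {x y u v} → x ≈ᴹ y → u ≈ᴹ v → (x · u) ≈ᴹ (y · v)
    ·-assoc  : ∀ x y z → ((x · y) · z) ≈ᴹ (x · (y · z))
    ·-identityˡ : ∀ x → (1ᴬ · x) ≈ᴹ x
    ·-identityʳ : ∀ x → (x · 1ᴬ) ≈ᴹ x
    ·-distribˡ : ∀ x y z → (x · (y +ᴹ z)) ≈ᴹ ((x · y) +ᴹ (x · z))
    ·-distribʳ : ∀ x y z → ((y +ᴹ z) · x) ≈ᴹ ((y · x) +ᴹ (z · x))
    *ₗ-·-assocˡ : ∀ (k : Scalar) x y → ((k *ₗ x) · y) ≈ᴹ (k *ₗ (x · y))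
    *ₗ-·-assocʳ : ∀ (k : Scalar) x y → (x · (k *ₗ y)) ≈ᴹ (k *ₗ (x · y))

record InfProbSpace {c ℓ : Level} (K : CommutativeRing c ℓ) (a ℓa : Level)
       : Set (c ⊔ ℓ ⊔ lsuc (a ⊔ ℓa)) where
  open CommutativeRing K
  field
    algebra : UnitalAlgebra K a ℓa
  open UnitalAlgebra algebra public
    using (Carrierᴹ; _≈ᴹ_; _+ᴹ_; _*ₗ_; _·_; 1ᴬ)
  field
    φ φ′      : Carrierᴹ → Carrier
    φ-cong    : ∀ {x y} → x ≈ᴹ y → φ x ≈ φ y
    φ′-cong   : ∀ {x y} → x ≈ᴹ y → φ′ x ≈ φ′ y
    φ-+       : ∀ x y → φ (x +ᴹ y) ≈ (φ x + φ y)
    φ′-+      : ∀ x y → φ′ (x +ᴹ y) ≈ (φ′ x + φ′ y)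
    φ-*ₗ      : ∀ k x → φ (k *ₗ x) ≈ (k * φ x)
    φ′-*ₗ     : ∀ k x → φ′ (k *ₗ x) ≈ (k * φ′ x)
    φ-unit    : φ 1ᴬ ≈ 1#
    φ′-unit   : φ′ 1ᴬ ≈ 0#

-- Set partitions of [n] = {1,…,n}.  A partition is a list of blocks,
-- each block a list of elements of [n] (listed increasingly).

Block : Set
Block = List ℕ

Partition : Set
Partition = List Block

extend : ℕ → Partition → List Partition
extend k []      = []
extend k (B ∷ π) = ((B ++ [ k ]) ∷ π) ∷ map (B ∷_) (extend k π)

partitions : ℕ → List Partition
partitions zero    = [ [] ]
partitions (suc n) =
  concatMap (λ π → (π ++ [ [ suc n ] ]) ∷ extend (suc n) π) (partitions n)

select : {A : Set} → List A → List (A × List A)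
select []       = []
select (x ∷ xs) = (x , xs) ∷ map (λ { (y , ys) → (y , x ∷ ys) }) (select xs)

_∈ᵇ_ : ℕ → Block → Bool
i ∈ᵇ V = any (λ j → i ≡ᵇ j) V

_<ᵇ_ : ℕ → ℕ → Bool
m <ᵇ n = suc m ≤ᵇ n

minB maxB : Block → ℕ
minB []       = 0
minB (x ∷ xs) = foldr _⊓_ x xs
maxB []       = 0
maxB (x ∷ xs) = foldr _⊔ℕ_ x xs

crossesᵇ : Block → Block → Bool
crossesᵇ V W =
  any (λ p → any (λ q → any (λ s → any (λ t →
        (p <ᵇ q) ∧ (q <ᵇ s) ∧ (s <ᵇ t)) W) V) W) V

isNCᵇ : Partition → Bool
isNCᵇ π = all (λ { (V , rest) → all (λ W → not (crossesᵇ V W)) rest }) (select π)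

isIntervalBlockᵇ : Block → Bool
isIntervalBlockᵇ V =
  all (λ i → if (minB V ≤ᵇ i) ∧ (i ≤ᵇ maxB V) then i ∈ᵇ V else true) (upTo (suc (maxB V)))

isIntervalᵇ : Partition → Bool
isIntervalᵇ π = all isIntervalBlockᵇ π

irrᵇ : ℕ → Partition → Bool
irrᵇ n π = any (λ V → (1 ∈ᵇ V) ∧ (n ∈ᵇ V)) π

NC : ℕ → List Partition
NC n = filterᵇ isNCᵇ (partitions n)

Int : ℕ → List Partition
Int n = filterᵇ isIntervalᵇ (partitions n)

NCirr : ℕ → List Partition
NCirr n = filterᵇ (λ π → isNCᵇ π ∧ irrᵇ n π) (partitions n)

Nblk : Partition → Block → ℕ
Nblk π V = length (filterᵇ (λ W → all (λ w → (minB V ≤ᵇ w) ∧ (w ≤ᵇ maxB V)) W) π)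

τ! : Partition → ℕ
τ! π = foldr (λ V acc → Data.Nat._*_ (Nblk π V) acc) 1 π

module Scalars {c ℓ : Level} (K : CommutativeRing c ℓ) where
  open CommutativeRing K

  ΣK : {X : Set} → List X → (X → Carrier) → Carrier
  ΣK xs f = foldr (λ x acc → f x + acc) 0# xs

  ΠK : {X : Set} → List X → (X → Carrier) → Carrier
  ΠK xs f = foldr (λ x acc → f x * acc) 1# xs

  fromℕ : ℕ → Carrier
  fromℕ zero    = 0#
  fromℕ (suc n) = 1# + fromℕ n

  sgn : ℕ → Carrier
  sgn zero    = 1#
  sgn (suc k) = - sgn k

  IsReciprocal : (ℕ → Carrier) → Set ℓ
  IsReciprocal recip = ∀ m → m ≢ 0 → (fromℕ m * recip m) ≈ 1#

module Over {c ℓ a ℓa : Level} (K : CommutativeRing c ℓ) (P : InfProbSpace K a ℓa) where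
  open CommutativeRing K
  open Scalars K public
  open InfProbSpace P using (Carrierᴹ; _·_; 1ᴬ; φ; φ′)

  args : (ℕ → Carrierᴹ) → ℕ → List Carrierᴹ
  args x n = map x (map suc (upTo n))

  prodA : (ℕ → Carrierᴹ) → ℕ → Carrierᴹ
  prodA x n = foldr _·_ 1ᴬ (args x n)

  -- a family of multilinear maps (f_m)_m, given as one function on tuples
  Family : Set (c ⊔ a)
  Family = List Carrierᴹ → Carrier

  [_]_at_ : Family → Partition → (ℕ → Carrierᴹ) → Carrier
  [ f ] π at x = ΠK π (λ V → f (map x V))

  ∂[_,_]_at_ : Family → Family → Partition → (ℕ → Carrierᴹ) → Carrier
  ∂[ f , f′ ] π at x =
    ΣK (select π) (λ { (V , rest) → f′ (map x V) * ΠK rest (λ W → f (map x W)) })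

  -- defining (moment–cumulant) relations, for all n ≥ 1 and a_i ∈ 𝒜.
  -- recip m plays the role of 1/m (m ≠ 0).
  AreFreeCumulants : Family → Family → Set (ℓ ⊔ a)
  AreFreeCumulants r r′ = ∀ (n : ℕ) → 1 Data.Nat.≤ n → (x : ℕ → Carrierᴹ) →
      (φ (prodA x n) ≈ ΣK (NC n) (λ π → [ r ] π at x))
    × (φ′ (prodA x n) ≈ ΣK (NC n) (λ π → ∂[ r , r′ ] π at x))

  AreBooleanCumulants : Family → Family → Set (ℓ ⊔ a)
  AreBooleanCumulants b b′ = ∀ (n : ℕ) → 1 Data.Nat.≤ n → (x : ℕ → Carrierᴹ) →
      (φ (prodA x n) ≈ ΣK (Int n) (λ π → [ b ] π at x))
    × (φ′ (prodA x n) ≈ ΣK (Int n) (λ π → ∂[ b , b′ ] π at x))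

  AreMonotoneCumulants : (ℕ → Carrier) → Family → Family → Set (ℓ ⊔ a)
  AreMonotoneCumulants recip h h′ = ∀ (n : ℕ) → 1 Data.Nat.≤ n → (x : ℕ → Carrierᴹ) →
      (φ (prodA x n) ≈ ΣK (NC n) (λ π → recip (τ! π) * [ h ] π at x))
    × (φ′ (prodA x n) ≈ ΣK (NC n) (λ π → recip (τ! π) * ∂[ h , h′ ] π at x))

{-# OPTIONS --safe #-}

-- Let ε² = 0.  Then ∂f_π is the ε-part of (f + εf′)_π, so that infinitesimal cumulants are the
-- ε-parts of cumulants over the dual numbers K[ε], and it suffices to express the Boolean and the
-- free cumulants b and r by r, b and the monotone cumulants h over a commutative ring.
--
-- View a function on words as a power series in non-commuting letters, and let M be the series of
-- moments.  Splitting off the first block of a partition gives M = 1 + b M, where the coefficient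
-- of b at a word a w is the coefficient at w of the a-derivative of r with every letter z replaced
-- by M z; this is the sum over irreducible non-crossing partitions.  The free moments N of -b satisfy
-- (1 + ρ) N = 1, where ρ is obtained from b by substituting N z for z, and comparing the two
-- functional equations shows that z ↦ M z and z ↦ N z are inverse substitutions, whence ρ = r.
--
-- For monotone cumulants, attach a factor s to each block.  The tree factorial turns the sum over
-- partitions into an iterated integral, so the resulting series M_s solves an autonomous
-- differential equation in s, and the substitutions z ↦ M_s z form a one-parameter group.  Hence
-- M_{-1}, the series for -h, is inverse to M_1 = M as well, and the formulas follow as before.

module Submission where

open import Defs
open import Level using (Level)
open import Data.Nat using (ℕ; _≤_)
open import Data.List using (List)
open import Data.Product using (_×_)
open import Algebra.Bundles using (CommutativeRing)
open import Algebra.Morphism.Construct.Identity using (isRingHomomorphism)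
open import Algebra.Morphism.Structures using (module RingMorphisms)
open import Data.Bool using (Bool; true; false; T)
open import Data.Empty using (⊥; ⊥-elim)
open import Data.List using ([]; _∷_; [_]; _++_; map; concatMap; filterᵇ; length; upTo; applyUpTo)
open import Data.List.Properties using (++-assoc; ++-identityʳ; map-++; map-∘; map-id; concatMap-map; map-concatMap; map-applyUpTo; upTo-∷ʳ; length-++; length-map)
open import Data.List.Relation.Unary.All as All using (All; []; _∷_)
import Data.List.Relation.Unary.All.Properties as Allₚ
open import Data.Nat using (zero; suc; _<_; _∸_; s≤s; z≤n)
import Data.Nat as ℕ
import Data.Nat.Properties as ℕₚ
open import Data.Product using (_,_; proj₁; proj₂; ∃-syntax)
open import Function using (id; _∘_)
open import Relation.Binary.Bundles using (Setoid)
open import Relation.Binary.PropositionalEquality as ≡ using (_≡_; _≢_; cong; cong₂; module ≡-Reasoning)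
import Relation.Binary.Reasoning.Setoid as SetoidReasoning
open import Relation.Nullary.Decidable using (T?)

open RingMorphisms using (IsRingHomomorphism)

-- Word functions

-- The letters of a word are indices into a fixed sequence of arguments and may repeat. The defining
-- relations hold for every relabelling of the arguments, so they determine the moment series at all
-- words, and the problem becomes one about series, where a right factor with constant term 1 can be
-- cancelled.
--
-- The obstacle is that partitions are listed by adding a largest element, while the functional
-- equations split off the first block. Non-crossing partitions are therefore encoded as trees that
-- support both operations, and the subword sum `S`, which carries the unfinished gap as extra
-- state, translates one into the other. A single operator `L` per block treats free and monotone
-- cumulants at once.
--
-- Both are series over polynomials in the one variable s, solve the same equation and agree at s =
-- 0; at s = 1 the second is the unit. Evaluation at s = 1 and at s = -1 then yields the unsigned
-- and the signed sums.

length-ind : {p : Level} (P : List ℕ → Set p) → (∀ w → (∀ v → length v < length w → P v) → P w) → ∀ w → P w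
length-ind P step w = go (suc (length w)) w ℕₚ.≤-refl
  where
  go : ∀ n w → length w < n → P w
  go (suc n) w (s≤s le) = step w (λ v lt → go n v (ℕₚ.≤-trans lt le))

module WordAlgebra {c ℓ : Level} (R : CommutativeRing c ℓ) where
  open CommutativeRing R
  open import Algebra.Solver.Ring.NaturalCoefficients.Default commutativeSemiring
    using (solve; _:+_; _:*_; _:=_)

  W : Set c
  W = List ℕ → Carrier

  infix 4 _≐_
  infixl 7 _⋆_ _·_
  infixl 6 _⊞_

  _≐_ : W → W → Set ℓ
  P ≐ Q = ∀ w → P w ≈ Q w

  W-setoid : Setoid c ℓ
  W-setoid = record
    { Carrier = W
    ; _≈_ = _≐_
    ; isEquivalence = record
        { refl = λ _ → refl ; sym = λ p w → sym (p w) ; trans = λ p q w → trans (p w) (q w) }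
    }

  module ≐-Reasoning = SetoidReasoning W-setoid
  open Setoid W-setoid public using () renaming (refl to ≐-refl; sym to ≐-sym; trans to ≐-trans)

  0ʷ δ : W
  0ʷ _ = 0#
  δ []      = 1#
  δ (_ ∷ _) = 0#

  _⊞_ : W → W → W
  (P ⊞ Q) w = P w + Q w

  _·_ : Carrier → W → W
  (k · P) w = k * P w

  ∂ : ℕ → W → W
  ∂ a P w = P (a ∷ w)

  -- The deconcatenation product, the sum of P u * Q v over all splittings w = uv. Passing to
  -- `∂ a P` keeps the recursion on the word and avoids listing the splittings.
  _⋆_ : W → W → W
  (P ⋆ Q) []      = P [] * Q []
  (P ⋆ Q) (a ∷ w) = P [] * Q (a ∷ w) + (∂ a P ⋆ Q) w

  -- The inverse of the family of all ∂ a, for word functions vanishing at [].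
  D : (ℕ → W) → W
  D F []      = 0#
  D F (a ∷ w) = F a w

  D-cong : ∀ {F G} → (∀ a → F a ≐ G a) → D F ≐ D G
  D-cong e []      = refl
  D-cong e (a ∷ w) = e a w

  ⊞-cong : ∀ {P P′ Q Q′} → P ≐ P′ → Q ≐ Q′ → P ⊞ Q ≐ P′ ⊞ Q′
  ⊞-cong p q w = +-cong (p w) (q w)

  ⋆-cong : ∀ {P P′ Q Q′} → P ≐ P′ → Q ≐ Q′ → P ⋆ Q ≐ P′ ⋆ Q′
  ⋆-cong p q []      = *-cong (p []) (q [])
  ⋆-cong p q (a ∷ w) = +-cong (*-cong (p []) (q (a ∷ w))) (⋆-cong (λ v → p (a ∷ v)) q w)

  ⋆-congˡ : ∀ {P Q Q′} → Q ≐ Q′ → P ⋆ Q ≐ P ⋆ Q′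
  ⋆-congˡ {P} q = ⋆-cong {P} {P} (λ _ → refl) q

  ⋆-congʳ : ∀ {P P′ Q} → P ≐ P′ → P ⋆ Q ≐ P′ ⋆ Q
  ⋆-congʳ {Q = Q} p = ⋆-cong {Q = Q} {Q} p (λ _ → refl)

  -- Since `D F` vanishes at [] and `D` consumes a letter, both factors are read at strictly shorter
  -- words only. This is what makes fixed-point equations of the form `P ⋆ D F` amenable to
  -- induction on length.
  ⋆-cong< : ∀ {P P′ F F′} w
          → (∀ v → length v < length w → P v ≈ P′ v)
          → (∀ a v → length v < length w → F a v ≈ F′ a v)
          → (P ⋆ D F) w ≈ (P′ ⋆ D F′) w
  ⋆-cong< []      p f = trans (zeroʳ _) (sym (zeroʳ _))
  ⋆-cong< {P} {P′} {F} {F′} (a ∷ w) p f = +-cong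
    (*-cong (p [] (s≤s z≤n)) (f a w ℕₚ.≤-refl))
    (⋆-cong< {∂ a P} {∂ a P′} {F} {F′} w (λ v lt → p (a ∷ v) (s≤s lt)) (λ b v lt → f b v (ℕₚ.<-trans lt ℕₚ.≤-refl)))

  ⋆-cong≤ : ∀ {P P′ Q Q′} w
          → (∀ v → length v ≤ length w → P v ≈ P′ v)
          → (∀ v → length v ≤ length w → Q v ≈ Q′ v)
          → (P ⋆ Q) w ≈ (P′ ⋆ Q′) w
  ⋆-cong≤ []      p q = *-cong (p [] z≤n) (q [] z≤n)
  ⋆-cong≤ {P} {P′} (a ∷ w) p q = +-cong
    (*-cong (p [] z≤n) (q (a ∷ w) ℕₚ.≤-refl))
    (⋆-cong≤ {∂ a P} {∂ a P′} w (λ v le → p (a ∷ v) (s≤s le)) (λ v le → q v (ℕₚ.≤-trans le (ℕₚ.n≤1+n _))))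

  ⋆-distribˡ : ∀ P Q Q′ → P ⋆ (Q ⊞ Q′) ≐ P ⋆ Q ⊞ P ⋆ Q′
  ⋆-distribˡ P Q Q′ []      = distribˡ _ _ _
  ⋆-distribˡ P Q Q′ (a ∷ w) = trans (+-cong (distribˡ _ _ _) (⋆-distribˡ (∂ a P) Q Q′ w))
    (solve 4 (λ x y z t → (x :+ y) :+ (z :+ t) := (x :+ z) :+ (y :+ t)) refl _ _ _ _)

  ⋆-distribʳ : ∀ P P′ Q → (P ⊞ P′) ⋆ Q ≐ P ⋆ Q ⊞ P′ ⋆ Q
  ⋆-distribʳ P P′ Q []      = distribʳ _ _ _
  ⋆-distribʳ P P′ Q (a ∷ w) = trans (+-cong (distribʳ _ _ _) (⋆-distribʳ (∂ a P) (∂ a P′) Q w))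
    (solve 4 (λ x y z t → (x :+ y) :+ (z :+ t) := (x :+ z) :+ (y :+ t)) refl _ _ _ _)

  ·-⋆ : ∀ k P Q → (k · P) ⋆ Q ≐ k · (P ⋆ Q)
  ·-⋆ k P Q []      = *-assoc _ _ _
  ·-⋆ k P Q (a ∷ w) = trans (+-cong (*-assoc _ _ _) (·-⋆ k (∂ a P) Q w)) (sym (distribˡ _ _ _))

  ⋆-· : ∀ k P Q → P ⋆ (k · Q) ≐ k · (P ⋆ Q)
  ⋆-· k P Q []      = solve 3 (λ x y z → x :* (y :* z) := y :* (x :* z)) refl _ _ _
  ⋆-· k P Q (a ∷ w) = trans (+-cong (solve 3 (λ x y z → x :* (y :* z) := y :* (x :* z)) refl _ _ _) (⋆-· k (∂ a P) Q w))
    (sym (distribˡ _ _ _))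

  ⋆-zeroˡ : ∀ Q → 0ʷ ⋆ Q ≐ 0ʷ
  ⋆-zeroˡ Q []      = zeroˡ _
  ⋆-zeroˡ Q (a ∷ w) = trans (+-cong (zeroˡ _) (⋆-zeroˡ Q w)) (+-identityˡ _)

  ⋆-zeroʳ : ∀ P → P ⋆ 0ʷ ≐ 0ʷ
  ⋆-zeroʳ P []      = zeroʳ _
  ⋆-zeroʳ P (a ∷ w) = trans (+-cong (zeroʳ _) (⋆-zeroʳ (∂ a P) w)) (+-identityˡ _)

  ⋆-identityˡ : ∀ Q → δ ⋆ Q ≐ Q
  ⋆-identityˡ Q []      = *-identityˡ _
  ⋆-identityˡ Q (a ∷ w) = trans (+-cong (*-identityˡ _) (⋆-zeroˡ Q w)) (+-identityʳ _)

  ⋆-identityʳ : ∀ P → P ⋆ δ ≐ P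
  ⋆-identityʳ P []      = *-identityʳ _
  ⋆-identityʳ P (a ∷ w) = trans (+-cong (zeroʳ _) (⋆-identityʳ (∂ a P) w)) (+-identityˡ _)

  ⋆-assoc : ∀ P Q S → (P ⋆ Q) ⋆ S ≐ P ⋆ (Q ⋆ S)
  ⋆-assoc P Q S []      = *-assoc _ _ _
  ⋆-assoc P Q S (a ∷ w) = trans
    (+-congˡ (trans (⋆-distribʳ (P [] · ∂ a Q) (∂ a P ⋆ Q) S w)
      (+-cong (·-⋆ (P []) (∂ a Q) S w) (⋆-assoc (∂ a P) Q S w))))
    (solve 5 (λ p q s x y → (p :* q) :* s :+ (p :* x :+ y) := p :* (q :* s :+ x) :+ y) refl _ _ _ _ _)

  D-⋆ : ∀ F Q → D F ⋆ Q ≐ D (λ a → F a ⋆ Q)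
  D-⋆ F Q []      = zeroˡ _
  D-⋆ F Q (a ∷ w) = trans (+-congʳ (zeroˡ _)) (+-identityˡ _)

  -- Agreement at [] makes the first summands at `a ∷ w` equal; cancelling them leaves the same
  -- hypothesis for `∂ a P` and `∂ a Q`.
  ⋆-cancelʳ : ∀ P Q M → M [] ≈ 1# → P ⋆ M ≐ Q ⋆ M → P ≐ Q
  ⋆-cancelʳ P Q M m e [] = begin
    P []         ≈⟨ *-identityʳ _ ⟨
    P [] * 1#    ≈⟨ *-congˡ m ⟨
    P [] * M []  ≈⟨ e [] ⟩
    Q [] * M []  ≈⟨ *-congˡ m ⟩
    Q [] * 1#    ≈⟨ *-identityʳ _ ⟩
    Q []         ∎
    where open SetoidReasoning setoid
  ⋆-cancelʳ P Q M m e (a ∷ w) = ⋆-cancelʳ (∂ a P) (∂ a Q) M m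
    (λ v → +-cancelˡ _ _ _ (trans (e (a ∷ v)) (+-congʳ (*-congʳ (sym (⋆-cancelʳ P Q M m e []))))))
    w
    where
    open import Algebra.Properties.Group +-group using () renaming (∙-cancelˡ to +-cancelˡ)

  -- S L H E f P Q w sums over the subwords v of w: the letters of v are fed to f, the gaps before
  -- them are weighted by H and the last gap by E; P and Q are H and E after the part of the
  -- current gap already read.  The weight of a choice, without its last gap, is fed to L.
  S : (Carrier → Carrier) → W → W → W → W → W → W
  S L H E f P Q []      = L (f []) * Q []
  S L H E f P Q (z ∷ w) = S L H E f (∂ z P) (∂ z Q) w + S L H E (P [] · ∂ z f) H E w

  -- Word functions are formal power series in non-commuting letters, with product ⋆; Sub H f is f
  -- with H z substituted for each letter z.
  Sub : W → W → W
  Sub H f = S id H δ f H δ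

  S-cong : ∀ {L H H′ E E′ f f′ P P′ Q Q′} → (∀ {x y} → x ≈ y → L x ≈ L y)
         → H ≐ H′ → E ≐ E′ → f ≐ f′ → P ≐ P′ → Q ≐ Q′
         → S L H E f P Q ≐ S L H′ E′ f′ P′ Q′
  S-cong L h e f p q []      = *-cong (L (f [])) (q [])
  S-cong L h e f p q (z ∷ w) = +-cong
    (S-cong L h e f (λ v → p (z ∷ v)) (λ v → q (z ∷ v)) w)
    (S-cong L h e (λ v → *-cong (p []) (f (z ∷ v))) h e w)

  Sub-cong : ∀ {H H′ f f′} → H ≐ H′ → f ≐ f′ → Sub H f ≐ Sub H′ f′
  Sub-cong h f = S-cong {id} id h ≐-refl f h ≐-refl

  S-· : ∀ k H E f P Q → S id H E (k · f) P Q ≐ k · S id H E f P Q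
  S-· k H E f P Q []      = *-assoc _ _ _
  S-· k H E f P Q (z ∷ w) = trans (+-cong
      (S-· k H E f (∂ z P) (∂ z Q) w)
      (trans (S-cong {id} id (≐-refl {H}) (≐-refl {E}) (λ v → solve 3 (λ x y z → x :* (y :* z) := y :* (x :* z)) refl _ _ _) ≐-refl ≐-refl w)
             (S-· k H E (P [] · ∂ z f) H E w)))
    (sym (distribˡ _ _ _))

  S-⊞ : ∀ H E f g P Q → S id H E (f ⊞ g) P Q ≐ S id H E f P Q ⊞ S id H E g P Q
  S-⊞ H E f g P Q []      = distribʳ _ _ _
  S-⊞ H E f g P Q (z ∷ w) = trans (+-cong
      (S-⊞ H E f g (∂ z P) (∂ z Q) w)
      (trans (S-cong {id} id (≐-refl {H}) (≐-refl {E}) (λ v → distribˡ _ _ _) ≐-refl ≐-refl w)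
             (S-⊞ H E (P [] · ∂ z f) (P [] · ∂ z g) H E w)))
    (solve 4 (λ x y z t → (x :+ y) :+ (z :+ t) := (x :+ z) :+ (y :+ t)) refl _ _ _ _)

  Sub-· : ∀ H k f → Sub H (k · f) ≐ k · Sub H f
  Sub-· H k f = S-· k H δ f H δ

  Sub-⊞ : ∀ H f g → Sub H (f ⊞ g) ≐ Sub H f ⊞ Sub H g
  Sub-⊞ H f g = S-⊞ H δ f g H δ

  Sub-0 : ∀ H → Sub H 0ʷ ≐ 0ʷ
  Sub-0 H w = trans (Sub-cong {H} {H} {0ʷ} {0# · 0ʷ} ≐-refl (λ _ → sym (zeroˡ _)) w) (trans (Sub-· H 0# 0ʷ w) (zeroˡ _))

  -- The last gap is a suffix of the word, so its weight `E` factors out on the right. The exception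
  -- is the choice in which the running gap is itself the last one: it gives the summand with `Q`,
  -- and `0ʷ` in place of `Q` removes it from the remaining sum.
  S-split′ : ∀ L H E f P Q
           → S L H E f P Q ≐ (L (f []) · Q) ⊞ (S L H δ f P 0ʷ ⋆ E)
  S-split  : ∀ L H E f → S L H E f H E ≐ S L H δ f H δ ⋆ E

  S-split′ L H E f P Q []      = sym (trans (+-congˡ (trans (*-congʳ (zeroʳ _)) (zeroˡ _))) (+-identityʳ _))
  S-split′ L H E f P Q (z ∷ w) = begin
    S L H E f (∂ z P) (∂ z Q) w + S L H E (P [] · ∂ z f) H E w
      ≈⟨ +-cong (S-split′ L H E f (∂ z P) (∂ z Q) w) (S-split L H E (P [] · ∂ z f) w) ⟩
    (L (f []) * Q (z ∷ w) + A w) + B w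
      ≈⟨ solve 3 (λ x y z → (x :+ y) :+ z := x :+ (y :+ z)) refl _ _ _ ⟩
    L (f []) * Q (z ∷ w) + (A w + B w)
      ≈⟨ +-congˡ (⋆-distribʳ (S L H δ f (∂ z P) 0ʷ) (S L H δ (P [] · ∂ z f) H δ) E w) ⟨
    L (f []) * Q (z ∷ w) + (∂ z (S L H δ f P 0ʷ) ⋆ E) w
      ≈⟨ +-congˡ (trans (+-congʳ (trans (*-congʳ (zeroʳ _)) (zeroˡ _))) (+-identityˡ _)) ⟨
    L (f []) * Q (z ∷ w) + (S L H δ f P 0ʷ ⋆ E) (z ∷ w) ∎
    where
    open SetoidReasoning setoid
    A = S L H δ f (∂ z P) 0ʷ ⋆ E
    B = S L H δ (P [] · ∂ z f) H δ ⋆ E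

  S-split L H E f []      = *-congʳ (sym (*-identityʳ _))
  S-split L H E f (z ∷ w) = begin
    S L H E f (∂ z H) (∂ z E) w + S L H E (H [] · ∂ z f) H E w
      ≈⟨ +-cong (S-split′ L H E f (∂ z H) (∂ z E) w) (S-split L H E (H [] · ∂ z f) w) ⟩
    (L (f []) * E (z ∷ w) + A w) + B w
      ≈⟨ solve 3 (λ x y z → (x :+ y) :+ z := x :+ (y :+ z)) refl _ _ _ ⟩
    L (f []) * E (z ∷ w) + (A w + B w)
      ≈⟨ +-cong (*-congʳ (*-identityʳ _)) (⋆-distribʳ (S L H δ f (∂ z H) 0ʷ) (S L H δ (H [] · ∂ z f) H δ) E w) ⟨
    (S L H δ f H δ ⋆ E) (z ∷ w) ∎
    where
    open SetoidReasoning setoid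
    A = S L H δ f (∂ z H) 0ʷ ⋆ E
    B = S L H δ (H [] · ∂ z f) H δ ⋆ E

  record Linear (L : Carrier → Carrier) : Set (c Level.⊔ ℓ) where
    field
      L-cong : ∀ {x y} → x ≈ y → L x ≈ L y
      L-+    : ∀ x y → L (x + y) ≈ L x + L y
      L-0    : L 0# ≈ 0#

  -- `L` is only additive and, like integration, need not commute with multiplication. It can still
  -- be pulled out of the sum, because the weights of the last gap, given by `δ` and `0ʷ`, are just
  -- 0 and 1.
  S-linear : ∀ {L} → Linear L → ∀ H f → S L H δ f H δ ≐ λ w → L (Sub H f w)
  S-linear {L} lin H = λ f w → go f H δ last-δ w
    where
    open Linear lin
    Last : W → Set (c Level.⊔ ℓ)
    Last Q = ∀ v x → L (x * Q v) ≈ L x * Q v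
    last-0 : Last 0ʷ
    last-0 v x = trans (L-cong (zeroʳ _)) (trans L-0 (sym (zeroʳ _)))
    last-δ : Last δ
    last-δ []      x = trans (L-cong (*-identityʳ _)) (sym (*-identityʳ _))
    last-δ (_ ∷ v) x = last-0 v x
    go : ∀ f P Q → Last Q → ∀ w → S L H δ f P Q w ≈ L (S id H δ f P Q w)
    go f P Q l []      = sym (l [] _)
    go f P Q l (z ∷ w) = trans
      (+-cong (go f (∂ z P) (∂ z Q) (λ v x → l (z ∷ v) x) w) (go (P [] · ∂ z f) H δ last-δ w))
      (sym (L-+ _ _))

  -- Sorts the choices by the first chosen letter: either none is chosen, or the gap before it
  -- splits off on the left and the rest starts afresh. The occurrences of `S` on the right are at
  -- shorter words, so this is the recursion behind the inductions on `Sub`.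
  S-unfold : ∀ H E f P Q → S id H E f P Q ≐ (f [] · Q) ⊞ (P ⋆ D (λ z → S id H E (∂ z f) H E))
  S-unfold H E f P Q []      = sym (trans (+-congˡ (zeroʳ _)) (+-identityʳ _))
  S-unfold H E f P Q (z ∷ w) = trans
    (+-cong (S-unfold H E f (∂ z P) (∂ z Q) w) (S-· (P []) H E (∂ z f) H E w))
    (solve 3 (λ x y z → (x :+ y) :+ z := x :+ (z :+ y)) refl _ _ _)

  Sub-unfold : ∀ H f → Sub H f ≐ (f [] · δ) ⊞ (H ⋆ D (λ z → Sub H (∂ z f)))
  Sub-unfold H f = S-unfold H δ f H δ

  Sub-D : ∀ H F → Sub H (D F) ≐ H ⋆ D (λ z → Sub H (F z))
  Sub-D H F w = trans (Sub-unfold H (D F) w) (trans (+-congʳ (zeroˡ _)) (+-identityˡ _))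

  Sub-δ : ∀ H → Sub H δ ≐ δ
  Sub-δ H w = trans (Sub-unfold H δ w) (trans (+-cong (*-identityˡ _)
    (trans (⋆-congˡ {H} (λ { [] → refl ; (a ∷ v) → Sub-0 H v }) w) (⋆-zeroʳ H w))) (+-identityʳ _))

  -- By `Sub-unfold` both sides obey one recursion, because `∂ z` acts on a product by
  -- `P [] · ∂ z Q` plus `∂ z P ⋆ Q`. The induction runs over the word with P and Q free, as these
  -- change under `∂ z`.
  Sub-⋆ : ∀ H P Q → Sub H (P ⋆ Q) ≐ Sub H P ⋆ Sub H Q
  Sub-⋆ H P Q w = length-ind (λ w → ∀ P Q → Sub H (P ⋆ Q) w ≈ (Sub H P ⋆ Sub H Q) w) step w P Q
    where
    step : ∀ w → (∀ v → length v < length w → ∀ P Q → Sub H (P ⋆ Q) v ≈ (Sub H P ⋆ Sub H Q) v)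
         → ∀ P Q → Sub H (P ⋆ Q) w ≈ (Sub H P ⋆ Sub H Q) w
    step w ih P Q = begin
      Sub H (P ⋆ Q) w
        ≈⟨ Sub-unfold H (P ⋆ Q) w ⟩
      (P [] * Q []) * δ w + (H ⋆ D (λ z → Sub H (∂ z (P ⋆ Q)))) w
        ≈⟨ +-congˡ (⋆-cong< {H} w (λ _ _ → refl) (λ z v lt → trans (Sub-⊞ H (P [] · ∂ z Q) (∂ z P ⋆ Q) v)
             (+-cong (Sub-· H (P []) (∂ z Q) v) (ih v lt (∂ z P) Q)))) ⟩
      (P [] * Q []) * δ w + (H ⋆ D (λ z → (P [] · Sub H (∂ z Q)) ⊞ (Sub H (∂ z P) ⋆ Sub H Q))) w
        ≈⟨ +-congˡ (⋆-congˡ {H} (λ { [] → sym (trans (+-congʳ (zeroʳ _)) (+-identityʳ _)) ; (a ∷ v) → refl }) w) ⟩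
      (P [] * Q []) * δ w + (H ⋆ ((P [] · D DQ) ⊞ D (λ z → Sub H (∂ z P) ⋆ Sub H Q))) w
        ≈⟨ +-congˡ (trans (⋆-distribˡ H (P [] · D DQ) (D (λ z → Sub H (∂ z P) ⋆ Sub H Q)) w)
             (+-cong (⋆-· (P []) H (D DQ) w) (⋆-congˡ {H} (≐-sym (D-⋆ (λ z → Sub H (∂ z P)) (Sub H Q))) w))) ⟩
      (P [] * Q []) * δ w + (P [] * (H ⋆ D DQ) w + (H ⋆ (D DP ⋆ Sub H Q)) w)
        ≈⟨ solve 5 (λ p q d x y → (p :* q) :* d :+ (p :* x :+ y) := p :* (q :* d :+ x) :+ y) refl _ _ _ _ _ ⟩
      P [] * (Q [] * δ w + (H ⋆ D DQ) w) + (H ⋆ (D DP ⋆ Sub H Q)) w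
        ≈⟨ +-cong (*-congˡ (sym (Sub-unfold H Q w))) (sym (⋆-assoc H (D DP) (Sub H Q) w)) ⟩
      P [] * Sub H Q w + ((H ⋆ D DP) ⋆ Sub H Q) w
        ≈⟨ +-congʳ (trans (·-⋆ (P []) δ (Sub H Q) w) (*-congˡ (⋆-identityˡ (Sub H Q) w))) ⟨
      ((P [] · δ) ⋆ Sub H Q) w + ((H ⋆ D DP) ⋆ Sub H Q) w
        ≈⟨ ⋆-distribʳ (P [] · δ) (H ⋆ D DP) (Sub H Q) w ⟨
      (((P [] · δ) ⊞ (H ⋆ D DP)) ⋆ Sub H Q) w
        ≈⟨ ⋆-congʳ {Q = Sub H Q} (Sub-unfold H P) w ⟨
      (Sub H P ⋆ Sub H Q) w ∎
      where
      open SetoidReasoning setoid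
      DQ DP : ℕ → W
      DQ z = Sub H (∂ z Q)
      DP z = Sub H (∂ z P)

  -- A letter z first becomes G z; substituting into this gives `Sub H G` times H z. So composites
  -- are again substitutions, with series `Sub H G ⋆ H`, and the composite is the identity when this
  -- series is `δ`.
  Sub-∘ : ∀ G H f → Sub H (Sub G f) ≐ Sub (Sub H G ⋆ H) f
  Sub-∘ G H f w = length-ind (λ w → ∀ f → Sub H (Sub G f) w ≈ Sub G′ f w) step w f
    where
    G′ = Sub H G ⋆ H
    step : ∀ w → (∀ v → length v < length w → ∀ f → Sub H (Sub G f) v ≈ Sub G′ f v)
         → ∀ f → Sub H (Sub G f) w ≈ Sub G′ f w
    step w ih f = begin
      Sub H (Sub G f) w
        ≈⟨ Sub-cong {H} ≐-refl (Sub-unfold G f) w ⟩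
      Sub H ((f [] · δ) ⊞ (G ⋆ D (λ z → Sub G (∂ z f)))) w
        ≈⟨ Sub-⊞ H (f [] · δ) (G ⋆ D (λ z → Sub G (∂ z f))) w ⟩
      Sub H (f [] · δ) w + Sub H (G ⋆ D (λ z → Sub G (∂ z f))) w
        ≈⟨ +-cong (trans (Sub-· H (f []) δ w) (*-congˡ (Sub-δ H w))) (Sub-⋆ H G (D (λ z → Sub G (∂ z f))) w) ⟩
      f [] * δ w + (Sub H G ⋆ Sub H (D (λ z → Sub G (∂ z f)))) w
        ≈⟨ +-congˡ (⋆-congˡ {Sub H G} (Sub-D H (λ z → Sub G (∂ z f))) w) ⟩
      f [] * δ w + (Sub H G ⋆ (H ⋆ D (λ z → Sub H (Sub G (∂ z f))))) w
        ≈⟨ +-congˡ (⋆-assoc (Sub H G) H (D (λ z → Sub H (Sub G (∂ z f)))) w) ⟨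
      f [] * δ w + (G′ ⋆ D (λ z → Sub H (Sub G (∂ z f)))) w
        ≈⟨ +-congˡ (⋆-cong< {G′} {G′} w (λ _ _ → refl) (λ z v lt → ih v lt (∂ z f))) ⟩
      f [] * δ w + (G′ ⋆ D (λ z → Sub G′ (∂ z f))) w
        ≈⟨ Sub-unfold G′ f w ⟨
      Sub G′ f w ∎
      where open SetoidReasoning setoid

  Sub-δˡ : ∀ f → Sub δ f ≐ f
  Sub-δˡ f []      = *-identityʳ _
  Sub-δˡ f (z ∷ w) = trans (+-cong (vanish f w) (trans (S-· 1# δ δ (∂ z f) δ δ w) (trans (*-identityˡ _) (Sub-δˡ (∂ z f) w)))) (+-identityˡ _)
    where
    -- Skipping a letter makes the running gap nonempty, where `δ` has weight 0; nothing that
    -- follows can restore a nonzero weight.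
    vanish : ∀ f w → S id δ δ f 0ʷ 0ʷ w ≈ 0#
    vanish f []      = zeroʳ _
    vanish f (z ∷ w) = trans (+-cong (vanish f w) (trans (S-· 0# δ δ (∂ z f) δ δ w) (zeroˡ _))) (+-identityˡ _)

  Sub-cong≤ : ∀ {H H′} w → (∀ v → length v ≤ length w → H v ≈ H′ v) → ∀ f → Sub H f w ≈ Sub H′ f w
  Sub-cong≤ {H} {H′} = length-ind _ step
    where
    step : ∀ w → (∀ v → length v < length w → (∀ u → length u ≤ length v → H u ≈ H′ u) → ∀ f → Sub H f v ≈ Sub H′ f v)
         → (∀ u → length u ≤ length w → H u ≈ H′ u) → ∀ f → Sub H f w ≈ Sub H′ f w
    step w ih e f = trans (Sub-unfold H f w) (trans (+-congˡ
      (⋆-cong< {H} {H′} w (λ v lt → e v (ℕₚ.<⇒≤ lt)) (λ z v lt → ih v lt (λ u le → e u (ℕₚ.≤-trans le (ℕₚ.<⇒≤ lt))) (∂ z f))))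
      (sym (Sub-unfold H′ f w)))

  -- N P N = N = 1 N, and N can be cancelled on the right.
  ⋆-inverse-comm : ∀ P N → P [] ≈ 1# → N [] ≈ 1# → P ⋆ N ≐ δ → N ⋆ P ≐ δ
  ⋆-inverse-comm P N p n e = ⋆-cancelʳ (N ⋆ P) δ N n
    (≐-trans (⋆-assoc N P N) (≐-trans (⋆-congˡ {N} e) (≐-trans (⋆-identityʳ N) (≐-sym (⋆-identityˡ N)))))

  -- Inverse substitutions and the inversion of the moment equation

  module _ (M N : W) (r b ρ : ℕ → W)
           (M-eq : M ≐ δ ⊞ (D b ⋆ M)) (b-eq : ∀ a → b a ≐ Sub M (r a))
           (N-eq : (δ ⊞ D ρ) ⋆ N ≐ δ) where
    private
      1+0 : 1# + 0# ≈ 1#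
      1+0 = +-identityʳ _

      N[] : N [] ≈ 1#
      N[] = trans (sym (trans (*-congʳ 1+0) (*-identityˡ _))) (N-eq [])

      N-eqʳ : N ⊞ (N ⋆ D ρ) ≐ δ
      N-eqʳ = ≐-trans (⊞-cong (≐-sym (⋆-identityʳ N)) ≐-refl)
        (≐-trans (≐-sym (⋆-distribˡ N δ (D ρ))) (⋆-inverse-comm (δ ⊞ D ρ) N 1+0 N[] N-eq))

      -- By `Sub-∘`, the equation `X ⋆ N ≐ δ` makes `Sub N` undo `Sub M`; both inversion statements
      -- turn on it.
      X : W
      X = Sub N M

      -- This is `M-eq` after substitution of N, which is multiplicative. The family `s` is left
      -- open because `Sub N (b a)` is known as ρ in one application and as r in the other.
      X-eq : ∀ {s} → (∀ a → Sub N (b a) ≐ s a) → X ≐ δ ⊞ ((N ⋆ D s) ⋆ X)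
      X-eq {s} e = begin
        Sub N M                                 ≈⟨ Sub-cong {N} ≐-refl M-eq ⟩
        Sub N (δ ⊞ (D b ⋆ M))                   ≈⟨ Sub-⊞ N δ (D b ⋆ M) ⟩
        Sub N δ ⊞ Sub N (D b ⋆ M)                 ≈⟨ ⊞-cong (Sub-δ N) (Sub-⋆ N (D b) M) ⟩
        δ ⊞ (Sub N (D b) ⋆ X)                   ≈⟨ ⊞-cong ≐-refl (⋆-congʳ {Q = X} (≐-trans (Sub-D N b) (⋆-congˡ {N} (D-cong e)))) ⟩
        δ ⊞ ((N ⋆ D s) ⋆ X)                   ∎
        where open ≐-Reasoning

      Sub-b : X ⋆ N ≐ δ → ∀ a → Sub N (b a) ≐ r a
      Sub-b XN a = ≐-trans (Sub-cong {N} ≐-refl (b-eq a)) (≐-trans (Sub-∘ M N (r a))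
        (≐-trans (Sub-cong {X ⋆ N} {δ} XN ≐-refl) (Sub-δˡ (r a))))

    -- Multiplying N + N Dρ = 1 by X, and writing out X = 1 + N Dρ X, gives two expressions with the
    -- common term N Dρ X. Cancelling it leaves N X = 1, so the substitutions are inverse and the
    -- hypothesis on ρ can be read back as r.
    inversion : (∀ a → ρ a ≐ Sub N (b a)) → ∀ a → r a ≐ ρ a
    inversion ρ-eq a = ≐-sym (≐-trans (ρ-eq a) (Sub-b XN a))
      where
      NX : N ⋆ X ≐ δ
      NX w = +-cancelʳ _ _ _ (begin
        (N ⋆ X) w + ((N ⋆ D ρ) ⋆ X) w  ≈⟨ ⋆-distribʳ N (N ⋆ D ρ) X w ⟨
        ((N ⊞ (N ⋆ D ρ)) ⋆ X) w        ≈⟨ ⋆-congʳ {Q = X} N-eqʳ w ⟩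
        (δ ⋆ X) w                      ≈⟨ ⋆-identityˡ X w ⟩
        X w                            ≈⟨ X-eq (λ a → ≐-sym (ρ-eq a)) w ⟩
        δ w + ((N ⋆ D ρ) ⋆ X) w        ∎)
        where
        open SetoidReasoning setoid
        open import Algebra.Properties.Group +-group using () renaming (∙-cancelʳ to +-cancelʳ)
      XN : X ⋆ N ≐ δ
      XN = ⋆-inverse-comm N X N[] (trans (sym (trans (*-congʳ N[]) (*-identityˡ _))) (NX [])) NX

    -- With the inverse given, X = 1 + N Dr X multiplied by N on the right becomes 1 = N (1 + Dr).
    -- Hence 1 + Dr is a right inverse of N and 1 + Dρ a left inverse, and the two coincide.
    inversion-from-inverse : X ⋆ N ≐ δ → ∀ a → r a ≐ ρ a
    inversion-from-inverse XN a w = trans (sym (+-identityˡ _)) (trans (sym (same (a ∷ w))) (+-identityˡ _))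
      where
      N-r : N ⋆ (δ ⊞ D r) ≐ δ
      N-r = begin
        N ⋆ (δ ⊞ D r)                   ≈⟨ ⋆-distribˡ N δ (D r) ⟩
        (N ⋆ δ) ⊞ (N ⋆ D r)             ≈⟨ ⊞-cong (≐-trans (⋆-identityʳ N) (≐-sym (⋆-identityˡ N)))
                                                  (≐-sym (≐-trans (⋆-assoc (N ⋆ D r) X N)
                                                    (≐-trans (⋆-congˡ {N ⋆ D r} XN) (⋆-identityʳ (N ⋆ D r))))) ⟩
        (δ ⋆ N) ⊞ (((N ⋆ D r) ⋆ X) ⋆ N) ≈⟨ ⋆-distribʳ δ ((N ⋆ D r) ⋆ X) N ⟨
        (δ ⊞ ((N ⋆ D r) ⋆ X)) ⋆ N       ≈⟨ ⋆-congʳ {Q = N} (X-eq (Sub-b XN)) ⟨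
        X ⋆ N                           ≈⟨ XN ⟩
        δ                               ∎
        where open ≐-Reasoning
      same : δ ⊞ D ρ ≐ δ ⊞ D r
      same = begin
        δ ⊞ D ρ                         ≈⟨ ⋆-identityʳ (δ ⊞ D ρ) ⟨
        (δ ⊞ D ρ) ⋆ δ                   ≈⟨ ⋆-congˡ {δ ⊞ D ρ} N-r ⟨
        (δ ⊞ D ρ) ⋆ (N ⋆ (δ ⊞ D r))     ≈⟨ ⋆-assoc (δ ⊞ D ρ) N (δ ⊞ D r) ⟨
        ((δ ⊞ D ρ) ⋆ N) ⋆ (δ ⊞ D r)     ≈⟨ ⋆-congʳ {Q = δ ⊞ D r} N-eq ⟩
        δ ⋆ (δ ⊞ D r)                   ≈⟨ ⋆-identityˡ (δ ⊞ D r) ⟩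
        δ ⊞ D r                         ∎
        where open ≐-Reasoning

-- Polynomials

module Polynomials {c ℓ : Level} (K : CommutativeRing c ℓ) where
  open CommutativeRing K
  open Scalars K using (fromℕ; IsReciprocal)
  open import Algebra.Solver.Ring.NaturalCoefficients.Default commutativeSemiring
    using (solve; _:+_; _:*_; _:=_)
  open import Algebra.Properties.Ring ring using (-0#≈0#)

  Poly : Set c
  Poly = List Carrier

  coef : Poly → ℕ → Carrier
  coef []      _       = 0#
  coef (a ∷ p) zero    = a
  coef (a ∷ p) (suc n) = coef p n

  infix 4 _≈ᴾ_
  infixl 6 _+ᴾ_
  infixl 7 _*ᴾ_ _·ᴾ_

  -- Equality of coefficients identifies lists that differ by trailing zeros. Wrapping it in a
  -- record lets unification recover the two polynomials, which a bare function type would not.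
  record _≈ᴾ_ (p q : Poly) : Set ℓ where
    constructor ≈coef
    field coef≈ : ∀ n → coef p n ≈ coef q n
  open _≈ᴾ_ public

  _+ᴾ_ _*ᴾ_ : Poly → Poly → Poly
  _·ᴾ_ : Carrier → Poly → Poly
  -ᴾ_ shift : Poly → Poly

  []      +ᴾ q       = q
  (a ∷ p) +ᴾ []      = a ∷ p
  (a ∷ p) +ᴾ (b ∷ q) = (a + b) ∷ (p +ᴾ q)

  k ·ᴾ p = map (k *_) p
  -ᴾ p   = map -_ p
  shift p = 0# ∷ p

  []      *ᴾ q = []
  (a ∷ p) *ᴾ q = (a ·ᴾ q) +ᴾ shift (p *ᴾ q)

  coef-+ : ∀ p q n → coef (p +ᴾ q) n ≈ coef p n + coef q n
  coef-+ []      q       n       = sym (+-identityˡ _)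
  coef-+ (a ∷ p) []      n       = sym (+-identityʳ _)
  coef-+ (a ∷ p) (b ∷ q) zero    = refl
  coef-+ (a ∷ p) (b ∷ q) (suc n) = coef-+ p q n

  coef-· : ∀ k p n → coef (k ·ᴾ p) n ≈ k * coef p n
  coef-· k []      n       = sym (zeroʳ _)
  coef-· k (a ∷ p) zero    = refl
  coef-· k (a ∷ p) (suc n) = coef-· k p n

  coef-neg : ∀ p n → coef (-ᴾ p) n ≈ - coef p n
  coef-neg []      n       = sym -0#≈0#
  coef-neg (a ∷ p) zero    = refl
  coef-neg (a ∷ p) (suc n) = coef-neg p n

  ≈ᴾ-refl : ∀ {p} → p ≈ᴾ p
  ≈ᴾ-refl = ≈coef (λ _ → refl)
  ≈ᴾ-sym : ∀ {p q} → p ≈ᴾ q → q ≈ᴾ p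
  ≈ᴾ-sym e = ≈coef (λ n → sym (coef≈ e n))
  ≈ᴾ-trans : ∀ {p q r} → p ≈ᴾ q → q ≈ᴾ r → p ≈ᴾ r
  ≈ᴾ-trans e f = ≈coef (λ n → trans (coef≈ e n) (coef≈ f n))

  +ᴾ-cong : ∀ {p p′ q q′} → p ≈ᴾ p′ → q ≈ᴾ q′ → p +ᴾ q ≈ᴾ p′ +ᴾ q′
  +ᴾ-cong {p} {p′} {q} {q′} e f = ≈coef λ n →
    trans (coef-+ p q n) (trans (+-cong (coef≈ e n) (coef≈ f n)) (sym (coef-+ p′ q′ n)))

  ·ᴾ-cong : ∀ {k k′ p p′} → k ≈ k′ → p ≈ᴾ p′ → k ·ᴾ p ≈ᴾ k′ ·ᴾ p′
  ·ᴾ-cong {k} {k′} {p} {p′} e f = ≈coef λ n →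
    trans (coef-· k p n) (trans (*-cong e (coef≈ f n)) (sym (coef-· k′ p′ n)))

  shift-cong : ∀ {p q} → p ≈ᴾ q → shift p ≈ᴾ shift q
  shift-cong e = ≈coef λ { zero → refl ; (suc n) → coef≈ e n }

  neg-cong : ∀ {p q} → p ≈ᴾ q → -ᴾ p ≈ᴾ -ᴾ q
  neg-cong {p} {q} e = ≈coef λ n → trans (coef-neg p n) (trans (-‿cong (coef≈ e n)) (sym (coef-neg q n)))

  +ᴾ-comm : ∀ p q → p +ᴾ q ≈ᴾ q +ᴾ p
  +ᴾ-comm p q = ≈coef λ n → trans (coef-+ p q n) (trans (+-comm _ _) (sym (coef-+ q p n)))

  +ᴾ-assoc : ∀ p q r → (p +ᴾ q) +ᴾ r ≈ᴾ p +ᴾ (q +ᴾ r)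
  +ᴾ-assoc p q r = ≈coef λ n → trans (coef-+ (p +ᴾ q) r n) (trans (+-congʳ (coef-+ p q n))
    (trans (+-assoc _ _ _) (sym (trans (coef-+ p (q +ᴾ r) n) (+-congˡ (coef-+ q r n))))))

  +ᴾ-identityʳ : ∀ p → p +ᴾ [] ≈ᴾ p
  +ᴾ-identityʳ p = +ᴾ-comm p []

  +ᴾ-inverseˡ : ∀ p → (-ᴾ p) +ᴾ p ≈ᴾ []
  +ᴾ-inverseˡ p = ≈coef λ n → trans (coef-+ (-ᴾ p) p n) (trans (+-congʳ (coef-neg p n)) (-‿inverseˡ _))

  +ᴾ-medial : ∀ p q r s → (p +ᴾ q) +ᴾ (r +ᴾ s) ≈ᴾ (p +ᴾ r) +ᴾ (q +ᴾ s)
  +ᴾ-medial p q r s = ≈coef λ n →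
    trans (coef-+ (p +ᴾ q) (r +ᴾ s) n) (trans (+-cong (coef-+ p q n) (coef-+ r s n))
    (trans (solve 4 (λ x y z t → (x :+ y) :+ (z :+ t) := (x :+ z) :+ (y :+ t)) refl _ _ _ _)
    (sym (trans (coef-+ (p +ᴾ r) (q +ᴾ s) n) (+-cong (coef-+ p r n) (coef-+ q s n))))))

  ·ᴾ-distribˡ : ∀ k p q → k ·ᴾ (p +ᴾ q) ≈ᴾ k ·ᴾ p +ᴾ k ·ᴾ q
  ·ᴾ-distribˡ k p q = ≈coef λ n → trans (coef-· k (p +ᴾ q) n) (trans (*-congˡ (coef-+ p q n))
    (trans (distribˡ _ _ _) (sym (trans (coef-+ (k ·ᴾ p) (k ·ᴾ q) n) (+-cong (coef-· k p n) (coef-· k q n))))))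

  ·ᴾ-assoc : ∀ k l p → (k * l) ·ᴾ p ≈ᴾ k ·ᴾ (l ·ᴾ p)
  ·ᴾ-assoc k l p = ≈coef λ n → trans (coef-· (k * l) p n) (trans (*-assoc _ _ _)
    (sym (trans (coef-· k (l ·ᴾ p) n) (*-congˡ (coef-· l p n)))))

  ·ᴾ-zero : ∀ p → 0# ·ᴾ p ≈ᴾ []
  ·ᴾ-zero p = ≈coef λ n → trans (coef-· 0# p n) (zeroˡ _)

  ·ᴾ-identity : ∀ p → 1# ·ᴾ p ≈ᴾ p
  ·ᴾ-identity p = ≈coef λ n → trans (coef-· 1# p n) (*-identityˡ _)

  shift-+ : ∀ p q → shift (p +ᴾ q) ≈ᴾ shift p +ᴾ shift q
  shift-+ p q = ≈coef λ { zero → sym (+-identityˡ _) ; (suc n) → refl }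

  shift-· : ∀ k p → shift (k ·ᴾ p) ≈ᴾ k ·ᴾ shift p
  shift-· k p = ≈coef λ { zero → sym (zeroʳ _) ; (suc n) → refl }

  shift-[] : shift [] ≈ᴾ []
  shift-[] = ≈coef λ { zero → refl ; (suc n) → refl }

  *ᴾ-congˡ : ∀ p {q q′} → q ≈ᴾ q′ → p *ᴾ q ≈ᴾ p *ᴾ q′
  *ᴾ-congˡ []      e = ≈ᴾ-refl
  *ᴾ-congˡ (a ∷ p) {q} {q′} e = +ᴾ-cong (·ᴾ-cong {p = q} refl e) (shift-cong (*ᴾ-congˡ p e))

  *ᴾ-zeroʳ : ∀ p → p *ᴾ [] ≈ᴾ []
  *ᴾ-zeroʳ []      = ≈ᴾ-refl
  *ᴾ-zeroʳ (a ∷ p) = ≈ᴾ-trans (shift-cong (*ᴾ-zeroʳ p)) shift-[]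

  -- The definition of `_*ᴾ_` unfolds the left factor; this unfolds the right one, and commutativity
  -- follows by comparing the two.
  *ᴾ-∷ : ∀ p b q → p *ᴾ (b ∷ q) ≈ᴾ b ·ᴾ p +ᴾ shift (p *ᴾ q)
  *ᴾ-∷ []      b q = ≈ᴾ-sym shift-[]
  *ᴾ-∷ (a ∷ p) b q = ≈coef λ
    { zero → +-congʳ (*-comm _ _)
    ; (suc n) → coef≈ (≈ᴾ-trans (+ᴾ-cong {a ·ᴾ q} ≈ᴾ-refl (*ᴾ-∷ p b q))
        (≈ᴾ-trans (≈ᴾ-sym (+ᴾ-assoc (a ·ᴾ q) (b ·ᴾ p) (shift (p *ᴾ q))))
        (≈ᴾ-trans (+ᴾ-cong {q = shift (p *ᴾ q)} (+ᴾ-comm (a ·ᴾ q) (b ·ᴾ p)) ≈ᴾ-refl) (+ᴾ-assoc (b ·ᴾ p) (a ·ᴾ q) (shift (p *ᴾ q)))))) n }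

  *ᴾ-comm : ∀ p q → p *ᴾ q ≈ᴾ q *ᴾ p
  *ᴾ-comm []      q = ≈ᴾ-sym (*ᴾ-zeroʳ q)
  *ᴾ-comm (a ∷ p) q = ≈ᴾ-sym (≈ᴾ-trans (*ᴾ-∷ q a p) (+ᴾ-cong {a ·ᴾ q} ≈ᴾ-refl (shift-cong (*ᴾ-comm q p))))

  *ᴾ-cong : ∀ {p p′ q q′} → p ≈ᴾ p′ → q ≈ᴾ q′ → p *ᴾ q ≈ᴾ p′ *ᴾ q′
  *ᴾ-cong {p} {p′} {q} {q′} e f = ≈ᴾ-trans (*ᴾ-congˡ p f) (≈ᴾ-trans (*ᴾ-comm p q′)
    (≈ᴾ-trans (*ᴾ-congˡ q′ e) (*ᴾ-comm q′ p′)))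

  *ᴾ-distribˡ : ∀ p q r → p *ᴾ (q +ᴾ r) ≈ᴾ p *ᴾ q +ᴾ p *ᴾ r
  *ᴾ-distribˡ []      q r = ≈ᴾ-refl
  *ᴾ-distribˡ (a ∷ p) q r = ≈ᴾ-trans
    (+ᴾ-cong (·ᴾ-distribˡ a q r) (≈ᴾ-trans (shift-cong (*ᴾ-distribˡ p q r)) (shift-+ (p *ᴾ q) (p *ᴾ r))))
    (+ᴾ-medial (a ·ᴾ q) (a ·ᴾ r) (shift (p *ᴾ q)) (shift (p *ᴾ r)))

  *ᴾ-distribʳ : ∀ r p q → (p +ᴾ q) *ᴾ r ≈ᴾ p *ᴾ r +ᴾ q *ᴾ r
  *ᴾ-distribʳ r p q = ≈ᴾ-trans (*ᴾ-comm (p +ᴾ q) r) (≈ᴾ-trans (*ᴾ-distribˡ r p q)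
    (+ᴾ-cong (*ᴾ-comm r p) (*ᴾ-comm r q)))

  ·ᴾ-*ᴾ : ∀ k p q → (k ·ᴾ p) *ᴾ q ≈ᴾ k ·ᴾ (p *ᴾ q)
  ·ᴾ-*ᴾ k []      q = ≈ᴾ-refl
  ·ᴾ-*ᴾ k (a ∷ p) q = ≈ᴾ-trans
    (+ᴾ-cong (·ᴾ-assoc k a q) (≈ᴾ-trans (shift-cong (·ᴾ-*ᴾ k p q)) (shift-· k (p *ᴾ q))))
    (≈ᴾ-sym (·ᴾ-distribˡ k (a ·ᴾ q) (shift (p *ᴾ q))))

  shift-*ᴾ : ∀ p q → shift p *ᴾ q ≈ᴾ shift (p *ᴾ q)
  shift-*ᴾ p q = +ᴾ-cong (·ᴾ-zero q) ≈ᴾ-refl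

  *ᴾ-assoc : ∀ p q r → (p *ᴾ q) *ᴾ r ≈ᴾ p *ᴾ (q *ᴾ r)
  *ᴾ-assoc []      q r = ≈ᴾ-refl
  *ᴾ-assoc (a ∷ p) q r = ≈ᴾ-trans (*ᴾ-distribʳ r (a ·ᴾ q) (shift (p *ᴾ q)))
    (+ᴾ-cong (·ᴾ-*ᴾ a q r) (≈ᴾ-trans (shift-*ᴾ (p *ᴾ q) r) (shift-cong (*ᴾ-assoc p q r))))

  1ᴾ : Poly
  1ᴾ = 1# ∷ []

  *ᴾ-identityˡ : ∀ p → 1ᴾ *ᴾ p ≈ᴾ p
  *ᴾ-identityˡ p = ≈ᴾ-trans (+ᴾ-cong (·ᴾ-identity p) shift-[]) (+ᴾ-identityʳ p)

  polyRing : CommutativeRing c ℓ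
  polyRing = record
    { Carrier = Poly ; _≈_ = _≈ᴾ_ ; _+_ = _+ᴾ_ ; _*_ = _*ᴾ_ ; -_ = -ᴾ_ ; 0# = [] ; 1# = 1ᴾ
    ; isCommutativeRing = record
      { isRing = record
        { +-isAbelianGroup = record
          { isGroup = record
            { isMonoid = record
              { isSemigroup = record
                { isMagma = record
                  { isEquivalence = record { refl = ≈ᴾ-refl ; sym = ≈ᴾ-sym ; trans = ≈ᴾ-trans }
                  ; ∙-cong = +ᴾ-cong }
                ; assoc = +ᴾ-assoc }
              ; identity = (λ _ → ≈ᴾ-refl) , +ᴾ-identityʳ }
            ; inverse = +ᴾ-inverseˡ , (λ p → ≈ᴾ-trans (+ᴾ-comm p (-ᴾ p)) (+ᴾ-inverseˡ p))
            ; ⁻¹-cong = neg-cong }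
          ; comm = +ᴾ-comm }
        ; *-cong = *ᴾ-cong
        ; *-assoc = *ᴾ-assoc
        ; *-identity = *ᴾ-identityˡ , (λ p → ≈ᴾ-trans (*ᴾ-comm p 1ᴾ) (*ᴾ-identityˡ p))
        ; distrib = *ᴾ-distribˡ , *ᴾ-distribʳ }
      ; *-comm = *ᴾ-comm } }

  -- Differentiation and integration of polynomials

  d : Poly → Poly
  d []      = []
  d (a ∷ p) = p +ᴾ shift (d p)

  coef-d : ∀ p n → coef (d p) n ≈ fromℕ (suc n) * coef p (suc n)
  coef-d []      n       = sym (zeroʳ _)
  coef-d (a ∷ p) zero    = trans (coef-+ p (shift (d p)) 0) (trans (+-identityʳ _)
    (sym (trans (*-congʳ (+-identityʳ _)) (*-identityˡ _))))
  coef-d (a ∷ p) (suc n) = trans (coef-+ p (shift (d p)) (suc n)) (trans (+-cong (sym (*-identityˡ _)) (coef-d p n))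
    (sym (distribʳ _ _ _)))

  d-cong : ∀ {p q} → p ≈ᴾ q → d p ≈ᴾ d q
  d-cong {p} {q} e = ≈coef λ n → trans (coef-d p n) (trans (*-congˡ (coef≈ e (suc n))) (sym (coef-d q n)))

  d-+ : ∀ p q → d (p +ᴾ q) ≈ᴾ d p +ᴾ d q
  d-+ p q = ≈coef λ n → trans (coef-d (p +ᴾ q) n) (trans (*-congˡ (coef-+ p q (suc n)))
    (trans (distribˡ _ _ _) (sym (trans (coef-+ (d p) (d q) n) (+-cong (coef-d p n) (coef-d q n))))))

  d-· : ∀ k p → d (k ·ᴾ p) ≈ᴾ k ·ᴾ d p
  d-· k p = ≈coef λ n → trans (coef-d (k ·ᴾ p) n) (trans (*-congˡ (coef-· k p (suc n)))
    (trans (solve 3 (λ x y z → x :* (y :* z) := y :* (x :* z)) refl _ _ _) (sym (trans (coef-· k (d p) n) (*-congˡ (coef-d p n))))))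

  d-* : ∀ p q → d (p *ᴾ q) ≈ᴾ d p *ᴾ q +ᴾ p *ᴾ d q
  d-* []      q = ≈ᴾ-refl
  d-* (a ∷ p) q = begin
    d (a ·ᴾ q +ᴾ shift pq)                             ≈⟨ d-+ (a ·ᴾ q) (shift pq) ⟩
    d (a ·ᴾ q) +ᴾ (pq +ᴾ shift (d pq))                 ≈⟨ +ᴾ-cong (d-· a q) (+ᴾ-cong {pq} ≈ᴾ-refl
                                                          (≈ᴾ-trans (shift-cong (d-* p q)) (shift-+ (d p *ᴾ q) (p *ᴾ d q)))) ⟩
    a ·ᴾ d q +ᴾ (pq +ᴾ (shift (d p *ᴾ q) +ᴾ shift (p *ᴾ d q)))
      ≈⟨ solveᴾ 4 (λ x y z t → x ⊕ (y ⊕ (z ⊕ t)) ⊜ (y ⊕ z) ⊕ (x ⊕ t)) ≈ᴾ-refl (a ·ᴾ d q) pq (shift (d p *ᴾ q)) (shift (p *ᴾ d q)) ⟩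
    (pq +ᴾ shift (d p *ᴾ q)) +ᴾ (a ·ᴾ d q +ᴾ shift (p *ᴾ d q))
      ≈⟨ +ᴾ-cong (≈ᴾ-trans (*ᴾ-distribʳ q p (shift (d p))) (+ᴾ-cong {pq} ≈ᴾ-refl (shift-*ᴾ (d p) q))) (≈ᴾ-refl {a ·ᴾ d q +ᴾ shift (p *ᴾ d q)}) ⟨
    (p +ᴾ shift (d p)) *ᴾ q +ᴾ (a ·ᴾ d q +ᴾ shift (p *ᴾ d q)) ∎
    where
    pq = p *ᴾ q
    open SetoidReasoning (CommutativeRing.setoid polyRing)
    open import Algebra.Solver.Ring.NaturalCoefficients.Default (CommutativeRing.commutativeSemiring polyRing)
      using () renaming (solve to solveᴾ; _:+_ to _⊕_; _:=_ to _⊜_)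

  const : Carrier → Poly
  const a = a ∷ []

  mono : ℕ → Carrier → Poly
  mono zero    a = const a
  mono (suc n) a = shift (mono n a)

  mono-cong : ∀ n {a b} → a ≈ b → mono n a ≈ᴾ mono n b
  mono-cong zero    e = ≈coef λ { zero → e ; (suc _) → refl }
  mono-cong (suc n) e = shift-cong (mono-cong n e)

  mono-≡ : ∀ {m n a b} → m ≡ n → a ≈ b → mono m a ≈ᴾ mono n b
  mono-≡ {m} ≡.refl e = mono-cong m e

  const-* : ∀ k p → const k *ᴾ p ≈ᴾ k ·ᴾ p
  const-* k p = ≈ᴾ-trans (+ᴾ-cong {k ·ᴾ p} ≈ᴾ-refl shift-[]) (+ᴾ-identityʳ (k ·ᴾ p))

  mono-· : ∀ k n a → k ·ᴾ mono n a ≈ᴾ mono n (k * a)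
  mono-· k zero    a = ≈ᴾ-refl
  mono-· k (suc n) a = ≈ᴾ-trans (≈ᴾ-sym (shift-· k (mono n a))) (shift-cong (mono-· k n a))

  mono-* : ∀ m n a b → mono m a *ᴾ mono n b ≈ᴾ mono (m ℕ.+ n) (a * b)
  mono-* zero    n a b = ≈ᴾ-trans (const-* a (mono n b)) (mono-· a n b)
  mono-* (suc m) n a b = ≈ᴾ-trans (shift-*ᴾ (mono m a) (mono n b)) (shift-cong (mono-* m n a b))

  module Integration (recip : ℕ → Carrier) (is-recip : IsReciprocal recip) where

    recip-* : ∀ n → fromℕ (suc n) * recip (suc n) ≈ 1#
    recip-* n = is-recip (suc n) (λ ())

    -- The divisor k grows along the list. Starting it at 1 and shifting gives the antiderivative
    -- without constant term.
    J : ℕ → Poly → Poly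
    J k []      = []
    J k (a ∷ p) = recip k * a ∷ J (suc k) p

    ∫ : Poly → Poly
    ∫ p = shift (J 1 p)

    coef-J : ∀ k p n → coef (J k p) n ≈ recip (k ℕ.+ n) * coef p n
    coef-J k []      n       = sym (zeroʳ _)
    coef-J k (a ∷ p) zero    = reflexive (≡.cong (λ m → recip m * a) (≡.sym (ℕₚ.+-identityʳ k)))
    coef-J k (a ∷ p) (suc n) = trans (coef-J (suc k) p n)
      (reflexive (≡.cong (λ m → recip m * coef p n) (≡.sym (ℕₚ.+-suc k n))))

    ∫-cong : ∀ {p q} → p ≈ᴾ q → ∫ p ≈ᴾ ∫ q
    ∫-cong {p} {q} e = ≈coef λ { zero → refl
      ; (suc n) → trans (coef-J 1 p n) (trans (*-congˡ (coef≈ e n)) (sym (coef-J 1 q n))) }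

    ∫-+ : ∀ p q → ∫ (p +ᴾ q) ≈ᴾ ∫ p +ᴾ ∫ q
    ∫-+ p q = ≈coef λ { zero → sym (+-identityˡ _)
      ; (suc n) → trans (coef-J 1 (p +ᴾ q) n) (trans (*-congˡ (coef-+ p q n)) (trans (distribˡ _ _ _)
        (sym (trans (coef-+ (J 1 p) (J 1 q) n) (+-cong (coef-J 1 p n) (coef-J 1 q n)))))) }

    d-∫ : ∀ p → d (∫ p) ≈ᴾ p
    d-∫ p = ≈coef λ n → trans (coef-d (∫ p) n) (trans (*-congˡ (coef-J 1 p n))
      (trans (sym (*-assoc _ _ _)) (trans (*-congʳ (recip-* n)) (*-identityˡ _))))

    ∫-mono : ∀ n a → ∫ (mono n a) ≈ᴾ mono (suc n) (recip (suc n) * a)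
    ∫-mono n a = shift-cong (go n 1)
      where
      go : ∀ n k → J k (mono n a) ≈ᴾ mono n (recip (k ℕ.+ n) * a)
      go zero    k = mono-cong 0 (reflexive (≡.cong (λ m → recip m * a) (≡.sym (ℕₚ.+-identityʳ k))))
      go (suc n) k = ≈coef λ { zero → zeroʳ _
        ; (suc m) → trans (coef≈ (go n (suc k)) m)
            (reflexive (≡.cong (λ j → coef (mono n (recip j * a)) m) (≡.sym (ℕₚ.+-suc k n)))) }

    -- Positive integers are invertible, so the derivative determines every coefficient except the
    -- constant one.
    d-unique : ∀ p q → d p ≈ᴾ d q → coef p 0 ≈ coef q 0 → p ≈ᴾ q
    d-unique p q e e₀ = ≈coef λ { zero → e₀ ; (suc n) → begin
      coef p (suc n)                                       ≈⟨ unit n _ ⟨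
      recip (suc n) * (fromℕ (suc n) * coef p (suc n))     ≈⟨ *-congˡ (trans (sym (coef-d p n)) (trans (coef≈ e n) (coef-d q n))) ⟩
      recip (suc n) * (fromℕ (suc n) * coef q (suc n))     ≈⟨ unit n _ ⟩
      coef q (suc n)                                       ∎ }
      where
      open SetoidReasoning setoid
      unit : ∀ n x → recip (suc n) * (fromℕ (suc n) * x) ≈ x
      unit n x = trans (solve 3 (λ r f y → r :* (f :* y) := (f :* r) :* y) refl _ _ _)
        (trans (*-congʳ (recip-* n)) (*-identityˡ x))

-- Evaluation of polynomials

module Evaluation {c ℓ c′ ℓ′ : Level} (K : CommutativeRing c ℓ) (R : CommutativeRing c′ ℓ′)
  (ι : CommutativeRing.Carrier K → CommutativeRing.Carrier R)
  (ι-hom : IsRingHomomorphism (CommutativeRing.rawRing K) (CommutativeRing.rawRing R) ι)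
  (e : CommutativeRing.Carrier R) where
  private module K = CommutativeRing K
  open Polynomials K
  open CommutativeRing R
  open IsRingHomomorphism ι-hom
  open import Algebra.Solver.Ring.NaturalCoefficients.Default commutativeSemiring
    using (solve; _:+_; _:*_; _:=_)
  open import Algebra.Properties.Ring ring using (-0#≈0#; -‿distribʳ-*; -‿+-comm)

  -- Horner's scheme along the coefficient homomorphism `ι`. A general target ring lets the same
  -- construction give evaluation at a scalar and the substitution of s - 1 into polynomials.
  eval : Poly → Carrier
  eval []      = 0#
  eval (a ∷ p) = ι a + e * eval p

  eval-0 : ∀ p → p ≈ᴾ [] → eval p ≈ 0#
  eval-0 []      _ = refl
  eval-0 (a ∷ p) z = trans (+-cong (trans (⟦⟧-cong (coef≈ z 0)) 0#-homo)
    (trans (*-congˡ (eval-0 p (≈coef (λ n → coef≈ z (suc n))))) (zeroʳ _))) (+-identityˡ _)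

  eval-cong : ∀ {p q} → p ≈ᴾ q → eval p ≈ eval q
  eval-cong {[]}    {q}     z = sym (eval-0 q (≈ᴾ-sym z))
  eval-cong {a ∷ p} {[]}    z = eval-0 (a ∷ p) z
  eval-cong {a ∷ p} {b ∷ q} z = +-cong (⟦⟧-cong (coef≈ z 0)) (*-congˡ (eval-cong {p} {q} (≈coef (λ n → coef≈ z (suc n)))))

  eval-+ : ∀ p q → eval (p +ᴾ q) ≈ eval p + eval q
  eval-+ []      q       = sym (+-identityˡ _)
  eval-+ (a ∷ p) []      = sym (+-identityʳ _)
  eval-+ (a ∷ p) (b ∷ q) = trans (+-cong (+-homo a b) (*-congˡ (eval-+ p q)))
    (solve 5 (λ x y z t u → (x :+ y) :+ z :* (t :+ u) := (x :+ z :* t) :+ (y :+ z :* u)) refl _ _ _ _ _)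

  eval-· : ∀ k p → eval (k ·ᴾ p) ≈ ι k * eval p
  eval-· k []      = sym (zeroʳ _)
  eval-· k (a ∷ p) = trans (+-cong (*-homo k a) (*-congˡ (eval-· k p)))
    (solve 4 (λ x y z t → (x :* y) :+ z :* (x :* t) := x :* (y :+ z :* t)) refl _ _ _ _)

  eval-shift : ∀ p → eval (shift p) ≈ e * eval p
  eval-shift p = trans (+-congʳ 0#-homo) (+-identityˡ _)

  eval-* : ∀ p q → eval (p *ᴾ q) ≈ eval p * eval q
  eval-* []      q = sym (zeroˡ _)
  eval-* (a ∷ p) q = trans (eval-+ (a ·ᴾ q) (shift (p *ᴾ q)))
    (trans (+-cong (eval-· a q) (trans (eval-shift (p *ᴾ q)) (*-congˡ (eval-* p q))))
    (solve 4 (λ x y z t → x :* y :+ z :* (t :* y) := (x :+ z :* t) :* y) refl _ _ _ _))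

  eval-neg : ∀ p → eval (-ᴾ p) ≈ - eval p
  eval-neg []      = sym -0#≈0#
  eval-neg (a ∷ p) = trans (+-cong (-‿homo a) (trans (*-congˡ (eval-neg p)) (sym (-‿distribʳ-* _ _)))) (-‿+-comm _ _)

  eval-const : ∀ a → eval (const a) ≈ ι a
  eval-const a = trans (+-congˡ (zeroʳ _)) (+-identityʳ _)

  eval-hom : IsRingHomomorphism (CommutativeRing.rawRing polyRing) rawRing eval
  eval-hom = record
    { isSemiringHomomorphism = record
      { isNearSemiringHomomorphism = record
        { +-isMonoidHomomorphism = record
          { isMagmaHomomorphism = record
            { isRelHomomorphism = record { cong = λ {p} {q} → eval-cong {p} {q} }
            ; homo = eval-+ }
          ; ε-homo = refl }
        ; *-homo = eval-* }
      ; 1#-homo = trans (eval-const K.1#) 1#-homo }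
    ; -‿homo = eval-neg }

-- Non-crossing partitions

module NonCrossingPartitions where
  open import Data.Bool using (Bool; true; false; T; not; _∧_; if_then_else_)
  open import Data.Bool.ListAction using (all)
  open import Data.Bool.Properties using (T-∧)
  open import Data.List using (List; []; _∷_; [_]; _++_; map; concatMap; filterᵇ; length; upTo; foldr)
  open import Data.List.Properties using (++-assoc; ++-identityʳ; map-++; map-∘; map-id; map-concatMap; concatMap-map; filter-all; filter-none; filter-++; length-++)
  open import Data.List.Membership.Propositional using (_∈_; find; lose)
  open import Data.List.Membership.Propositional.Properties using (∈-++⁺ˡ; ∈-++⁺ʳ; ∈-++⁻; ∈-upTo⁺)
  open import Data.List.Relation.Unary.All.Properties using (all⁺; all⁻)
  open import Data.List.Relation.Unary.Any as Any using (Any; here; there)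
  open import Data.List.Relation.Unary.Any.Properties as Anyₚ using (any⁺; any⁻)
  open import Data.List.Relation.Unary.AllPairs as AllPairs using (AllPairs; []; _∷_)
  import Data.List.Relation.Unary.AllPairs.Properties as AllPairsₚ
  open import Data.Nat using (_+_; _*_; _<_; _≤ᵇ_; _⊓_; _⊔_)
  open import Data.Nat.Properties
  open import Data.Product using (uncurry)
  open import Data.Sum using (_⊎_; inj₁; inj₂; [_,_]′)
  open import Function using (Equivalence; _⇔_; mk⇔)
  open import Relation.Nullary using (¬_; yes; no)
  open import Relation.Nullary.Decidable using (T?)
  open import Relation.Binary.PropositionalEquality using (refl; sym; trans; subst)

  open Equivalence using (to; from)

  -- A non-crossing partition is a sequence of irreducible components.  node a g is the one whose
  -- first block starts with a: going through g, mid F x g′ puts the partition F before the next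
  -- element x of this block, and end F puts the remaining components after its last element.
  data Forest : Set
  data Gaps   : Set

  data Forest where
    ε    : Forest
    node : ℕ → Gaps → Forest

  data Gaps where
    end : Forest → Gaps
    mid : Forest → ℕ → Gaps → Gaps

  flatten : Forest → Partition
  block   : Gaps → Block
  blocks  : Gaps → Partition

  flatten ε          = []
  flatten (node a g) = (a ∷ block g) ∷ blocks g

  block (end F)     = []
  block (mid F x g) = x ∷ block g

  blocks (end F)     = flatten F
  blocks (mid F x g) = flatten F ++ blocks g

  -- A new largest element z can be added as a block of its own (singleton), to the block around g
  -- (close) or to the first block of a component (join); added to any other block, it would create
  -- a crossing.
  singleton  : ℕ → Forest → Forest
  singletonᴳ : ℕ → Gaps → Gaps
  singleton z ε          = node z (end ε)
  singleton z (node a g) = node a (singletonᴳ z g)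
  singletonᴳ z (end F)     = end (singleton z F)
  singletonᴳ z (mid F x g) = mid F x (singletonᴳ z g)

  close : ℕ → Gaps → Gaps
  close z (end F)     = mid F z (end ε)
  close z (mid F x g) = mid F x (close z g)

  join  : ℕ → Forest → List Forest
  joinᴳ : ℕ → Gaps → List Gaps
  join z ε          = []
  join z (node a g) = node a (close z g) ∷ map (node a) (joinᴳ z g)
  joinᴳ z (end F)     = map end (join z F)
  joinᴳ z (mid F x g) = map (mid F x) (joinᴳ z g)

  insert : ℕ → Forest → List Forest
  insert z F = singleton z F ∷ join z F

  forests : ℕ → List Forest
  forests zero    = [ ε ]
  forests (suc n) = concatMap (insert (suc n)) (forests n)

  -- Spans lo hi F : F is a partition of {lo, …, hi - 1}.
  data Spans  : ℕ → ℕ → Forest → Set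
  data Spansᴳ : ℕ → ℕ → Gaps → Set

  data Spans where
    ε    : ∀ {lo} → Spans lo lo ε
    node : ∀ {lo hi g} → Spansᴳ (suc lo) hi g → Spans lo hi (node lo g)

  data Spansᴳ where
    end : ∀ {lo hi F} → Spans lo hi F → Spansᴳ lo hi (end F)
    mid : ∀ {lo x hi F g} → Spans lo x F → Spansᴳ (suc x) hi g → Spansᴳ lo hi (mid F x g)

  spans-≤  : ∀ {lo hi F} → Spans lo hi F → lo ≤ hi
  spansᴳ-≤ : ∀ {lo hi g} → Spansᴳ lo hi g → lo ≤ hi
  spans-≤ ε        = ≤-refl
  spans-≤ (node g) = <⇒≤ (spansᴳ-≤ g)
  spansᴳ-≤ (end F)   = spans-≤ F
  spansᴳ-≤ (mid F g) = ≤-trans (spans-≤ F) (<⇒≤ (spansᴳ-≤ g))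

  singleton-spans  : ∀ {lo k F} → Spans lo k F → Spans lo (suc k) (singleton k F)
  singletonᴳ-spans : ∀ {lo k g} → Spansᴳ lo k g → Spansᴳ lo (suc k) (singletonᴳ k g)
  singleton-spans ε        = node (end ε)
  singleton-spans (node g) = node (singletonᴳ-spans g)
  singletonᴳ-spans (end F)   = end (singleton-spans F)
  singletonᴳ-spans (mid F g) = mid F (singletonᴳ-spans g)

  close-spans : ∀ {lo k g} → Spansᴳ lo k g → Spansᴳ lo (suc k) (close k g)
  close-spans (end F)   = mid F (end ε)
  close-spans (mid F g) = mid F (close-spans g)

  join-spans  : ∀ {lo k F} → Spans lo k F → All (Spans lo (suc k)) (join k F)
  joinᴳ-spans : ∀ {lo k g} → Spansᴳ lo k g → All (Spansᴳ lo (suc k)) (joinᴳ k g)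
  join-spans ε        = []
  join-spans (node g) = node (close-spans g) ∷ Allₚ.map⁺ (All.map node (joinᴳ-spans g))
  joinᴳ-spans (end F)   = Allₚ.map⁺ (All.map end (join-spans F))
  joinᴳ-spans (mid F g) = Allₚ.map⁺ (All.map (mid F) (joinᴳ-spans g))

  forests-spans : ∀ n → All (Spans 1 (suc n)) (forests n)
  forests-spans zero    = ε ∷ []
  forests-spans (suc n) = Allₚ.concat⁺ (Allₚ.map⁺ (All.map (λ s → singleton-spans s ∷ join-spans s) (forests-spans n)))

  flatten-singleton  : ∀ k F → flatten (singleton k F) ≡ flatten F ++ [ [ k ] ]
  blocks-singletonᴳ  : ∀ k g → blocks (singletonᴳ k g) ≡ blocks g ++ [ [ k ] ]
  block-singletonᴳ   : ∀ k g → block (singletonᴳ k g) ≡ block g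
  flatten-singleton k ε          = refl
  flatten-singleton k (node a g) = cong₂ (λ V π → (a ∷ V) ∷ π) (block-singletonᴳ k g) (blocks-singletonᴳ k g)
  blocks-singletonᴳ k (end F)     = flatten-singleton k F
  blocks-singletonᴳ k (mid F x g) = trans (cong (flatten F ++_) (blocks-singletonᴳ k g)) (sym (++-assoc (flatten F) _ _))
  block-singletonᴳ k (end F)     = refl
  block-singletonᴳ k (mid F x g) = cong (x ∷_) (block-singletonᴳ k g)

  block-close : ∀ k g → block (close k g) ≡ block g ++ [ k ]
  block-close k (end F)     = refl
  block-close k (mid F x g) = cong (x ∷_) (block-close k g)

  blocks-close : ∀ k g → blocks (close k g) ≡ blocks g
  blocks-close k (end F)     = ++-identityʳ _
  blocks-close k (mid F x g) = cong (flatten F ++_) (blocks-close k g)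

  block-joinᴳ : ∀ k g → All (λ g′ → block g′ ≡ block g) (joinᴳ k g)
  block-joinᴳ k (end F)     = Allₚ.map⁺ (All.universal (λ _ → refl) _)
  block-joinᴳ k (mid F x g) = Allₚ.map⁺ (All.map (cong (x ∷_)) (block-joinᴳ k g))

  -- Crossings

  record Cross (V W : Block) : Set where
    constructor crossing
    field
      {p q s t} : ℕ
      p∈V : p ∈ V
      q∈W : q ∈ W
      s∈V : s ∈ V
      t∈W : t ∈ W
      p<q : p < q
      q<s : q < s
      s<t : s < t

  crossesᵇ⇒ : ∀ V W → T (crossesᵇ V W) → Cross V W
  crossesᵇ⇒ V W h =
    let p , p∈V , h = find (any⁻ _ V h)
        q , q∈W , h = find (any⁻ _ W h)
        s , s∈V , h = find (any⁻ _ V h)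
        t , t∈W , h = find (any⁻ _ W h)
        pq , h      = to T-∧ h
        qs , st     = to T-∧ h
    in crossing p∈V q∈W s∈V t∈W (≤ᵇ⇒≤ _ _ pq) (≤ᵇ⇒≤ _ _ qs) (≤ᵇ⇒≤ _ _ st)

  ⇒crossesᵇ : ∀ {V W} → Cross V W → T (crossesᵇ V W)
  ⇒crossesᵇ (crossing p q s t pq qs st) =
    any⁺ _ (lose p (any⁺ _ (lose q (any⁺ _ (lose s (any⁺ _ (lose t
      (from T-∧ (≤⇒≤ᵇ pq , from T-∧ (≤⇒≤ᵇ qs , ≤⇒≤ᵇ st))))))))))

  -- `crossesᵇ` is not symmetric, and `isNCᵇ` tests every block against all others, hence each pair
  -- in both orders. `AllPairs` meets a pair only once, so both orders are put into the relation.
  Compatible : Block → Block → Set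
  Compatible V W = ¬ Cross V W × ¬ Cross W V

  NonCrossing : Partition → Set
  NonCrossing = AllPairs Compatible

  T-not : ∀ {b} → T (not b) ⇔ (¬ T b)
  T-not {true}  = mk⇔ (λ ()) (λ f → f _)
  T-not {false} = mk⇔ (λ _ ()) (λ _ → _)

  private
    Separate : Block × Partition → Set
    Separate (V , rest) = All (λ W → ¬ Cross V W) rest

    proj₁-select : ∀ {A : Set} (xs : List A) {P : A → Set} → All P xs ⇔ All (P ∘ proj₁) (select xs)
    proj₁-select []       = mk⇔ (λ _ → []) (λ _ → [])
    proj₁-select (x ∷ xs) = mk⇔
      (λ { (p ∷ ps) → p ∷ Allₚ.map⁺ (All.map id (to (proj₁-select xs) ps)) })
      (λ { (p ∷ ps) → p ∷ from (proj₁-select xs) (All.map id (Allₚ.map⁻ ps)) })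

    select⇒ : ∀ π → All Separate (select π) → NonCrossing π
    select⇒ []      _        = []
    select⇒ (V ∷ π) (h ∷ hs) =
      All.zip (h , from (proj₁-select π) (All.map (λ { (v ∷ _) → v }) (Allₚ.map⁻ hs)))
      ∷ select⇒ π (All.map (λ { (_ ∷ r) → r }) (Allₚ.map⁻ hs))

    ⇒select : ∀ {π} → NonCrossing π → All Separate (select π)
    ⇒select []       = []
    ⇒select (h ∷ hs) = All.map proj₁ h
      ∷ Allₚ.map⁺ (All.map (uncurry _∷_) (All.zip (to (proj₁-select _) (All.map proj₂ h) , ⇒select hs)))

  isNC⇔ : ∀ π → T (isNCᵇ π) ⇔ NonCrossing π
  isNC⇔ π = mk⇔
    (λ h → select⇒ π (All.map (λ {(V , _)} h → All.map (λ {W} n c → to T-not n (⇒crossesᵇ {V} {W} c)) (all⁺ _ _ h)) (all⁺ _ _ h)))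
    (λ h → all⁻ _ (All.map (λ {(V , _)} h → all⁻ _ (All.map (λ {W} n → from T-not (n ∘ crossesᵇ⇒ V W)) h)) (⇒select h)))

  Between : ℕ → ℕ → ℕ → Set
  Between lo hi w = lo ≤ w × w < hi

  between-weaken : ∀ {lo lo′ hi hi′ w} → lo′ ≤ lo → hi ≤ hi′ → Between lo hi w → Between lo′ hi′ w
  between-weaken l h (lw , wh) = ≤-trans l lw , ≤-trans wh h

  -- Either crossing pattern puts an element of V between two elements of W, hence into the range
  -- from lo to hi, where V has none.
  outside-compatible : ∀ {lo hi V W} → (∀ {v} → v ∈ V → v < lo ⊎ hi ≤ v) → All (Between lo hi) W → Compatible V W
  outside-compatible {lo} {hi} {V} {W} out inside =
    (λ (crossing _ q s t _ qs st) → absurd (out s) (≤-trans (proj₁ (All.lookup inside q)) (<⇒≤ qs)) (<-trans st (proj₂ (All.lookup inside t)))) ,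
    (λ (crossing p q s _ pq qs _) → absurd (out q) (≤-trans (proj₁ (All.lookup inside p)) (<⇒≤ pq)) (<-trans qs (proj₂ (All.lookup inside s))))
    where
    absurd : ∀ {v} → v < lo ⊎ hi ≤ v → lo ≤ v → ¬ v < hi
    absurd (inj₁ v<lo) lo≤v _    = <⇒≱ v<lo lo≤v
    absurd (inj₂ hi≤v) _    v<hi = <⇒≱ v<hi hi≤v

  -- The `Any` component says that the block is nonempty: an actual element is needed to exhibit a
  -- crossing or to locate the minimum and maximum.
  LiesIn : ℕ → ℕ → Block → Set
  LiesIn lo hi W = Any (Between lo hi) W × All (Between lo hi) W

  liesIn-weaken : ∀ {lo lo′ hi hi′ W} → lo′ ≤ lo → hi ≤ hi′ → LiesIn lo hi W → LiesIn lo′ hi′ W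
  liesIn-weaken l h (a , b) = Any.map (between-weaken l h) a , All.map (between-weaken l h) b

  block-between : ∀ {lo hi g} → Spansᴳ lo hi g → All (Between lo hi) (block g)
  block-between (end F)   = []
  block-between (mid F g) = (spans-≤ F , spansᴳ-≤ g)
    ∷ All.map (between-weaken (m≤n⇒m≤1+n (spans-≤ F)) ≤-refl) (block-between g)

  flatten-liesIn : ∀ {lo hi F} → Spans lo hi F → All (LiesIn lo hi) (flatten F)
  blocks-liesIn  : ∀ {lo hi g} → Spansᴳ lo hi g → All (LiesIn lo hi) (blocks g)
  flatten-liesIn ε        = []
  flatten-liesIn (node g) =
    (here (≤-refl , spansᴳ-≤ g) , (≤-refl , spansᴳ-≤ g) ∷ All.map (between-weaken (n≤1+n _) ≤-refl) (block-between g))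
    ∷ All.map (liesIn-weaken (n≤1+n _) ≤-refl) (blocks-liesIn g)
  blocks-liesIn (end F)   = flatten-liesIn F
  blocks-liesIn (mid F g) = Allₚ.++⁺
    (All.map (liesIn-weaken ≤-refl (<⇒≤ (spansᴳ-≤ g))) (flatten-liesIn F))
    (All.map (liesIn-weaken (m≤n⇒m≤1+n (spans-≤ F)) ≤-refl) (blocks-liesIn g))

  separated-compatible : ∀ {lo x hi π ρ} → All (All (Between lo x)) π → All (All (Between x hi)) ρ
                       → All (λ V → All (Compatible V) ρ) π
  separated-compatible l r = All.map (λ v → All.map (outside-compatible (λ m → inj₁ (proj₂ (All.lookup v m)))) r) l

  between-flatten : ∀ {lo hi F} → Spans lo hi F → All (All (Between lo hi)) (flatten F)
  between-flatten F = All.map proj₂ (flatten-liesIn F)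

  between-blocks : ∀ {lo hi g} → Spansᴳ lo hi g → All (All (Between lo hi)) (blocks g)
  between-blocks g = All.map proj₂ (blocks-liesIn g)

  flatten-nonCrossing : ∀ {lo hi F} → Spans lo hi F → NonCrossing (flatten F)
  -- V is more general than the block around g: it may contain elements before lo, which arise as
  -- the recursion moves along the gaps, and elements from hi on, which arise when a new largest
  -- element has been appended to it.
  blocks-nonCrossing  : ∀ {lo hi g V} → Spansᴳ lo hi g → (∀ {v} → v ∈ V → v < lo ⊎ v ∈ block g ⊎ hi ≤ v)
                      → NonCrossing (V ∷ blocks g)
  flatten-nonCrossing ε        = []
  flatten-nonCrossing (node g) = blocks-nonCrossing g λ { (here refl) → inj₁ ≤-refl ; (there m) → inj₂ (inj₁ m) }
  blocks-nonCrossing {lo} {hi} {g} {V} (end F) v =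
    All.map (outside-compatible out) (between-flatten F) ∷ flatten-nonCrossing F
    where
    out : ∀ {x} → x ∈ V → x < lo ⊎ hi ≤ x
    out m with v m
    ... | inj₁ l         = inj₁ l
    ... | inj₂ (inj₂ h)  = inj₂ h
  blocks-nonCrossing {lo} {hi} {mid _ x _} {V} (mid F g) v with blocks-nonCrossing {V = V} g in-rest
    where
    in-rest : ∀ {y} → y ∈ V → y < suc x ⊎ _ ⊎ hi ≤ y
    in-rest m with v m
    ... | inj₁ l                   = inj₁ (m≤n⇒m≤1+n (≤-trans l (spans-≤ F)))
    ... | inj₂ (inj₁ (here refl))  = inj₁ ≤-refl
    ... | inj₂ (inj₁ (there y∈))   = inj₂ (inj₁ y∈)
    ... | inj₂ (inj₂ h)            = inj₂ (inj₂ h)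
  ... | c ∷ nc =
    Allₚ.++⁺ (All.map (outside-compatible out) (between-flatten F)) c
    ∷ AllPairsₚ.++⁺ (flatten-nonCrossing F) nc
        (separated-compatible (All.map (All.map (between-weaken ≤-refl (n≤1+n x))) (between-flatten F)) (between-blocks g))
    where
    out : ∀ {y} → y ∈ V → y < lo ⊎ x ≤ y
    out m with v m
    ... | inj₁ l                   = inj₁ l
    ... | inj₂ (inj₁ (here refl))  = inj₂ ≤-refl
    ... | inj₂ (inj₁ (there y∈))   = inj₂ (<⇒≤ (proj₁ (All.lookup (block-between g) y∈)))
    ... | inj₂ (inj₂ h)            = inj₂ (≤-trans (<⇒≤ (spansᴳ-≤ g)) h)

  module _ {A : Set} where

    filterᵇ-local : ∀ {p q : A → Bool} {xs} → All (λ x → T (p x) ⇔ T (q x)) xs → filterᵇ p xs ≡ filterᵇ q xs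
    filterᵇ-local [] = refl
    filterᵇ-local {p} {q} {x ∷ xs} (e ∷ es) with p x | q x
    ... | true  | true  = cong (x ∷_) (filterᵇ-local es)
    ... | false | false = filterᵇ-local es
    ... | true  | false = ⊥-elim (to e _)
    ... | false | true  = ⊥-elim (from e _)

    filterᵇ-map : ∀ {B : Set} (f : B → A) {p : A → Bool} xs → filterᵇ p (map f xs) ≡ map f (filterᵇ (p ∘ f) xs)
    filterᵇ-map f     []       = refl
    filterᵇ-map f {p} (x ∷ xs) with p (f x)
    ... | true  = cong (f x ∷_) (filterᵇ-map f xs)
    ... | false = filterᵇ-map f xs

    filterᵇ-∧ : ∀ (p q : A → Bool) xs → filterᵇ (λ x → p x ∧ q x) xs ≡ filterᵇ q (filterᵇ p xs)
    filterᵇ-∧ p q [] = refl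
    filterᵇ-∧ p q (x ∷ xs) with p x
    ... | false = filterᵇ-∧ p q xs
    ... | true with q x
    ... | true  = cong (x ∷_) (filterᵇ-∧ p q xs)
    ... | false = filterᵇ-∧ p q xs

    filterᵇ-++ : ∀ (p : A → Bool) xs ys → filterᵇ p (xs ++ ys) ≡ filterᵇ p xs ++ filterᵇ p ys
    filterᵇ-++ p = filter-++ (T? ∘ p)

    filterᵇ-none : ∀ (p : A → Bool) {xs} → All (λ x → ¬ T (p x)) xs → filterᵇ p xs ≡ []
    filterᵇ-none p = filter-none (T? ∘ p)

    filterᵇ-all : ∀ (p : A → Bool) {xs} → All (λ x → T (p x)) xs → filterᵇ p xs ≡ xs
    filterᵇ-all p = filter-all (T? ∘ p)

    filterᵇ-accept : ∀ (p : A → Bool) {x} xs → T (p x) → filterᵇ p (x ∷ xs) ≡ x ∷ filterᵇ p xs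
    filterᵇ-accept p {x} xs h with p x
    ... | true = refl

    filterᵇ-reject : ∀ (p : A → Bool) {x} xs → ¬ T (p x) → filterᵇ p (x ∷ xs) ≡ filterᵇ p xs
    filterᵇ-reject p {x} xs h with p x
    ... | true  = ⊥-elim (h _)
    ... | false = refl

    filterᵇ-concatMap : ∀ {B : Set} (p : A → Bool) (q : B → Bool) (f : B → List A) xs
                      → All (λ x → ¬ T (q x) → filterᵇ p (f x) ≡ []) xs
                      → filterᵇ p (concatMap f xs) ≡ concatMap (filterᵇ p ∘ f) (filterᵇ q xs)
    filterᵇ-concatMap p q f []       []       = refl
    filterᵇ-concatMap p q f (x ∷ xs) (e ∷ h) with q x
    ... | true  = trans (filterᵇ-++ p (f x) _) (cong (_ ++_) (filterᵇ-concatMap p q f xs h))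
    ... | false = trans (filterᵇ-++ p (f x) _) (cong₂ _++_ (e id) (filterᵇ-concatMap p q f xs h))

    concatMap-local : ∀ {B : Set} {f g : B → List A} {xs} → All (λ x → f x ≡ g x) xs → concatMap f xs ≡ concatMap g xs
    concatMap-local []       = refl
    concatMap-local (e ∷ es) = cong₂ _++_ e (concatMap-local es)

    map-local : ∀ {B : Set} {f g : B → A} {xs} → All (λ x → f x ≡ g x) xs → map f xs ≡ map g xs
    map-local []       = refl
    map-local (e ∷ es) = cong₂ _∷_ e (map-local es)

  -- Adding a largest element without creating a crossing

  extend-++ : ∀ k π ρ → extend k (π ++ ρ) ≡ map (_++ ρ) (extend k π) ++ map (π ++_) (extend k ρ)
  extend-++ k []      ρ = sym (map-id (extend k ρ))
  extend-++ k (B ∷ π) ρ = cong (((B ++ [ k ]) ∷ π ++ ρ) ∷_) (begin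
    map (B ∷_) (extend k (π ++ ρ))                                             ≡⟨ cong (map (B ∷_)) (extend-++ k π ρ) ⟩
    map (B ∷_) (map (_++ ρ) (extend k π) ++ map (π ++_) (extend k ρ))          ≡⟨ map-++ (B ∷_) (map (_++ ρ) (extend k π)) _ ⟩
    map (B ∷_) (map (_++ ρ) (extend k π)) ++ map (B ∷_) (map (π ++_) (extend k ρ))
      ≡⟨ cong₂ _++_ (trans (sym (map-∘ (extend k π))) (map-∘ (extend k π))) (sym (map-∘ (extend k ρ))) ⟩
    map (_++ ρ) (map (B ∷_) (extend k π)) ++ map ((B ∷ π) ++_) (extend k ρ)    ∎)
    where open ≡-Reasoning

  extend-between : ∀ {lo k} π → lo ≤ k → All (All (Between lo k)) π → All (All (All (Between lo (suc k)))) (extend k π)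
  extend-between []      _ []       = []
  extend-between (B ∷ π) l (b ∷ bs) =
    (Allₚ.++⁺ (All.map (between-weaken ≤-refl (n≤1+n _)) b) ((l , ≤-refl) ∷ []) ∷ All.map (All.map (between-weaken ≤-refl (n≤1+n _))) bs)
    ∷ Allₚ.map⁺ (All.map (All.map (between-weaken ≤-refl (n≤1+n _)) b ∷_) (extend-between π l bs))

  -- The situation of the gaps g of a block V: they start at lo, after some element of V.
  record Enclosing (V : Block) (lo : ℕ) (g : Gaps) : Set where
    field
      {first}  : ℕ
      first∈   : first ∈ V
      first<   : first < lo
      block⊆   : ∀ {v} → v ∈ block g → v ∈ V
      classify : ∀ {v} → v ∈ V → v < lo ⊎ v ∈ block g

  enclosing-mid : ∀ {V lo x F g} → lo ≤ x → Enclosing V lo (mid F x g) → Enclosing V (suc x) g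
  enclosing-mid l e = record
    { first∈ = first∈ ; first< = m≤n⇒m≤1+n (≤-trans first< l) ; block⊆ = block⊆ ∘ there
    ; classify = λ m → [ (λ v< → inj₁ (m≤n⇒m≤1+n (≤-trans v< l))) , (λ { (here refl) → inj₁ ≤-refl ; (there m) → inj₂ m }) ]′ (classify m) }
    where open Enclosing e

  enclosing-node : ∀ {a g} → Enclosing (a ∷ block g) (suc a) g
  enclosing-node = record
    { first∈ = here refl ; first< = ≤-refl ; block⊆ = there
    ; classify = λ { (here refl) → inj₁ ≤-refl ; (there m) → inj₂ m } }

  -- The crossing is v < w < x < k, with v and x in V, w an element of the extended block and k the
  -- new one.
  extend-crosses : ∀ {V lo x k} π → (∃[ v ] (v ∈ V × v < lo)) → x ∈ V → x < k → All (LiesIn lo x) π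
                 → All (Any (Cross V)) (extend k π)
  extend-crosses []      _ _ _ _ = []
  extend-crosses (B ∷ π) v x∈ x<k ((b , _) ∷ bs) with find b | v
  ... | w , w∈ , lo≤w , w<x | v , v∈ , v<lo =
    here (crossing v∈ (∈-++⁺ˡ w∈) x∈ (∈-++⁺ʳ B (here refl)) (≤-trans v<lo lo≤w) w<x x<k)
    ∷ Allₚ.map⁺ (All.map there (extend-crosses π (v , v∈ , v<lo) x∈ x<k bs))

  -- `join` visits the admissible blocks in the order of `extend`, so the enumerations agree as
  -- lists and no permutation has to be tracked.
  filter-extend : ∀ {lo k F} → Spans lo k F → filterᵇ isNCᵇ (extend k (flatten F)) ≡ map flatten (join k F)
  filter-extendᴳ : ∀ {lo k V g} → Spansᴳ lo k g → Enclosing V lo g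
                 → filterᵇ (isNCᵇ ∘ (V ∷_)) (extend k (blocks g)) ≡ map blocks (joinᴳ k g)

  filter-extend ε = refl
  filter-extend {k = k} {F = node a g} (node s) = begin
    filterᵇ isNCᵇ (((V ++ [ k ]) ∷ blocks g) ∷ map (V ∷_) (extend k (blocks g)))
      ≡⟨ filterᵇ-accept isNCᵇ _ (from (isNC⇔ ((V ++ [ k ]) ∷ blocks g)) (blocks-nonCrossing s position)) ⟩
    ((V ++ [ k ]) ∷ blocks g) ∷ filterᵇ isNCᵇ (map (V ∷_) (extend k (blocks g)))
      ≡⟨ cong₂ _∷_ (sym (cong₂ (λ v π → (a ∷ v) ∷ π) (block-close k g) (blocks-close k g))) (filterᵇ-map (V ∷_) (extend k (blocks g))) ⟩
    flatten (node a (close k g)) ∷ map (V ∷_) (filterᵇ (isNCᵇ ∘ (V ∷_)) (extend k (blocks g)))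
      ≡⟨ cong (λ πs → flatten (node a (close k g)) ∷ map (V ∷_) πs) (filter-extendᴳ s enclosing-node) ⟩
    flatten (node a (close k g)) ∷ map (V ∷_) (map blocks (joinᴳ k g))
      ≡⟨ cong (flatten (node a (close k g)) ∷_) (trans (sym (map-∘ (joinᴳ k g))) (trans
           (map-local (All.map (λ {g′} e → cong (λ v → (a ∷ v) ∷ blocks g′) (sym e)) (block-joinᴳ k g))) (map-∘ (joinᴳ k g)))) ⟩
    map flatten (join k (node a g)) ∎
    where
    open ≡-Reasoning
    V = a ∷ block g
    position : ∀ {v} → v ∈ V ++ [ k ] → v < suc a ⊎ v ∈ block g ⊎ k ≤ v
    position m with ∈-++⁻ V m
    ... | inj₁ (here refl) = inj₁ ≤-refl
    ... | inj₁ (there v∈)  = inj₂ (inj₁ v∈)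
    ... | inj₂ (here refl) = inj₂ (inj₂ ≤-refl)
  filter-extendᴳ {lo} {k} {V} {end F} (end s) e = begin
    filterᵇ (isNCᵇ ∘ (V ∷_)) (extend k (flatten F))
      ≡⟨ filterᵇ-local (All.map (λ {π} r → mk⇔
           (λ h → from (isNC⇔ π) (AllPairs.tail (to (isNC⇔ (V ∷ π)) h)))
           (λ h → from (isNC⇔ (V ∷ π)) (All.map (outside-compatible below) r ∷ to (isNC⇔ π) h)))
           (extend-between (flatten F) (spans-≤ s) (between-flatten s))) ⟩
    filterᵇ isNCᵇ (extend k (flatten F))        ≡⟨ filter-extend s ⟩
    map flatten (join k F)                      ≡⟨ map-∘ (join k F) ⟩
    map blocks (map end (join k F))             ∎
    where
    open ≡-Reasoning
    below : ∀ {v} → v ∈ V → v < lo ⊎ suc k ≤ v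
    below m with Enclosing.classify e m
    ... | inj₁ l = inj₁ l
  filter-extendᴳ {lo} {k} {V} {mid F x g} (mid s t) e = begin
    filterᵇ p (extend k (flatten F ++ blocks g))
      ≡⟨ cong (filterᵇ p) (extend-++ k (flatten F) (blocks g)) ⟩
    filterᵇ p (map (_++ blocks g) (extend k (flatten F)) ++ map (flatten F ++_) (extend k (blocks g)))
      ≡⟨ filterᵇ-++ p (map (_++ blocks g) (extend k (flatten F))) _ ⟩
    filterᵇ p (map (_++ blocks g) (extend k (flatten F))) ++ filterᵇ p (map (flatten F ++_) (extend k (blocks g)))
      -- A block in the gap before x is trapped between two elements of V; appending k to it crosses
      -- V, so this half of the list disappears.
      ≡⟨ cong₂ _++_ (filterᵇ-none p (Allₚ.map⁺ (All.map inner-crosses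
           (extend-crosses (flatten F) (_ , first∈ , first<) (block⊆ (here refl)) (spansᴳ-≤ t) (flatten-liesIn s)))))
           (filterᵇ-map (flatten F ++_) (extend k (blocks g))) ⟩
    map (flatten F ++_) (filterᵇ (p ∘ (flatten F ++_)) (extend k (blocks g)))
      -- The unchanged blocks of F cross neither V nor anything after x, so they can be left out of
      -- the test.
      ≡⟨ cong (map (flatten F ++_)) (filterᵇ-local (All.map drop-gap
           (extend-between (blocks g) (spansᴳ-≤ t) (between-blocks t)))) ⟩
    map (flatten F ++_) (filterᵇ p (extend k (blocks g)))
      ≡⟨ cong (map (flatten F ++_)) (filter-extendᴳ t (enclosing-mid (spans-≤ s) e)) ⟩
    map (flatten F ++_) (map blocks (joinᴳ k g))
      ≡⟨ trans (sym (map-∘ (joinᴳ k g))) (map-∘ (joinᴳ k g)) ⟩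
    map blocks (map (mid F x) (joinᴳ k g)) ∎
    where
    open ≡-Reasoning
    open Enclosing e
    p = isNCᵇ ∘ (V ∷_)
    inner-crosses : ∀ {π} → Any (Cross V) π → ¬ T (p (π ++ blocks g))
    inner-crosses {π} c h with to (isNC⇔ (V ∷ π ++ blocks g)) h
    ... | nc ∷ _ with find c
    ... | W , W∈ , cr = proj₁ (All.lookup nc (∈-++⁺ˡ W∈)) cr
    position : ∀ {v} → v ∈ V → v < lo ⊎ x ≤ v
    position m with classify m
    ... | inj₁ l            = inj₁ l
    ... | inj₂ (here refl)  = inj₂ ≤-refl
    ... | inj₂ (there v∈)   = inj₂ (<⇒≤ (proj₁ (All.lookup (block-between t) v∈)))
    drop-gap : ∀ {π} → All (All (Between (suc x) (suc k))) π → T (p (flatten F ++ π)) ⇔ T (p π)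
    drop-gap {π} r = mk⇔
      (λ h → from (isNC⇔ (V ∷ π)) (drop (flatten F) (to (isNC⇔ (V ∷ flatten F ++ π)) h)))
      (λ h → from (isNC⇔ (V ∷ flatten F ++ π)) (add (to (isNC⇔ (V ∷ π)) h)))
      where
      drop : ∀ ρ → NonCrossing (V ∷ ρ ++ π) → NonCrossing (V ∷ π)
      drop []      h                  = h
      drop (_ ∷ ρ) ((_ ∷ v) ∷ _ ∷ h)  = drop ρ (v ∷ h)
      add : NonCrossing (V ∷ π) → NonCrossing (V ∷ flatten F ++ π)
      add (v ∷ h) = Allₚ.++⁺ (All.map (outside-compatible position) (between-flatten s)) v
        ∷ AllPairsₚ.++⁺ (flatten-nonCrossing s) h
            (separated-compatible (All.map (All.map (between-weaken ≤-refl (n≤1+n x))) (between-flatten s)) r)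

  cross-extendˡ : ∀ {V W} k → Cross V W → Cross (V ++ [ k ]) W
  cross-extendˡ k (crossing p q s t a b c) = crossing (∈-++⁺ˡ p) q (∈-++⁺ˡ s) t a b c

  cross-extendʳ : ∀ {V W} k → Cross V W → Cross V (W ++ [ k ])
  cross-extendʳ k (crossing p q s t a b c) = crossing p (∈-++⁺ˡ q) s (∈-++⁺ˡ t) a b c

  extend-compatible : ∀ {V} k π → All (λ π′ → All (Compatible V) π′ → All (Compatible V) π) (extend k π)
  extend-compatible k []      = []
  extend-compatible k (B ∷ π) =
    (λ { ((a , b) ∷ cs) → (a ∘ cross-extendʳ k , b ∘ cross-extendˡ k) ∷ cs })
    ∷ Allₚ.map⁺ (All.map (λ { h (c ∷ cs) → c ∷ h cs }) (extend-compatible k π))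

  -- A crossing survives the addition of an element. Read contrapositively, a crossing partition has
  -- no non-crossing descendant, which allows filtering at each stage of the enumeration.
  extend-nonCrossing : ∀ k π → All (λ π′ → NonCrossing π′ → NonCrossing π) (extend k π)
  extend-nonCrossing k []      = []
  extend-nonCrossing k (B ∷ π) =
    (λ { (b ∷ h) → All.map (λ (x , y) → x ∘ cross-extendˡ k , y ∘ cross-extendʳ k) b ∷ h })
    ∷ Allₚ.map⁺ (All.map (λ { (c , h) (b ∷ bs) → c b ∷ h bs }) (All.zip (extend-compatible k π , extend-nonCrossing k π)))

  snoc-nonCrossing : ∀ π W → NonCrossing (π ++ [ W ]) → NonCrossing π
  snoc-nonCrossing []      W _       = []
  snoc-nonCrossing (V ∷ π) W (v ∷ h) = Allₚ.++⁻ˡ π v ∷ snoc-nonCrossing π W h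

  NC-forests : ∀ n → NC n ≡ map flatten (forests n)
  NC-forests zero    = refl
  NC-forests (suc n) = begin
    filterᵇ isNCᵇ (concatMap children (partitions n))           ≡⟨ filterᵇ-concatMap isNCᵇ isNCᵇ children (partitions n) (All.universal none _) ⟩
    concatMap (filterᵇ isNCᵇ ∘ children) (NC n)                 ≡⟨ cong (concatMap (filterᵇ isNCᵇ ∘ children)) (NC-forests n) ⟩
    concatMap (filterᵇ isNCᵇ ∘ children) (map flatten (forests n))
      ≡⟨ concatMap-map (filterᵇ isNCᵇ ∘ children) flatten (forests n) ⟩
    concatMap (filterᵇ isNCᵇ ∘ children ∘ flatten) (forests n)  ≡⟨ concatMap-local (All.map step (forests-spans n)) ⟩
    concatMap (map flatten ∘ insert (suc n)) (forests n)        ≡⟨ map-concatMap flatten (insert (suc n)) (forests n) ⟨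
    map flatten (concatMap (insert (suc n)) (forests n))        ∎
    where
    open ≡-Reasoning
    children : Partition → List Partition
    children π = (π ++ [ [ suc n ] ]) ∷ extend (suc n) π
    none : ∀ π → ¬ T (isNCᵇ π) → filterᵇ isNCᵇ (children π) ≡ []
    none π h = filterᵇ-none isNCᵇ (All.map (λ {π′} f nc → h (from (isNC⇔ π) (f (to (isNC⇔ π′) nc))))
      (snoc-nonCrossing π [ suc n ] ∷ extend-nonCrossing (suc n) π))
    step : ∀ {F} → Spans 1 (suc n) F → filterᵇ isNCᵇ (children (flatten F)) ≡ map flatten (insert (suc n) F)
    step {F} s = trans
      (filterᵇ-accept isNCᵇ _ (from (isNC⇔ _) (subst NonCrossing (flatten-singleton (suc n) F) (flatten-nonCrossing (singleton-spans s)))))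
      (cong₂ _∷_ (sym (flatten-singleton (suc n) F)) (filter-extend s))

  -- Irreducible non-crossing partitions

  irreducible  : Forest → Bool
  irreducibleᴳ : Gaps → Bool
  irreducible ε          = false
  irreducible (node a g) = irreducibleᴳ g
  irreducibleᴳ (end ε)          = true
  irreducibleᴳ (end (node _ _)) = false
  irreducibleᴳ (mid _ _ g)      = irreducibleᴳ g

  -- The case lo ≡ suc n means that no element is left: then n is the element of the block passed
  -- just before lo.
  last∈block : ∀ {lo n g} → Spansᴳ lo (suc n) g → T (irreducibleᴳ g) → lo ≡ suc n ⊎ n ∈ block g
  last∈block {g = end ε}     (end ε)   _ = inj₁ refl
  last∈block {g = mid _ _ _} (mid _ s) h with last∈block s h
  ... | inj₁ refl = inj₂ (here refl)
  ... | inj₂ n∈   = inj₂ (there n∈)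

  block-<last : ∀ {lo n g} → Spansᴳ lo (suc n) g → ¬ T (irreducibleᴳ g) → lo ≤ n × All (_< n) (block g)
  block-<last {g = end ε}          (end s)        h = ⊥-elim (h _)
  block-<last {g = end (node _ _)} (end (node s)) h = ≤-pred (spansᴳ-≤ s) , []
  block-<last {g = mid _ _ _}      (mid s t)      h with block-<last t h
  ... | x<n , b = ≤-trans (spans-≤ s) (<⇒≤ x<n) , x<n ∷ b

  ∈ᵇ⇔ : ∀ i V → T (i ∈ᵇ V) ⇔ i ∈ V
  ∈ᵇ⇔ i V = mk⇔
    (λ h → Any.map (≡ᵇ⇒≡ i _) (any⁻ _ V h))
    (λ h → any⁺ _ (Any.map (≡⇒≡ᵇ i _) h))

  irr-flatten : ∀ {n F} → Spans 1 (suc (suc n)) F → T (irrᵇ (suc n) (flatten F)) ⇔ T (irreducible F)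
  irr-flatten {n} {node .1 g} (node s) = mk⇔ ⇒ ⇐
    where
    V = 1 ∷ block g
    ⇒ : T (irrᵇ (suc n) (V ∷ blocks g)) → T (irreducibleᴳ g)
    ⇒ h with T? (irreducibleᴳ g)
    ... | yes i = i
    ... | no ¬i with find (any⁻ _ (V ∷ blocks g) h)
    ... | W , W∈ , w with to T-∧ w
    ... | 1∈ , n∈ = ⊥-elim (lemma W∈ (to (∈ᵇ⇔ 1 W) 1∈) (to (∈ᵇ⇔ (suc n) W) n∈))
      where
      lemma : ∀ {W} → W ∈ V ∷ blocks g → 1 ∈ W → suc n ∈ W → ⊥
      lemma (here refl) _ (here refl) = n≮n 1 (proj₁ (block-<last s ¬i))
      lemma (here refl) _ (there m)   = n≮n _ (All.lookup (proj₂ (block-<last s ¬i)) m)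
      lemma (there W∈)  m _           = n≮n 1 (proj₁ (All.lookup (All.lookup (between-blocks s) W∈) m))
    ⇐ : T (irreducibleᴳ g) → T (irrᵇ (suc n) (V ∷ blocks g))
    ⇐ i = any⁺ {xs = V ∷ blocks g} (λ W → (1 ∈ᵇ W) ∧ (suc n ∈ᵇ W)) (here (from T-∧ (from (∈ᵇ⇔ 1 V) (here refl) , from (∈ᵇ⇔ (suc n) V) (last (last∈block s i)))))
      where
      last : 2 ≡ suc (suc n) ⊎ suc n ∈ block g → suc n ∈ V
      last (inj₁ refl) = here refl
      last (inj₂ m)    = there m

  NCirr-forests : ∀ n → NCirr (suc n) ≡ map flatten (filterᵇ irreducible (forests (suc n)))
  NCirr-forests n = begin
    NCirr (suc n)                                                            ≡⟨ filterᵇ-∧ isNCᵇ (irrᵇ (suc n)) (partitions (suc n)) ⟩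
    filterᵇ (irrᵇ (suc n)) (NC (suc n))                                      ≡⟨ cong (filterᵇ (irrᵇ (suc n))) (NC-forests (suc n)) ⟩
    filterᵇ (irrᵇ (suc n)) (map flatten (forests (suc n)))                   ≡⟨ filterᵇ-map flatten (forests (suc n)) ⟩
    map flatten (filterᵇ (irrᵇ (suc n) ∘ flatten) (forests (suc n)))         ≡⟨ cong (map flatten) (filterᵇ-local (All.map irr-flatten (forests-spans (suc n)))) ⟩
    map flatten (filterᵇ irreducible (forests (suc n)))                      ∎
    where open ≡-Reasoning

  -- The tree factorial

  size : Forest → ℕ
  size F = length (flatten F)

  -- The components in `end F` follow the last element of the block and are not nested in it, so
  -- they do not count. With the block itself added this is N(V).
  innerSize : Gaps → ℕ
  innerSize (end F)     = 0
  innerSize (mid F x g) = size F + innerSize g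

  treeFactorial  : Forest → ℕ
  treeFactorialᴳ : Gaps → ℕ
  treeFactorial ε          = 1
  treeFactorial (node a g) = suc (innerSize g) * treeFactorialᴳ g
  treeFactorialᴳ (end F)     = treeFactorial F
  treeFactorialᴳ (mid F x g) = treeFactorial F * treeFactorialᴳ g

  minB≤ : ∀ {v} V → v ∈ V → minB V ≤ v
  minB≤ (x ∷ xs) m = go xs m
    where
    go : ∀ {v} ys → v ∈ x ∷ ys → foldr _⊓_ x ys ≤ v
    go []       (here refl)         = ≤-refl
    go (y ∷ ys) (here refl)         = ≤-trans (m⊓n≤n y _) (go ys (here refl))
    go (y ∷ ys) (there (here refl)) = m⊓n≤m y _
    go (y ∷ ys) (there (there m))   = ≤-trans (m⊓n≤n y _) (go ys (there m))

  ≤maxB : ∀ {v} V → v ∈ V → v ≤ maxB V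
  ≤maxB (x ∷ xs) m = go xs m
    where
    go : ∀ {v} ys → v ∈ x ∷ ys → v ≤ foldr _⊔_ x ys
    go []       (here refl)         = ≤-refl
    go (y ∷ ys) (here refl)         = ≤-trans (go ys (here refl)) (m≤n⊔m y _)
    go (y ∷ ys) (there (here refl)) = m≤m⊔n y _
    go (y ∷ ys) (there (there m))   = ≤-trans (go ys (there m)) (m≤n⊔m y _)

  minB∈ : ∀ x xs → minB (x ∷ xs) ∈ x ∷ xs
  minB∈ x []       = here refl
  minB∈ x (y ∷ ys) with ⊓-sel y (foldr _⊓_ x ys) | minB∈ x ys
  ... | inj₁ e | _        = there (here e)
  ... | inj₂ e | here m   = here (trans e m)
  ... | inj₂ e | there m  = there (there (subst (_∈ ys) (sym e) m))

  maxB∈ : ∀ x xs → maxB (x ∷ xs) ∈ x ∷ xs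
  maxB∈ x []       = here refl
  maxB∈ x (y ∷ ys) with ⊔-sel y (foldr _⊔_ x ys) | maxB∈ x ys
  ... | inj₁ e | _        = there (here e)
  ... | inj₂ e | here m   = here (trans e m)
  ... | inj₂ e | there m  = there (there (subst (_∈ ys) (sym e) m))

  minB-maxB-between : ∀ {lo hi V} → LiesIn lo hi V → Between lo hi (minB V) × Between lo hi (maxB V)
  minB-maxB-between {V = x ∷ xs} (_ , b) = All.lookup b (minB∈ x xs) , All.lookup b (maxB∈ x xs)

  covers : Block → Block → Bool
  covers V W = all (λ w → (minB V ≤ᵇ w) ∧ (w ≤ᵇ maxB V)) W

  covers⇔ : ∀ V W → T (covers V W) ⇔ All (λ w → minB V ≤ w × w ≤ maxB V) W
  covers⇔ V W = mk⇔
    (λ h → All.map (λ x → let a , b = to T-∧ x in ≤ᵇ⇒≤ _ _ a , ≤ᵇ⇒≤ _ _ b) (all⁺ _ W h))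
    (λ h → all⁻ _ (All.map (λ (a , b) → from T-∧ (≤⇒≤ᵇ a , ≤⇒≤ᵇ b)) h))

  Nblk-++ : ∀ π ρ V → Nblk (π ++ ρ) V ≡ Nblk π V + Nblk ρ V
  Nblk-++ π ρ V = trans (cong length (filterᵇ-++ (covers V) π ρ)) (length-++ (filterᵇ (covers V) π))

  Nblk-all : ∀ π V → All (All (λ w → minB V ≤ w × w ≤ maxB V)) π → Nblk π V ≡ length π
  Nblk-all π V h = cong length (filterᵇ-all (covers V) (All.map (λ {W} → from (covers⇔ V W)) h))

  Nblk-none : ∀ π V → All (Any (λ w → w < minB V ⊎ maxB V < w)) π → Nblk π V ≡ 0
  Nblk-none π V h = cong length (filterᵇ-none (covers V) {π} (All.map (λ {W} → not-covered W) h))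
    where
    not-covered : ∀ W → Any (λ w → w < minB V ⊎ maxB V < w) W → ¬ T (covers V W)
    not-covered W a h with find a
    ... | w , w∈ , o with All.lookup (to (covers⇔ V W) h) w∈ | o
    ... | l , _ | inj₁ w< = <⇒≱ w< l
    ... | _ , u | inj₂ <w = <⇒≱ <w u

  Nblk-inner : ∀ {V lo hi g} → Spansᴳ lo hi g → Enclosing V lo g → Nblk (blocks g) V ≡ innerSize g
  Nblk-inner {V@(v ∷ vs)} {lo} {hi} {end F} (end s) e = Nblk-none (flatten F) V
    (All.map (λ (a , _) → Any.map (λ (lo≤ , _) → inj₂ (≤-trans max< lo≤)) a) (flatten-liesIn s))
    where
    max< : maxB V < lo
    max< with Enclosing.classify e (maxB∈ v vs)
    ... | inj₁ l = l
  Nblk-inner {[]} {g = end F} (end s) e with Enclosing.first∈ e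
  ... | ()
  Nblk-inner {V} {lo} {hi} {mid F x g} (mid s t) e = trans (Nblk-++ (flatten F) (blocks g) V) (cong₂ _+_
    (Nblk-all (flatten F) V (All.map (All.map (λ (lo≤ , <x) →
      ≤-trans (minB≤ V first∈) (≤-trans (<⇒≤ first<) lo≤) , ≤-trans (<⇒≤ <x) (≤maxB V (block⊆ (here refl))))) (between-flatten s)))
    (Nblk-inner t (enclosing-mid (spans-≤ s) e)))
    where open Enclosing e

  -- `τ!` takes the product and the counts over the same partition. Separating them lets the product
  -- recurse over parts while the counts still refer to the whole.
  τ!-over : Partition → Partition → ℕ
  τ!-over ρ = foldr (λ V n → Nblk ρ V * n) 1

  τ!-over-++ : ∀ ρ π σ → τ!-over ρ (π ++ σ) ≡ τ!-over ρ π * τ!-over ρ σ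
  τ!-over-++ ρ []      σ = sym (+-identityʳ _)
  τ!-over-++ ρ (V ∷ π) σ = trans (cong (Nblk ρ V *_) (τ!-over-++ ρ π σ)) (sym (*-assoc (Nblk ρ V) _ _))

  -- Applied to a part `π` of `ρ`: the other blocks of `ρ` contribute nothing to the counts of
  -- blocks between lo and hi. This is the invariant that descends to subforests.
  CountsLike : Partition → ℕ → ℕ → Partition → Set
  CountsLike ρ lo hi π = ∀ {V} → LiesIn lo hi V → Nblk ρ V ≡ Nblk π V

  τ!-flatten : ∀ {lo hi F} ρ → Spans lo hi F → CountsLike ρ lo hi (flatten F) → τ!-over ρ (flatten F) ≡ treeFactorial F
  τ!-blocks  : ∀ {lo hi g} ρ → Spansᴳ lo hi g → CountsLike ρ lo hi (blocks g) → τ!-over ρ (blocks g) ≡ treeFactorialᴳ g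

  τ!-flatten ρ ε c = refl
  τ!-flatten {lo} {hi} {node .lo g} ρ (node s) c = cong₂ _*_
    (trans (c V-in) (trans (Nblk-++ [ V ] (blocks g) V) (cong₂ _+_
      (Nblk-all [ V ] V (All.tabulate (λ m → minB≤ V m , ≤maxB V m) ∷ []))
      (Nblk-inner s enclosing-node))))
    (τ!-blocks ρ s inside)
    where
    V = lo ∷ block g
    V-in : LiesIn lo hi V
    V-in = here (≤-refl , spansᴳ-≤ s) , (≤-refl , spansᴳ-≤ s) ∷ All.map (between-weaken (n≤1+n _) ≤-refl) (block-between s)
    inside : CountsLike ρ (suc lo) hi (blocks g)
    inside {W} l = trans (c (liesIn-weaken (n≤1+n _) ≤-refl l)) (trans (Nblk-++ [ V ] (blocks g) W)
      (cong (_+ Nblk (blocks g) W) (Nblk-none [ V ] W (here (inj₁ (proj₁ (proj₁ (minB-maxB-between l)))) ∷ []))))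
  τ!-blocks ρ (end s) c = τ!-flatten ρ s c
  τ!-blocks {lo} {hi} {mid F x g} ρ (mid s t) c = trans (τ!-over-++ ρ (flatten F) (blocks g))
    (cong₂ _*_ (τ!-flatten ρ s left) (τ!-blocks ρ t right))
    where
    left : CountsLike ρ lo x (flatten F)
    left {W} l = trans (c (liesIn-weaken ≤-refl (<⇒≤ (spansᴳ-≤ t)) l)) (trans (Nblk-++ (flatten F) (blocks g) W)
      (trans (cong (Nblk (flatten F) W +_) (Nblk-none (blocks g) W (All.map
        (λ (a , _) → Any.map (λ (x< , _) → inj₂ (≤-trans (proj₂ (proj₂ (minB-maxB-between l))) (<⇒≤ x<))) a)
        (blocks-liesIn t)))) (+-identityʳ _)))
    right : CountsLike ρ (suc x) hi (blocks g)
    right {W} l = trans (c (liesIn-weaken (m≤n⇒m≤1+n (spans-≤ s)) ≤-refl l)) (trans (Nblk-++ (flatten F) (blocks g) W)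
      (cong (_+ Nblk (blocks g) W) (Nblk-none (flatten F) W (All.map
        (λ (a , _) → Any.map (λ (_ , <x) → inj₁ (≤-trans <x (<⇒≤ (proj₁ (proj₁ (minB-maxB-between l)))))) a)
        (flatten-liesIn s)))))

  τ!-treeFactorial : ∀ {lo hi F} → Spans lo hi F → τ! (flatten F) ≡ treeFactorial F
  τ!-treeFactorial {F = F} s = τ!-flatten (flatten F) s (λ _ → refl)

  -- Interval partitions

  Consecutive : Block → Set
  Consecutive V = ∀ i → minB V ≤ i → i ≤ maxB V → i ∈ V

  isIntervalBlock⇔ : ∀ V → T (isIntervalBlockᵇ V) ⇔ Consecutive V
  isIntervalBlock⇔ V = mk⇔
    (λ h i l u → to (∈ᵇ⇔ i V) (to if⇔ (All.lookup (all⁺ _ (upTo (suc (maxB V))) h) (∈-upTo⁺ (s≤s u)))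
      (from T-∧ (≤⇒≤ᵇ l , ≤⇒≤ᵇ u))))
    (λ h → all⁻ _ {upTo (suc (maxB V))} (All.universal (λ i → from if⇔ (λ c → let l , u = to T-∧ c in
      from (∈ᵇ⇔ i V) (h i (≤ᵇ⇒≤ _ _ l) (≤ᵇ⇒≤ _ _ u)))) _))
    where
    if⇔ : ∀ {b c} → T (if c then b else true) ⇔ (T c → T b)
    if⇔ {b} {true}  = mk⇔ (λ h _ → h) (λ h → h _)
    if⇔ {b} {false} = mk⇔ (λ _ ()) (λ _ → _)

  isInterval⇔ : ∀ π → T (isIntervalᵇ π) ⇔ All Consecutive π
  isInterval⇔ π = mk⇔
    (λ h → All.map (λ {V} → to (isIntervalBlock⇔ V)) (all⁺ _ π h))
    (λ h → all⁻ _ (All.map (λ {V} → from (isIntervalBlock⇔ V)) h))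

  record Run (lo hi : ℕ) (V : Block) : Set where
    field
      nonempty : lo < hi
      ∈⇒       : ∀ {w} → w ∈ V → Between lo hi w
      ⇒∈       : ∀ {w} → Between lo hi w → w ∈ V
  open Run

  data Runs : ℕ → ℕ → Partition → Set where
    []  : ∀ {lo} → Runs lo lo []
    _∷_ : ∀ {lo m hi V π} → Run lo m V → Runs m hi π → Runs lo hi (V ∷ π)

  run-consecutive : ∀ {lo hi V} → Run lo hi V → Consecutive V
  run-consecutive {lo} {V = V} r i l u with ⇒∈ r {lo} (≤-refl , nonempty r)
  run-consecutive {V = v ∷ vs} r i l u | _ =
    ⇒∈ r (≤-trans (proj₁ (∈⇒ r (minB∈ v vs))) l , ≤-<-trans u (proj₂ (∈⇒ r (maxB∈ v vs))))

  runs-≤ : ∀ {lo hi π} → Runs lo hi π → lo ≤ hi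
  runs-≤ []       = ≤-refl
  runs-≤ (r ∷ rs) = ≤-trans (<⇒≤ (nonempty r)) (runs-≤ rs)

  runs-consecutive : ∀ {lo hi π} → Runs lo hi π → All Consecutive π
  runs-consecutive []       = []
  runs-consecutive (r ∷ rs) = run-consecutive r ∷ runs-consecutive rs

  run-singleton : ∀ k → Run k (suc k) [ k ]
  run-singleton k = record
    { nonempty = ≤-refl ; ∈⇒ = λ { (here refl) → ≤-refl , ≤-refl }
    ; ⇒∈ = λ (l , u) → here (≤-antisym (≤-pred u) l) }

  run-snoc : ∀ {lo k V} → Run lo k V → Run lo (suc k) (V ++ [ k ])
  run-snoc {lo} {k} {V} r = record { nonempty = m≤n⇒m≤1+n (nonempty r) ; ∈⇒ = ⇒ ; ⇒∈ = ⇐ }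
    where
    ⇒ : ∀ {w} → w ∈ V ++ [ k ] → Between lo (suc k) w
    ⇒ m with ∈-++⁻ V m
    ... | inj₁ w∈          = between-weaken ≤-refl (n≤1+n k) (∈⇒ r w∈)
    ... | inj₂ (here refl) = <⇒≤ (nonempty r) , ≤-refl
    ⇐ : ∀ {w} → Between lo (suc k) w → w ∈ V ++ [ k ]
    ⇐ (l , s≤s w≤k) with m≤n⇒m<n∨m≡n w≤k
    ... | inj₁ w<k  = ∈-++⁺ˡ (⇒∈ r (l , w<k))
    ... | inj₂ refl = ∈-++⁺ʳ V (here refl)

  joinLast : ℕ → Partition → List Partition
  joinLast k []          = []
  joinLast k (V ∷ [])    = [ [ V ++ [ k ] ] ]
  joinLast k (V ∷ W ∷ π) = map (V ∷_) (joinLast k (W ∷ π))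

  append : ℕ → Partition → List Partition
  append k π = (π ++ [ [ k ] ]) ∷ joinLast k π

  intervals : ℕ → List Partition
  intervals zero    = [ [] ]
  intervals (suc n) = concatMap (append (suc n)) (intervals n)

  runs-snoc : ∀ {lo k π} → Runs lo k π → Runs lo (suc k) (π ++ [ [ k ] ])
  runs-snoc []       = run-singleton _ ∷ []
  runs-snoc (r ∷ rs) = r ∷ runs-snoc rs

  joinLast-runs : ∀ {lo k π} → Runs lo k π → All (Runs lo (suc k)) (joinLast k π)
  joinLast-runs []            = []
  joinLast-runs (r ∷ [])      = (run-snoc r ∷ []) ∷ []
  joinLast-runs (r ∷ s ∷ rs)  = Allₚ.map⁺ (All.map (r ∷_) (joinLast-runs (s ∷ rs)))

  intervals-runs : ∀ n → All (Runs 1 (suc n)) (intervals n)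
  intervals-runs zero    = [] ∷ []
  intervals-runs (suc n) = Allₚ.concat⁺ (Allₚ.map⁺ (All.map (λ r → runs-snoc r ∷ joinLast-runs r) (intervals-runs n)))

  filter-joinLast : ∀ {lo k π} → Runs lo k π → filterᵇ isIntervalᵇ (extend k π) ≡ joinLast k π
  filter-joinLast [] = refl
  filter-joinLast {k = k} {V ∷ []} (r ∷ []) =
    filterᵇ-accept isIntervalᵇ [] (from (isInterval⇔ [ V ++ [ k ] ]) (runs-consecutive (run-snoc r ∷ [])))
  filter-joinLast {lo} {k} {V ∷ W ∷ π} (_∷_ {m = m} r (s ∷ rs)) = begin
    filterᵇ isIntervalᵇ (((V ++ [ k ]) ∷ W ∷ π) ∷ map (V ∷_) (extend k (W ∷ π)))
      ≡⟨ filterᵇ-reject isIntervalᵇ {(V ++ [ k ]) ∷ W ∷ π} (map (V ∷_) (extend k (W ∷ π))) not-consecutive ⟩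
    filterᵇ isIntervalᵇ (map (V ∷_) (extend k (W ∷ π)))
      ≡⟨ filterᵇ-map (V ∷_) {isIntervalᵇ} (extend k (W ∷ π)) ⟩
    map (V ∷_) (filterᵇ (isIntervalᵇ ∘ (V ∷_)) (extend k (W ∷ π)))
      ≡⟨ cong (map (V ∷_)) (filterᵇ-local {p = isIntervalᵇ ∘ (V ∷_)} {isIntervalᵇ} (All.universal drop-first (extend k (W ∷ π)))) ⟩
    map (V ∷_) (filterᵇ isIntervalᵇ (extend k (W ∷ π)))
      ≡⟨ cong (map (V ∷_)) (filter-joinLast (s ∷ rs)) ⟩
    map (V ∷_) (joinLast k (W ∷ π)) ∎
    where
    open ≡-Reasoning
    m<k : m < k
    m<k = ≤-trans (nonempty s) (runs-≤ rs)
    -- The missing element is m, where the next block starts: it lies between the minimum of V and k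
    -- but belongs to W.
    not-consecutive : ¬ T (isIntervalᵇ ((V ++ [ k ]) ∷ W ∷ π))
    not-consecutive h with ∈-++⁻ V (All.head (to (isInterval⇔ ((V ++ [ k ]) ∷ W ∷ π)) h) m
      (≤-trans (minB≤ (V ++ [ k ]) (∈-++⁺ˡ (⇒∈ r (≤-refl , nonempty r)))) (<⇒≤ (nonempty r)))
      (≤-trans (<⇒≤ m<k) (≤maxB (V ++ [ k ]) (∈-++⁺ʳ V (here refl)))))
    ... | inj₁ m∈          = n≮n m (proj₂ (∈⇒ r m∈))
    ... | inj₂ (here refl) = n≮n m m<k
    drop-first : ∀ π → T (isIntervalᵇ (V ∷ π)) ⇔ T (isIntervalᵇ π)
    drop-first π = mk⇔
      (λ h → from (isInterval⇔ π) (All.tail (to (isInterval⇔ (V ∷ π)) h)))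
      (λ h → from (isInterval⇔ (V ∷ π)) (run-consecutive r ∷ to (isInterval⇔ π) h))

  extend-liesIn : ∀ {lo k} π → lo ≤ k → All (LiesIn lo k) π → All (All (LiesIn lo (suc k))) (extend k π)
  extend-liesIn []      _ []             = []
  extend-liesIn (B ∷ π) l ((a , b) ∷ bs) =
    ((Anyₚ.++⁺ʳ B (here (l , ≤-refl))
      , Allₚ.++⁺ (All.map (between-weaken ≤-refl (n≤1+n _)) b) ((l , ≤-refl) ∷ []))
      ∷ All.map (liesIn-weaken ≤-refl (n≤1+n _)) bs)
    ∷ Allₚ.map⁺ (All.map (liesIn-weaken ≤-refl (n≤1+n _) (a , b) ∷_) (extend-liesIn π l bs))

  partitions-liesIn : ∀ n → All (All (LiesIn 1 (suc n))) (partitions n)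
  partitions-liesIn zero    = [] ∷ []
  partitions-liesIn (suc n) = Allₚ.concat⁺ (Allₚ.map⁺ (All.map
    (λ {π} h → Allₚ.++⁺ (All.map (liesIn-weaken ≤-refl (n≤1+n _)) h) ((here (s≤s z≤n , ≤-refl) , (s≤s z≤n , ≤-refl) ∷ []) ∷ [])
      ∷ extend-liesIn π (s≤s z≤n) h)
    (partitions-liesIn n)))

  consecutive-snoc : ∀ {lo k V} → LiesIn lo k V → Consecutive (V ++ [ k ]) → Consecutive V
  consecutive-snoc {k = k} {V@(v ∷ vs)} (_ , b) h i l u
    with ∈-++⁻ V (h i (≤-trans (minB≤ (V ++ [ k ]) (∈-++⁺ˡ (minB∈ v vs))) l) (≤-trans u (≤maxB (V ++ [ k ]) (∈-++⁺ˡ (maxB∈ v vs)))))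
  ... | inj₁ i∈          = i∈
  ... | inj₂ (here refl) = ⊥-elim (<⇒≱ (proj₂ (All.lookup b (maxB∈ v vs))) u)

  extend-consecutive : ∀ {lo k} π → All (LiesIn lo k) π → All (λ π′ → All Consecutive π′ → All Consecutive π) (extend k π)
  extend-consecutive []      _        = []
  extend-consecutive (V ∷ π) (b ∷ bs) =
    (λ { (c ∷ cs) → consecutive-snoc b c ∷ cs })
    ∷ Allₚ.map⁺ (All.map (λ { f (c ∷ cs) → c ∷ f cs }) (extend-consecutive π bs))

  Int-intervals : ∀ n → Int n ≡ intervals n
  Int-intervals zero    = refl
  Int-intervals (suc n) = begin
    filterᵇ isIntervalᵇ (concatMap children (partitions n))
      ≡⟨ filterᵇ-concatMap isIntervalᵇ isIntervalᵇ children (partitions n) (All.map none (partitions-liesIn n)) ⟩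
    concatMap (filterᵇ isIntervalᵇ ∘ children) (Int n)
      ≡⟨ cong (concatMap (filterᵇ isIntervalᵇ ∘ children)) (Int-intervals n) ⟩
    concatMap (filterᵇ isIntervalᵇ ∘ children) (intervals n)
      ≡⟨ concatMap-local (All.map step (intervals-runs n)) ⟩
    intervals (suc n) ∎
    where
    open ≡-Reasoning
    children : Partition → List Partition
    children π = (π ++ [ [ suc n ] ]) ∷ extend (suc n) π
    none : ∀ {π} → All (LiesIn 1 (suc n)) π → ¬ T (isIntervalᵇ π) → filterᵇ isIntervalᵇ (children π) ≡ []
    none {π} l h = filterᵇ-none isIntervalᵇ (All.map
      (λ {π′} f i → h (from (isInterval⇔ π) (f (to (isInterval⇔ π′) i))))
      (Allₚ.++⁻ˡ π ∷ extend-consecutive π l))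
    step : ∀ {π} → Runs 1 (suc n) π → filterᵇ isIntervalᵇ (children π) ≡ append (suc n) π
    step {π} r = trans
      (filterᵇ-accept isIntervalᵇ {π ++ [ [ suc n ] ]} (extend (suc n) π)
        (from (isInterval⇔ (π ++ [ [ suc n ] ])) (runs-consecutive (runs-snoc r))))
      (cong ((π ++ [ [ suc n ] ]) ∷_) (filter-joinLast r))

  *-≢0 : ∀ m n → m ≢ 0 → n ≢ 0 → m * n ≢ 0
  *-≢0 m n m≢0 n≢0 e with m*n≡0⇒m≡0∨n≡0 m e
  ... | inj₁ m≡0 = m≢0 m≡0
  ... | inj₂ n≡0 = n≢0 n≡0

  treeFactorial≢0  : ∀ F → treeFactorial F ≢ 0
  treeFactorialᴳ≢0 : ∀ g → treeFactorialᴳ g ≢ 0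
  treeFactorial≢0 ε          = λ ()
  treeFactorial≢0 (node a g) = *-≢0 (suc (innerSize g)) (treeFactorialᴳ g) (λ ()) (treeFactorialᴳ≢0 g)
  treeFactorialᴳ≢0 (end F)     = treeFactorial≢0 F
  treeFactorialᴳ≢0 (mid F x g) = *-≢0 (treeFactorial F) (treeFactorialᴳ g) (treeFactorial≢0 F) (treeFactorialᴳ≢0 g)

open NonCrossingPartitions

-- Moments

range : ℕ → List ℕ
range n = map suc (upTo n)

range-suc : ∀ n → range (suc n) ≡ range n ++ [ suc n ]
range-suc n = ≡.trans (cong (map suc) (≡.sym (upTo-∷ʳ n))) (map-++ suc (upTo n) [ n ])

insertᴳ : ℕ → Gaps → List Gaps
insertᴳ z g = singletonᴳ z g ∷ close z g ∷ joinᴳ z g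

module Iterate {A : Set} (step : ℕ → A → List A) where

  iterate : List ℕ → A → List A
  iterate []      x = [ x ]
  iterate (z ∷ w) x = concatMap (iterate w) (step z x)

  -- `iterate` consumes a word from its first letter, as the functional equations do, while
  -- `forests` and `intervals` are generated at the last one.
  iterate-snoc : ∀ w z x → iterate (w ++ [ z ]) x ≡ concatMap (step z) (iterate w x)
  iterate-snoc []      z x = concatMap-singleton (step z x)
    where
    concatMap-singleton : ∀ xs → concatMap [_] xs ≡ xs ++ []
    concatMap-singleton []       = ≡.refl
    concatMap-singleton (x ∷ xs) = cong (x ∷_) (concatMap-singleton xs)
  iterate-snoc (y ∷ w) z x = ≡.trans (concatMap-local (All.universal (iterate-snoc w z) (step y x)))
    (concatMap-concatMap (step y x))
    where
    concatMap-++ : ∀ xs ys → concatMap (step z) (xs ++ ys) ≡ concatMap (step z) xs ++ concatMap (step z) ys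
    concatMap-++ []       ys = ≡.refl
    concatMap-++ (x ∷ xs) ys = ≡.trans (cong (step z x ++_) (concatMap-++ xs ys)) (≡.sym (++-assoc (step z x) _ _))
    concatMap-concatMap : ∀ xs → concatMap (concatMap (step z) ∘ iterate w) xs ≡ concatMap (step z) (concatMap (iterate w) xs)
    concatMap-concatMap []       = ≡.refl
    concatMap-concatMap (x ∷ xs) = ≡.trans (cong (concatMap (step z) (iterate w x) ++_) (concatMap-concatMap xs))
      (≡.sym (concatMap-++ (iterate w x) (concatMap (iterate w) xs)))

  iterate-range : ∀ (xs : ℕ → List A) x → xs 0 ≡ [ x ] → (∀ n → xs (suc n) ≡ concatMap (step (suc n)) (xs n))
                → ∀ n → xs n ≡ iterate (range n) x
  iterate-range xs x z s zero    = z
  iterate-range xs x z s (suc n) = ≡.trans (s n) (≡.trans (cong (concatMap (step (suc n))) (iterate-range xs x z s n))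
    (≡.trans (≡.sym (iterate-snoc (range n) (suc n) x)) (cong (λ w → iterate w x) (≡.sym (range-suc n)))))

open Iterate

-- Used in two ways: with y the identity, to move all insertions underneath a constructor that they
-- leave alone, and with f a relabelling, to replace the elements of [n] by arbitrary letters. The
-- invariant P covers maps that commute with a step only on part of the domain.
iterate-natural : ∀ {A B : Set} {stepᴬ : ℕ → A → List A} {stepᴮ : ℕ → B → List B} (y : ℕ → ℕ) (f : A → B) (P : A → Set)
  → (∀ z {x} → P x → stepᴮ (y z) (f x) ≡ map f (stepᴬ z x)) → (∀ z {x} → P x → All P (stepᴬ z x))
  → ∀ w {x} → P x → iterate stepᴮ (map y w) (f x) ≡ map f (iterate stepᴬ w x)
iterate-natural y f P nat pres []      p = ≡.refl
iterate-natural {stepᴬ = stepᴬ} {stepᴮ} y f P nat pres (z ∷ w) {x} p = begin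
  concatMap (iterate stepᴮ (map y w)) (stepᴮ (y z) (f x))     ≡⟨ cong (concatMap (iterate stepᴮ (map y w))) (nat z p) ⟩
  concatMap (iterate stepᴮ (map y w)) (map f (stepᴬ z x))     ≡⟨ concatMap-map (iterate stepᴮ (map y w)) f (stepᴬ z x) ⟩
  concatMap (iterate stepᴮ (map y w) ∘ f) (stepᴬ z x)         ≡⟨ concatMap-local (All.map (iterate-natural y f P nat pres w) (pres z p)) ⟩
  concatMap (map f ∘ iterate stepᴬ w) (stepᴬ z x)             ≡⟨ map-concatMap f (iterate stepᴬ w) (stepᴬ z x) ⟨
  map f (iterate stepᴬ (z ∷ w) x)                             ∎
  where open ≡-Reasoning

iterate-natural′ : ∀ {A B : Set} {stepᴬ : ℕ → A → List A} {stepᴮ : ℕ → B → List B} (y : ℕ → ℕ) (f : A → B)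
  → (∀ z x → stepᴮ (y z) (f x) ≡ map f (stepᴬ z x))
  → ∀ w x → iterate stepᴮ (map y w) (f x) ≡ map f (iterate stepᴬ w x)
iterate-natural′ y f nat w x = iterate-natural y f (λ _ → ⊤) (λ z {x} _ → nat z x) (λ z _ → All.universal (λ _ → tt) _) w tt
  where open import Data.Unit using (⊤; tt)

insertAll : List ℕ → Forest → List Forest
insertAll = iterate insert

insertAllᴳ : List ℕ → Gaps → List Gaps
insertAllᴳ = iterate insertᴳ

appendAll : List ℕ → Partition → List Partition
appendAll = iterate append

insertAll-node : ∀ w a g → insertAll w (node a g) ≡ map (node a) (insertAllᴳ w g)
insertAll-node w a g = ≡.trans (cong (λ v → insertAll v (node a g)) (≡.sym (map-id w)))
  (iterate-natural′ id (node a) (λ _ _ → ≡.refl) w g)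

insertAllᴳ-mid : ∀ w F x g → insertAllᴳ w (mid F x g) ≡ map (mid F x) (insertAllᴳ w g)
insertAllᴳ-mid w F x g = ≡.trans (cong (λ v → insertAllᴳ v (mid F x g)) (≡.sym (map-id w)))
  (iterate-natural′ id (mid F x) (λ _ _ → ≡.refl) w g)

appendAll-∷ : ∀ w V W π → appendAll w (V ∷ W ∷ π) ≡ map (V ∷_) (appendAll w (W ∷ π))
appendAll-∷ w V W π = ≡.trans (cong (λ v → appendAll v (V ∷ W ∷ π)) (≡.sym (map-id w)))
  (iterate-natural id (V ∷_) Nonempty (λ { z (_ , _ , ≡.refl) → ≡.refl }) (λ { z (W , π , ≡.refl) → preserved z W π }) w (W , π , ≡.refl))
  where
  Nonempty : Partition → Set
  Nonempty π = ∃[ W ] ∃[ ρ ] π ≡ W ∷ ρ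
  preserved : ∀ z W π → All Nonempty (append z (W ∷ π))
  preserved z W []      = (_ , _ , ≡.refl) ∷ (_ , _ , ≡.refl) ∷ []
  preserved z W (V ∷ π) = (_ , _ , ≡.refl) ∷ Allₚ.map⁺ (All.universal (λ _ → _ , _ , ≡.refl) _)

module Relabel (y : ℕ → ℕ) where

  relabel  : Forest → Forest
  relabelᴳ : Gaps → Gaps
  relabel ε          = ε
  relabel (node a g) = node (y a) (relabelᴳ g)
  relabelᴳ (end F)     = end (relabel F)
  relabelᴳ (mid F x g) = mid (relabel F) (y x) (relabelᴳ g)

  flatten-relabel : ∀ F → flatten (relabel F) ≡ map (map y) (flatten F)
  block-relabel   : ∀ g → block (relabelᴳ g) ≡ map y (block g)
  blocks-relabel  : ∀ g → blocks (relabelᴳ g) ≡ map (map y) (blocks g)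
  flatten-relabel ε          = ≡.refl
  flatten-relabel (node a g) = cong₂ (λ V π → (y a ∷ V) ∷ π) (block-relabel g) (blocks-relabel g)
  block-relabel (end F)     = ≡.refl
  block-relabel (mid F x g) = cong (y x ∷_) (block-relabel g)
  blocks-relabel (end F)     = flatten-relabel F
  blocks-relabel (mid F x g) = ≡.trans (cong₂ _++_ (flatten-relabel F) (blocks-relabel g)) (≡.sym (map-++ (map y) (flatten F) _))

  insert-relabel  : ∀ z F → insert (y z) (relabel F) ≡ map relabel (insert z F)
  insertᴳ-relabel : ∀ z g → insertᴳ (y z) (relabelᴳ g) ≡ map relabelᴳ (insertᴳ z g)
  insert-relabel z ε          = ≡.refl
  insert-relabel z (node a g) = ≡.trans (cong (map (node (y a))) (insertᴳ-relabel z g))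
    (≡.trans (≡.sym (map-∘ (insertᴳ z g))) (map-∘ (insertᴳ z g)))
  -- At `end F` the list `insertᴳ` is `insert z F` with the `close` term put in second place, and
  -- this function rearranges a list accordingly. `insert` is never empty, so the value at [] is a
  -- mere default.
  insertᴳ-relabel z (end F)     = cong (λ { [] → [] ; (s ∷ j) → end s ∷ mid (relabel F) (y z) (end ε) ∷ map end j })
    (insert-relabel z F) ⟨≡⟩ cong (λ j → end (relabel (singleton z F)) ∷ mid (relabel F) (y z) (end ε) ∷ j)
    (≡.trans (≡.sym (map-∘ (join z F))) (map-∘ (join z F)))
    where
    infixr 5 _⟨≡⟩_
    _⟨≡⟩_ : ∀ {A : Set} {x y z : A} → x ≡ y → y ≡ z → x ≡ z
    _⟨≡⟩_ = ≡.trans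
  insertᴳ-relabel z (mid F x g) = ≡.trans (cong (map (mid (relabel F) (y x))) (insertᴳ-relabel z g))
    (≡.trans (≡.sym (map-∘ (insertᴳ z g))) (map-∘ (insertᴳ z g)))

  append-relabel : ∀ z π → append (y z) (map (map y) π) ≡ map (map (map y)) (append z π)
  append-relabel z []          = ≡.refl
  append-relabel z (V ∷ [])    = cong (λ B → (map y V ∷ [ [ y z ] ]) ∷ [ [ B ] ]) (≡.sym (map-++ y V [ z ]))
  append-relabel z (V ∷ W ∷ π) = ≡.trans (cong (map (map y V ∷_)) (append-relabel z (W ∷ π)))
    (≡.trans (≡.sym (map-∘ (append z (W ∷ π)))) (map-∘ (append z (W ∷ π))))

  insertAll-relabel : ∀ w → insertAll (map y w) ε ≡ map relabel (insertAll w ε)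
  insertAll-relabel w = iterate-natural′ y relabel insert-relabel w ε

  appendAll-relabel : ∀ w → appendAll (map y w) [] ≡ map (map (map y)) (appendAll w [])
  appendAll-relabel w = iterate-natural′ y (map (map y)) append-relabel w []

forests-insertAll : ∀ n → forests n ≡ insertAll (range n) ε
forests-insertAll = iterate-range insert forests ε ≡.refl (λ _ → ≡.refl)

intervals-appendAll : ∀ n → intervals n ≡ appendAll (range n) []
intervals-appendAll = iterate-range append intervals [] ≡.refl (λ _ → ≡.refl)

module Sums {c ℓ : Level} (R : CommutativeRing c ℓ) where
  open CommutativeRing R
  open Scalars R using (ΣK; ΠK) public
  open import Algebra.Solver.Ring.NaturalCoefficients.Default commutativeSemiring
    using (solve; _:+_; _:*_; _:=_)

  module _ {X : Set} where

    Σ-+ : ∀ (xs : List X) f g → ΣK xs (λ x → f x + g x) ≈ ΣK xs f + ΣK xs g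
    Σ-+ []       f g = sym (+-identityˡ _)
    Σ-+ (x ∷ xs) f g = trans (+-congˡ (Σ-+ xs f g))
      (solve 4 (λ x y z t → (x :+ y) :+ (z :+ t) := (x :+ z) :+ (y :+ t)) refl _ _ _ _)

    Σ-0 : ∀ (xs : List X) → ΣK xs (λ _ → 0#) ≈ 0#
    Σ-0 []       = refl
    Σ-0 (x ∷ xs) = trans (+-identityˡ _) (Σ-0 xs)

  module _ {X : Set} where

    Σ-++ : ∀ (xs ys : List X) f → ΣK (xs ++ ys) f ≈ ΣK xs f + ΣK ys f
    Σ-++ []       ys f = sym (+-identityˡ _)
    Σ-++ (x ∷ xs) ys f = trans (+-congˡ (Σ-++ xs ys f)) (sym (+-assoc _ _ _))

    Σ-concatMap : ∀ {Y : Set} (k : Y → List X) ys f → ΣK (concatMap k ys) f ≈ ΣK ys (λ y → ΣK (k y) f)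
    Σ-concatMap k []       f = refl
    Σ-concatMap k (y ∷ ys) f = trans (Σ-++ (k y) _ f) (+-congˡ (Σ-concatMap k ys f))

    Σ-map : ∀ {Y : Set} (k : Y → X) ys f → ΣK (map k ys) f ≈ ΣK ys (f ∘ k)
    Σ-map k []       f = refl
    Σ-map k (y ∷ ys) f = +-congˡ (Σ-map k ys f)

    Σ-local : ∀ {xs : List X} {f g} → All (λ x → f x ≈ g x) xs → ΣK xs f ≈ ΣK xs g
    Σ-local []       = refl
    Σ-local (e ∷ es) = +-cong e (Σ-local es)

    Σ-cong : ∀ (xs : List X) {f g} → (∀ x → f x ≈ g x) → ΣK xs f ≈ ΣK xs g
    Σ-cong xs e = Σ-local (All.universal e xs)

    Σ-*ˡ : ∀ k (xs : List X) f → ΣK xs (λ x → k * f x) ≈ k * ΣK xs f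
    Σ-*ˡ k []       f = sym (zeroʳ _)
    Σ-*ˡ k (x ∷ xs) f = trans (+-congˡ (Σ-*ˡ k xs f)) (sym (distribˡ _ _ _))

    Σ-swap : ∀ {Y : Set} (xs : List X) (ys : List Y) (f : X → Y → Carrier) → ΣK xs (λ x → ΣK ys (f x)) ≈ ΣK ys (λ y → ΣK xs (λ x → f x y))
    Σ-swap []       ys f = sym (Σ-0 ys)
    Σ-swap (x ∷ xs) ys f = trans (+-congˡ (Σ-swap xs ys f)) (sym (Σ-+ ys (f x) _))

    Σ-filterᵇ : ∀ (p : X → Bool) (xs : List X) {f g}
              → (∀ x → T (p x) → f x ≈ g x) → (∀ x → (T (p x) → ⊥) → 0# ≈ g x) → ΣK (filterᵇ p xs) f ≈ ΣK xs g
    Σ-filterᵇ p []       t e = refl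
    Σ-filterᵇ p (x ∷ xs) t e with p x | t x | e x
    ... | true  | tx | _  = +-cong (tx _) (Σ-filterᵇ p xs t e)
    ... | false | _  | ex = trans (Σ-filterᵇ p xs t e) (trans (sym (+-identityˡ _)) (+-congʳ (ex id)))

    Π-++ : ∀ (xs ys : List X) f → ΠK (xs ++ ys) f ≈ ΠK xs f * ΠK ys f
    Π-++ []       ys f = sym (*-identityˡ _)
    Π-++ (x ∷ xs) ys f = trans (*-congˡ (Π-++ xs ys f)) (sym (*-assoc _ _ _))

    Π-map : ∀ {Y : Set} (k : Y → X) ys f → ΠK (map k ys) f ≈ ΠK ys (f ∘ k)
    Π-map k []       f = refl
    Π-map k (y ∷ ys) f = *-congˡ (Π-map k ys f)

    Π-cong : ∀ (xs : List X) {f g} → (∀ x → f x ≈ g x) → ΠK xs f ≈ ΠK xs g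
    Π-cong []       e = refl
    Π-cong (x ∷ xs) e = *-cong (e x) (Π-cong xs e)

-- L is applied, once per block V, to the weight of V and of what is nested in it.  It is the
-- identity for free cumulants; for monotone cumulants it is integration, which maps s^k to
-- s^(k+1)/(k+1) and so produces the factor 1/N(V).
module ForestMoments {c ℓ : Level} (R : CommutativeRing c ℓ)
  (L : CommutativeRing.Carrier R → CommutativeRing.Carrier R) (L-linear : WordAlgebra.Linear R L) (κ : WordAlgebra.W R) where
  open CommutativeRing R
  open WordAlgebra R
  open Sums R
  open Linear L-linear

  weight  : Forest → Carrier
  -- f is κ after the elements of the block passed so far, scaled by the weights of the gaps between
  -- them. Keeping the gaps inside f ensures that `L` acts on the nested part too, and not on the
  -- trailing components.
  weightᴳ : W → Gaps → Carrier
  weight ε          = 1#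
  weight (node a g) = weightᴳ (∂ a κ) g
  weightᴳ f (end F)     = L (f []) * weight F
  weightᴳ f (mid F x g) = weightᴳ (weight F · ∂ x f) g

  moment : W
  moment w = ΣK (insertAll w ε) weight

  -- weightᴳ, with the components after the last element of the block weighted by e instead
  weightᴱ : (Forest → Carrier) → W → Gaps → Carrier
  weightᴱ e f (end F)     = L (f []) * e F
  weightᴱ e f (mid F x g) = weightᴱ e (weight F · ∂ x f) g

  weightᴱ-weight : ∀ f g → weightᴱ weight f g ≡ weightᴳ f g
  weightᴱ-weight f (end F)     = ≡.refl
  weightᴱ-weight f (mid F x g) = weightᴱ-weight (weight F · ∂ x f) g

  weightᴱ-cong : ∀ e {f f′} g → f ≐ f′ → weightᴱ e f g ≈ weightᴱ e f′ g
  weightᴱ-cong e (end F)     h = *-congʳ (L-cong (h []))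
  weightᴱ-cong e (mid F x g) h = weightᴱ-cong e g (λ v → *-congˡ (h (x ∷ v)))

  weightᴱ-⊞ : ∀ e f f′ g → weightᴱ e (f ⊞ f′) g ≈ weightᴱ e f g + weightᴱ e f′ g
  weightᴱ-⊞ e f f′ (end F)     = trans (*-congʳ (L-+ _ _)) (distribʳ _ _ _)
  weightᴱ-⊞ e f f′ (mid F x g) = trans (weightᴱ-cong e g (λ v → distribˡ _ _ _)) (weightᴱ-⊞ e (weight F · ∂ x f) (weight F · ∂ x f′) g)

  weightᴱ-0 : ∀ e g → weightᴱ e 0ʷ g ≈ 0#
  weightᴱ-0 e (end F)     = trans (*-congʳ L-0) (zeroˡ _)
  weightᴱ-0 e (mid F x g) = trans (weightᴱ-cong e g (λ v → zeroʳ _)) (weightᴱ-0 e g)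

  weightᴱ-Σ : ∀ e f g (Fs : List Forest) → ΣK Fs (λ F → weightᴱ e (weight F · f) g) ≈ weightᴱ e (ΣK Fs weight · f) g
  weightᴱ-Σ e f g []       = sym (trans (weightᴱ-cong e g (λ _ → zeroˡ _)) (weightᴱ-0 e g))
  weightᴱ-Σ e f g (F ∷ Fs) = trans (+-congˡ (weightᴱ-Σ e f g Fs)) (trans
    (sym (weightᴱ-⊞ e (weight F · f) (ΣK Fs weight · f) g)) (weightᴱ-cong e g (λ _ → sym (distribʳ _ _ _))))

  module _ (e : Forest → Carrier) where

    final : W
    final w = ΣK (insertAll w ε) e

    -- u holds the letters already placed in the current last gap. The next letter either enters the
    -- forest in that gap, so that u grows, or becomes the next element of the block, which freezes
    -- the gap with total weight `moment u`. These are the two summands in the recursion of `S`.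
    gap-sum : ∀ w u f → ΣK (insertAll u ε) (λ F → ΣK (insertAllᴳ w (end F)) (weightᴱ e f))
            ≈ S L moment final f (λ v → moment (u ++ v)) (λ v → final (u ++ v)) w
    gap-sum [] u f = begin
      ΣK (insertAll u ε) (λ F → L (f []) * e F + 0#)   ≈⟨ Σ-cong (insertAll u ε) (λ _ → +-identityʳ _) ⟩
      ΣK (insertAll u ε) (λ F → L (f []) * e F)        ≈⟨ Σ-*ˡ (L (f [])) (insertAll u ε) e ⟩
      L (f []) * final u                               ≈⟨ *-congˡ (reflexive (cong final (++-identityʳ u))) ⟨
      L (f []) * final (u ++ [])                       ∎
      where open SetoidReasoning setoid
    gap-sum (z ∷ w) u f = begin
      ΣK Fs (λ F → ΣK (insertAllᴳ (z ∷ w) (end F)) (weightᴱ e f))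
        -- `close` stands between `singletonᴳ` and `joinᴳ`; moving it to the end leaves exactly
        -- `insert z F` inside the gap.
        ≈⟨ Σ-cong Fs (λ F → trans (Σ-concatMap (insertAllᴳ w) (insertᴳ z (end F)) (weightᴱ e f))
             (trans (+-congˡ (+-congˡ (Σ-map end (join z F) G))) (solve 3 (λ x y t → x :+ (y :+ t) := (x :+ t) :+ y) refl _ _ _))) ⟩
      ΣK Fs (λ F → ΣK (insert z F) (G ∘ end) + G (mid F z (end ε)))
        ≈⟨ Σ-+ Fs _ _ ⟩
      ΣK Fs (λ F → ΣK (insert z F) (G ∘ end)) + ΣK Fs (λ F → G (mid F z (end ε)))
        ≈⟨ +-cong skip take ⟩
      S L moment final f (λ v → moment (u ++ z ∷ v)) (λ v → final (u ++ z ∷ v)) w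
        + S L moment final (moment (u ++ []) · ∂ z f) moment final w ∎
      where
      open SetoidReasoning setoid
      open import Algebra.Solver.Ring.NaturalCoefficients.Default commutativeSemiring using (solve; _:+_; _:=_)
      Fs = insertAll u ε
      G : Gaps → Carrier
      G g = ΣK (insertAllᴳ w g) (weightᴱ e f)
      reassoc : ∀ (H : W) v → H ((u ++ [ z ]) ++ v) ≈ H (u ++ z ∷ v)
      reassoc H v = reflexive (cong H (++-assoc u [ z ] v))
      skip : ΣK Fs (λ F → ΣK (insert z F) (G ∘ end)) ≈ S L moment final f (λ v → moment (u ++ z ∷ v)) (λ v → final (u ++ z ∷ v)) w
      skip = begin
        ΣK Fs (λ F → ΣK (insert z F) (G ∘ end))      ≈⟨ Σ-concatMap (insert z) Fs (G ∘ end) ⟨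
        ΣK (concatMap (insert z) Fs) (G ∘ end)       ≈⟨ reflexive (cong (λ Fs → ΣK Fs (G ∘ end)) (iterate-snoc insert u z ε)) ⟨
        ΣK (insertAll (u ++ [ z ]) ε) (G ∘ end)      ≈⟨ gap-sum w (u ++ [ z ]) f ⟩
        S L moment final f (λ v → moment ((u ++ [ z ]) ++ v)) (λ v → final ((u ++ [ z ]) ++ v)) w
          ≈⟨ S-cong {L} L-cong (≐-refl {moment}) (≐-refl {final}) ≐-refl (reassoc moment) (reassoc final) w ⟩
        S L moment final f (λ v → moment (u ++ z ∷ v)) (λ v → final (u ++ z ∷ v)) w ∎
      take : ΣK Fs (λ F → G (mid F z (end ε))) ≈ S L moment final (moment (u ++ []) · ∂ z f) moment final w
      take = begin
        ΣK Fs (λ F → G (mid F z (end ε)))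
          ≈⟨ Σ-cong Fs (λ F → trans (reflexive (cong (λ gs → ΣK gs (weightᴱ e f)) (insertAllᴳ-mid w F z (end ε))))
               (Σ-map (mid F z) (insertAllᴳ w (end ε)) (weightᴱ e f))) ⟩
        ΣK Fs (λ F → ΣK (insertAllᴳ w (end ε)) (weightᴱ e (weight F · ∂ z f)))
          -- Nothing can be inserted into a frozen gap, so its sum can be taken on the inside, where
          -- additivity of `weightᴱ` in f collects it to the scalar `moment u`.
          ≈⟨ Σ-swap Fs (insertAllᴳ w (end ε)) _ ⟩
        ΣK (insertAllᴳ w (end ε)) (λ g → ΣK Fs (λ F → weightᴱ e (weight F · ∂ z f) g))
          ≈⟨ Σ-cong (insertAllᴳ w (end ε)) (λ g → weightᴱ-Σ e (∂ z f) g Fs) ⟩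
        ΣK (insertAllᴳ w (end ε)) (weightᴱ e (moment u · ∂ z f))
          ≈⟨ trans (sym (+-identityʳ _)) (gap-sum w [] (moment u · ∂ z f)) ⟩
        S L moment final (moment u · ∂ z f) moment final w
          ≈⟨ S-cong {L} L-cong (≐-refl {moment}) (≐-refl {final})
               (λ v → *-congʳ (reflexive (cong moment (≡.sym (++-identityʳ u))))) ≐-refl ≐-refl w ⟩
        S L moment final (moment (u ++ []) · ∂ z f) moment final w ∎

    nodeWeight : Forest → Carrier
    nodeWeight ε          = 0#
    nodeWeight (node a g) = weightᴱ e (∂ a κ) g

    node-sum : ∀ a w → ΣK (insertAll (a ∷ w) ε) nodeWeight
             ≈ (L ∘ Sub moment (∂ a κ) ⋆ final) w
    node-sum a w = begin
      ΣK (insertAll w (node a (end ε)) ++ []) Φ        ≈⟨ reflexive (cong (λ Fs → ΣK Fs Φ) (++-identityʳ (insertAll w (node a (end ε))))) ⟩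
      ΣK (insertAll w (node a (end ε))) Φ              ≈⟨ reflexive (cong (λ Fs → ΣK Fs Φ) (insertAll-node w a (end ε))) ⟩
      ΣK (map (node a) (insertAllᴳ w (end ε))) Φ       ≈⟨ Σ-map (node a) (insertAllᴳ w (end ε)) Φ ⟩
      ΣK (insertAllᴳ w (end ε)) (weightᴱ e (∂ a κ))    ≈⟨ trans (sym (+-identityʳ _)) (gap-sum w [] (∂ a κ)) ⟩
      S L moment final (∂ a κ) moment final w          ≈⟨ S-split L moment final (∂ a κ) w ⟩
      (S L moment δ (∂ a κ) moment δ ⋆ final) w        ≈⟨ ⋆-congʳ {Q = final} (S-linear L-linear moment (∂ a κ)) w ⟩
      (L ∘ Sub moment (∂ a κ) ⋆ final) w                 ∎
      where
      open SetoidReasoning setoid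
      Φ = nodeWeight

  insertAll-∷ : ∀ a w → All (λ F → ∃[ g ] F ≡ node a g) (insertAll (a ∷ w) ε)
  insertAll-∷ a w = ≡.subst (All _) (≡.sym (≡.trans (++-identityʳ _) (insertAll-node w a (end ε))))
    (Allₚ.map⁺ (All.universal (λ g → g , ≡.refl) _))

  moment-equation : moment ≐ δ ⊞ (D (λ a → L ∘ Sub moment (∂ a κ)) ⋆ moment)
  moment-equation []      = +-congˡ (sym (zeroˡ _))
  moment-equation (a ∷ w) = begin
    moment (a ∷ w)                               ≈⟨ Σ-local (All.map (λ { (g , ≡.refl) → reflexive (≡.sym (weightᴱ-weight (∂ a κ) g)) }) (insertAll-∷ a w)) ⟩
    ΣK (insertAll (a ∷ w) ε) (nodeWeight weight) ≈⟨ node-sum weight a w ⟩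
    (L ∘ Sub moment (∂ a κ) ⋆ moment) w            ≈⟨ trans (+-identityˡ _) (trans (+-congʳ (zeroˡ _)) (+-identityˡ _)) ⟨
    (δ ⊞ (D (λ a → L ∘ Sub moment (∂ a κ)) ⋆ moment)) (a ∷ w) ∎
    where open SetoidReasoning setoid

  -- Irreducibility means that no component follows the first block. Weighting the trailing
  -- components by the indicator `single` of the empty forest expresses this as a choice of e, for
  -- which `final` is the unit.
  irreducible-sum : ∀ a w → ΣK (filterᵇ irreducible (insertAll (a ∷ w) ε)) weight ≈ L (Sub moment (∂ a κ) w)
  irreducible-sum a w = begin
    ΣK (filterᵇ irreducible (insertAll (a ∷ w) ε)) weight   ≈⟨ Σ-filterᵇ irreducible (insertAll (a ∷ w) ε) irr ¬irr ⟩
    ΣK (insertAll (a ∷ w) ε) (nodeWeight single)            ≈⟨ node-sum single a w ⟩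
    (L ∘ Sub moment (∂ a κ) ⋆ final single) w                 ≈⟨ ⋆-congˡ {L ∘ Sub moment (∂ a κ)} final-δ w ⟩
    (L ∘ Sub moment (∂ a κ) ⋆ δ) w                            ≈⟨ ⋆-identityʳ (L ∘ Sub moment (∂ a κ)) w ⟩
    L (Sub moment (∂ a κ) w)                                  ∎
    where
    open SetoidReasoning setoid
    single : Forest → Carrier
    single ε          = 1#
    single (node _ _) = 0#
    irrᴳ : ∀ f g → T (irreducibleᴳ g) → weightᴳ f g ≈ weightᴱ single f g
    irrᴳ f (end ε)     _ = refl
    irrᴳ f (mid F x g) h = irrᴳ (weight F · ∂ x f) g h
    ¬irrᴳ : ∀ f g → (T (irreducibleᴳ g) → ⊥) → 0# ≈ weightᴱ single f g
    ¬irrᴳ f (end ε)          h = ⊥-elim (h _)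
    ¬irrᴳ f (end (node _ _)) h = sym (zeroʳ _)
    ¬irrᴳ f (mid F x g)      h = ¬irrᴳ (weight F · ∂ x f) g h
    irr : ∀ F → T (irreducible F) → weight F ≈ nodeWeight single F
    irr (node a g) h = irrᴳ (∂ a κ) g h
    ¬irr : ∀ F → (T (irreducible F) → ⊥) → 0# ≈ nodeWeight single F
    ¬irr ε          h = refl
    ¬irr (node a g) h = ¬irrᴳ (∂ a κ) g h
    final-δ : final single ≐ δ
    final-δ []      = +-identityʳ _
    final-δ (a ∷ w) = trans (Σ-local {g = λ _ → 0#} (All.map (λ { (g , ≡.refl) → refl }) (insertAll-∷ a w))) (Σ-0 (insertAll (a ∷ w) ε))

-- Moments from Boolean cumulants

module IntervalMoments {c ℓ : Level} (R : CommutativeRing c ℓ)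
  (κ : WordAlgebra.W R) where
  open CommutativeRing R
  open WordAlgebra R
  open Sums R

  moment : W
  moment w = ΣK (appendAll w []) (λ π → ΠK π κ)

  -- V is the block still growing: the next letter joins it or opens a new block, and in the latter
  -- case V no longer changes.
  block-sum : ∀ V w → ΣK (appendAll w [ V ]) (λ π → ΠK π κ) ≈ ((λ v → κ (V ++ v)) ⋆ moment) w
  block-sum V []      = begin
    κ V * 1# + 0#                 ≈⟨ trans (+-identityʳ _) (*-cong (reflexive (cong κ (≡.sym (++-identityʳ V)))) (sym (+-identityʳ _))) ⟩
    κ (V ++ []) * (1# + 0#)       ∎
    where open SetoidReasoning setoid
  block-sum V (z ∷ w) = begin
    ΣK (concatMap (appendAll w) ((V ∷ [ [ z ] ]) ∷ [ [ V ++ [ z ] ] ])) Φ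
      ≈⟨ Σ-concatMap (appendAll w) ((V ∷ [ [ z ] ]) ∷ [ [ V ++ [ z ] ] ]) Φ ⟩
    ΣK (appendAll w (V ∷ [ [ z ] ])) Φ + (ΣK (appendAll w [ V ++ [ z ] ]) Φ + 0#)
      ≈⟨ +-cong (trans (reflexive (cong (λ πs → ΣK πs Φ) (appendAll-∷ w V [ z ] []))) (trans (Σ-map (V ∷_) (appendAll w [ [ z ] ]) Φ)
           (Σ-*ˡ (κ V) (appendAll w [ [ z ] ]) Φ)))
           (trans (+-identityʳ _) (block-sum (V ++ [ z ]) w)) ⟩
    κ V * ΣK (appendAll w [ [ z ] ]) Φ + ((λ v → κ ((V ++ [ z ]) ++ v)) ⋆ moment) w
      ≈⟨ +-cong (*-cong (reflexive (cong κ (≡.sym (++-identityʳ V)))) (reflexive (cong (λ πs → ΣK πs Φ) (≡.sym (++-identityʳ (appendAll w [ [ z ] ]))))))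
           (⋆-congʳ {Q = moment} (λ v → reflexive (cong κ (++-assoc V [ z ] v))) w) ⟩
    ((λ v → κ (V ++ v)) ⋆ moment) (z ∷ w) ∎
    where
    open SetoidReasoning setoid
    Φ : Partition → Carrier
    Φ π = ΠK π κ

  moment-equation : moment ≐ δ ⊞ (D (λ a → ∂ a κ) ⋆ moment)
  moment-equation []      = +-congˡ (sym (zeroˡ _))
  moment-equation (a ∷ w) = begin
    moment (a ∷ w)                                        ≈⟨ reflexive (cong (λ πs → ΣK πs (λ π → ΠK π κ)) (++-identityʳ (appendAll w [ [ a ] ]))) ⟩
    ΣK (appendAll w [ [ a ] ]) (λ π → ΠK π κ)             ≈⟨ block-sum [ a ] w ⟩
    (∂ a κ ⋆ moment) w                                    ≈⟨ trans (+-identityˡ _) (trans (+-congʳ (zeroˡ _)) (+-identityˡ _)) ⟨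
    (δ ⊞ (D (λ a → ∂ a κ) ⋆ moment)) (a ∷ w)              ∎
    where open SetoidReasoning setoid

-- Moments from free cumulants

module FreeMoments {c ℓ : Level} (R : CommutativeRing c ℓ)
  (κ : WordAlgebra.W R) where
  open CommutativeRing R
  open WordAlgebra R
  open Sums R
  open import Algebra.Solver.Ring.NaturalCoefficients.Default commutativeSemiring
    using (solve; _:+_; _:*_; _:=_)

  id-linear : Linear id
  id-linear = record { L-cong = id ; L-+ = λ _ _ → refl ; L-0 = refl }

  open ForestMoments R id id-linear κ public

  weight-Π  : ∀ F → weight F ≈ ΠK (flatten F) κ
  weightᴳ-Π : ∀ f g → weightᴳ f g ≈ f (block g) * ΠK (blocks g) κ
  weight-Π ε          = refl
  weight-Π (node a g) = weightᴳ-Π (∂ a κ) g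
  weightᴳ-Π f (end F)     = *-congˡ (weight-Π F)
  weightᴳ-Π f (mid F x g) = trans (weightᴳ-Π (weight F · ∂ x f) g) (trans (*-congʳ (*-congʳ (weight-Π F)))
    (trans (solve 3 (λ x y z → (x :* y) :* z := y :* (x :* z)) refl _ _ _) (*-congˡ (sym (Π-++ (flatten F) (blocks g) κ)))))

module Reciprocals {c ℓ : Level} (K : CommutativeRing c ℓ)
  (recip : ℕ → CommutativeRing.Carrier K) (is-recip : Scalars.IsReciprocal K recip) where
  open CommutativeRing K
  open Scalars K using (fromℕ)
  open import Algebra.Solver.Ring.NaturalCoefficients.Default commutativeSemiring
    using (solve; _:*_; _:=_)

  fromℕ-+ : ∀ m n → fromℕ (m ℕ.+ n) ≈ fromℕ m + fromℕ n
  fromℕ-+ zero    n = sym (+-identityˡ _)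
  fromℕ-+ (suc m) n = trans (+-congˡ (fromℕ-+ m n)) (sym (+-assoc _ _ _))

  fromℕ-* : ∀ m n → fromℕ (m ℕ.* n) ≈ fromℕ m * fromℕ n
  fromℕ-* zero    n = sym (zeroˡ _)
  fromℕ-* (suc m) n = trans (fromℕ-+ n (m ℕ.* n)) (trans (+-cong (sym (*-identityˡ _)) (fromℕ-* m n)) (sym (distribʳ _ _ _)))

  recip-1 : recip 1 ≈ 1#
  recip-1 = trans (sym (trans (*-congʳ (+-identityʳ _)) (*-identityˡ _))) (is-recip 1 (λ ()))

  recip-homo : ∀ m n → m ≢ 0 → n ≢ 0 → recip (m ℕ.* n) ≈ recip m * recip n
  recip-homo m n m≢0 n≢0 = begin
    recip (m ℕ.* n)                                                        ≈⟨ unit ⟨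
    ((fromℕ m * recip m) * (fromℕ n * recip n)) * recip (m ℕ.* n)
      ≈⟨ solve 5 (λ a b c d e → ((a :* b) :* (c :* d)) :* e := (b :* d) :* ((a :* c) :* e)) refl _ _ _ _ _ ⟩
    (recip m * recip n) * ((fromℕ m * fromℕ n) * recip (m ℕ.* n))          ≈⟨ *-congˡ (*-congʳ (fromℕ-* m n)) ⟨
    (recip m * recip n) * (fromℕ (m ℕ.* n) * recip (m ℕ.* n))              ≈⟨ *-congˡ (is-recip (m ℕ.* n) (*-≢0 m n m≢0 n≢0)) ⟩
    (recip m * recip n) * 1#                                               ≈⟨ *-identityʳ _ ⟩
    recip m * recip n                                                      ∎
    where
    open SetoidReasoning setoid
    unit : ∀ {x} → ((fromℕ m * recip m) * (fromℕ n * recip n)) * x ≈ x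
    unit = trans (*-congʳ (trans (*-cong (is-recip m m≢0) (is-recip n n≢0)) (*-identityˡ _))) (*-identityˡ _)

-- Moments from monotone cumulants

module MonotoneMoments {c ℓ : Level} (K : CommutativeRing c ℓ)
  (recip : ℕ → CommutativeRing.Carrier K) (is-recip : Scalars.IsReciprocal K recip) (h : WordAlgebra.W K) where
  open CommutativeRing K
  open Polynomials K
  open Integration recip is-recip
  open Sums K
  open Reciprocals K recip is-recip
  open import Algebra.Solver.Ring.NaturalCoefficients.Default commutativeSemiring
    using (solve; _:*_; _:=_)
  private module R = CommutativeRing polyRing

  ∫-linear : WordAlgebra.Linear polyRing ∫
  ∫-linear = record { L-cong = ∫-cong ; L-+ = ∫-+ ; L-0 = shift-[] }

  open ForestMoments polyRing ∫ ∫-linear (const ∘ h) public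

  weight-mono  : ∀ F → weight F ≈ᴾ mono (size F) (recip (treeFactorial F) * ΠK (flatten F) h)
  -- n counts the blocks in the gaps already passed and q is the coefficient accumulated there. At
  -- the end of the block the degree has reached the number of nested blocks, one less than the
  -- divisor produced by `∫`.
  weightᴳ-mono : ∀ n f (q : List ℕ → Carrier) g → (∀ v → f v ≈ᴾ mono n (q v))
               → weightᴳ f g ≈ᴾ mono (suc (n ℕ.+ length (blocks g)))
                   (recip (suc (n ℕ.+ innerSize g)) * (recip (treeFactorialᴳ g) * (q (block g) * ΠK (blocks g) h)))
  weight-mono ε          = mono-cong 0 (trans (sym recip-1) (sym (*-identityʳ _)))
  weight-mono (node a g) = R.trans (weightᴳ-mono 0 (const ∘ h ∘ (a ∷_)) (h ∘ (a ∷_)) g (λ _ → R.refl))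
    (mono-cong (suc (length (blocks g))) (trans (sym (*-assoc _ _ _))
      (*-congʳ (sym (recip-homo (suc (innerSize g)) (treeFactorialᴳ g) (λ ()) (treeFactorialᴳ≢0 g))))))
  weightᴳ-mono n f q (end F) e = R.trans
    (R.*-cong (R.trans (∫-cong (e [])) (∫-mono n (q []))) (weight-mono F))
    (R.trans (mono-* (suc n) (size F) _ _) (mono-cong (suc (n ℕ.+ size F))
      (trans (solve 4 (λ r x t p → (r :* x) :* (t :* p) := r :* (t :* (x :* p))) refl _ _ _ _)
        (*-congʳ (reflexive (cong (recip ∘ suc) (≡.sym (ℕₚ.+-identityʳ n))))))))
  weightᴳ-mono n f q (mid F x g) e = R.trans
    (weightᴳ-mono (size F ℕ.+ n) _ (λ v → (recip (treeFactorial F) * ΠK (flatten F) h) * q (x ∷ v)) g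
      (λ v → R.trans (R.*-cong (weight-mono F) (e (x ∷ v))) (mono-* (size F) n _ _)))
    (mono-≡ (cong suc (≡.trans (rearrange (length (blocks g))) (cong (n ℕ.+_) (≡.sym (length-++ (flatten F))))))
      (*-cong (reflexive (cong (recip ∘ suc) (rearrange (innerSize g))))
        (trans (solve 5 (λ r t p y z → r :* (((t :* p) :* y) :* z) := (t :* r) :* (y :* (p :* z))) refl _ _ _ _ _)
          (*-cong (sym (recip-homo (treeFactorial F) (treeFactorialᴳ g) (treeFactorial≢0 F) (treeFactorialᴳ≢0 g)))
            (*-congˡ (sym (Π-++ (flatten F) (blocks g) h)))))))
    where
    rearrange : ∀ k → size F ℕ.+ n ℕ.+ k ≡ n ℕ.+ (size F ℕ.+ k)
    rearrange k = ≡.trans (cong (ℕ._+ k) (ℕₚ.+-comm (size F) n)) (ℕₚ.+-assoc n (size F) k)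

-- The flow of monotone moments

module WordHom {c ℓ c′ ℓ′ : Level} (R : CommutativeRing c ℓ) (R′ : CommutativeRing c′ ℓ′)
  (η : CommutativeRing.Carrier R → CommutativeRing.Carrier R′)
  (η-hom : IsRingHomomorphism (CommutativeRing.rawRing R) (CommutativeRing.rawRing R′) η) where
  private
    module A = WordAlgebra R
    module B = WordAlgebra R′
  open CommutativeRing R′
  open IsRingHomomorphism η-hom

  hom-δ : η ∘ A.δ B.≐ B.δ
  hom-δ []      = 1#-homo
  hom-δ (_ ∷ _) = 0#-homo

  hom-D : ∀ F → η ∘ A.D F B.≐ B.D (λ a → η ∘ F a)
  hom-D F []      = 0#-homo
  hom-D F (_ ∷ _) = refl

  hom-⋆ : ∀ P Q → η ∘ (P A.⋆ Q) B.≐ (η ∘ P) B.⋆ (η ∘ Q)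
  hom-⋆ P Q []      = *-homo _ _
  hom-⋆ P Q (a ∷ w) = trans (+-homo _ _) (+-cong (*-homo _ _) (hom-⋆ (A.∂ a P) Q w))

  hom-S : ∀ H E f P Q → η ∘ A.S id H E f P Q B.≐ B.S id (η ∘ H) (η ∘ E) (η ∘ f) (η ∘ P) (η ∘ Q)
  hom-S H E f P Q []      = *-homo _ _
  hom-S H E f P Q (z ∷ w) = trans (+-homo _ _) (+-cong (hom-S H E f (A.∂ z P) (A.∂ z Q) w)
    (trans (hom-S H E (P [] A.· A.∂ z f) H E w)
      (B.S-cong {id} id (B.≐-refl {η ∘ H}) (B.≐-refl {η ∘ E}) (λ v → *-homo _ _) B.≐-refl B.≐-refl w)))

  hom-Sub : ∀ H f → η ∘ A.Sub H f B.≐ B.Sub (η ∘ H) (η ∘ f)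
  hom-Sub H f = B.≐-trans (hom-S H A.δ f H A.δ)
    (B.S-cong {id} id (B.≐-refl {η ∘ H}) hom-δ B.≐-refl B.≐-refl hom-δ)

record Derivation {c ℓ : Level} (R : CommutativeRing c ℓ) : Set (c Level.⊔ ℓ) where
  open CommutativeRing R
  field
    d   : Carrier → Carrier
    d-+ : ∀ x y → d (x + y) ≈ d x + d y
    d-* : ∀ x y → d (x * y) ≈ d x * y + x * d y

module WordDerivation {c ℓ : Level} (R : CommutativeRing c ℓ) (∇ : Derivation R) where
  open CommutativeRing R
  open Derivation ∇
  open WordAlgebra R
  open import Algebra.Solver.Ring.NaturalCoefficients.Default commutativeSemiring
    using (solve; _:+_; _:*_; _:=_)

  Constant : W → Set ℓ
  Constant P = d ∘ P ≐ 0ʷ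

  d-⋆ : ∀ P Q → d ∘ (P ⋆ Q) ≐ ((d ∘ P) ⋆ Q) ⊞ (P ⋆ (d ∘ Q))
  d-⋆ P Q []      = d-* _ _
  d-⋆ P Q (a ∷ w) = trans (d-+ _ _) (trans (+-cong (d-* _ _) (d-⋆ (∂ a P) Q w))
    (solve 4 (λ x y z t → (x :+ y) :+ (z :+ t) := (x :+ z) :+ (y :+ t)) refl _ _ _ _))

  d-*-constantʳ : ∀ x {y} → d y ≈ 0# → d (x * y) ≈ d x * y
  d-*-constantʳ x e = trans (d-* _ _) (trans (+-congˡ (trans (*-congˡ e) (zeroʳ _))) (+-identityʳ _))

  -- Each summand of `S` is linear in f; with the other data constant, the Leibniz rule leaves only
  -- the term in which f is differentiated.
  d-S : ∀ {H E P Q} → Constant H → Constant E → ∀ f → Constant P → Constant Q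
      → d ∘ S id H E f P Q ≐ S id H E (d ∘ f) P Q
  d-S h e f p q []      = d-*-constantʳ _ (q [])
  d-S {H} {E} {P} {Q} h e f p q (z ∷ w) = trans (d-+ _ _) (+-cong
    (d-S h e f (λ v → p (z ∷ v)) (λ v → q (z ∷ v)) w)
    (trans (d-S h e (P [] · ∂ z f) h e w)
      (S-cong {id} id (≐-refl {H}) (≐-refl {E})
        (λ v → trans (d-* _ _) (trans (+-congʳ (trans (*-congʳ (p [])) (zeroˡ _))) (+-identityˡ _))) ≐-refl ≐-refl w)))

module MonotoneFlow {c ℓ : Level} (K : CommutativeRing c ℓ)
  (recip : ℕ → CommutativeRing.Carrier K) (is-recip : Scalars.IsReciprocal K recip) where
  open CommutativeRing K
  open Polynomials K
  open Integration recip is-recip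
  private
    module R = CommutativeRing polyRing
    module A = WordAlgebra K

  differentiation : Derivation polyRing
  differentiation = record { d = d ; d-+ = d-+ ; d-* = d-* }

  open WordAlgebra polyRing
  open WordDerivation polyRing differentiation

  const-hom : IsRingHomomorphism rawRing R.rawRing const
  const-hom = record
    { isSemiringHomomorphism = record
      { isNearSemiringHomomorphism = record
        { +-isMonoidHomomorphism = record
          { isMagmaHomomorphism = record
            { isRelHomomorphism = record { cong = mono-cong 0 } ; homo = λ _ _ → R.refl }
          ; ε-homo = shift-[] }
        ; *-homo = λ a b → mono-cong 0 (sym (+-identityʳ _)) }
      ; 1#-homo = R.refl }
    ; -‿homo = λ _ → R.refl }

  module EvalAt (x : Carrier) = Evaluation K K id (isRingHomomorphism rawRing refl) x
  open EvalAt 0#     public using () renaming (eval to ev₀; eval-hom to ev₀-hom)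
  open EvalAt 1#     public using () renaming (eval to ev₁; eval-hom to ev₁-hom)
  open EvalAt (- 1#) public using () renaming (eval to ev₋; eval-hom to ev₋-hom)

  s-1 : Poly
  s-1 = - 1# ∷ 1# ∷ []

  -- substitution of s - 1 for the variable s
  open Evaluation K polyRing const const-hom s-1
    using () renaming (eval to σ; eval-hom to σ-hom; eval-+ to σ-+; eval-shift to σ-shift; eval-const to σ-const)

  private
    module H₀ = WordHom polyRing K ev₀ ev₀-hom
    module H₁ = WordHom polyRing K ev₁ ev₁-hom
    module Hσ = WordHom polyRing polyRing σ σ-hom

  ev₀-coef : ∀ p → ev₀ p ≈ coef p 0
  ev₀-coef []      = refl
  ev₀-coef (a ∷ p) = trans (+-congˡ (zeroˡ _)) (+-identityʳ _)

  ev-const : ∀ x a → EvalAt.eval x (const a) ≈ a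
  ev-const x a = EvalAt.eval-const x a

  ev₀-σ : ∀ p → ev₀ (σ p) ≈ ev₋ p
  ev₀-σ []      = refl
  ev₀-σ (a ∷ p) = trans (+-homo (const a) (s-1 *ᴾ σ p)) (+-cong (ev-const 0# a)
    (trans (*-homo s-1 (σ p)) (*-cong (ev₀-coef s-1) (ev₀-σ p))))
    where open IsRingHomomorphism ev₀-hom

  ev₁-σ : ∀ p → ev₁ (σ p) ≈ ev₀ p
  ev₁-σ []      = refl
  ev₁-σ (a ∷ p) = trans (+-homo (const a) (s-1 *ᴾ σ p)) (+-cong (ev-const 1# a)
    (trans (*-homo s-1 (σ p)) (trans (*-congʳ at-1) (trans (zeroˡ _) (sym (zeroˡ _))))))
    where
    open IsRingHomomorphism ev₁-hom
    at-1 : ev₁ s-1 ≈ 0#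
    at-1 = trans (+-congˡ (trans (*-identityˡ _) (trans (+-congˡ (zeroʳ _)) (+-identityʳ _)))) (-‿inverseˡ 1#)

  d-const : ∀ a → d (const a) ≈ᴾ []
  d-const a = shift-[]

  d-s-1 : d s-1 ≈ᴾ 1ᴾ
  d-s-1 = ≈coef λ { zero → +-identityʳ _ ; (suc zero) → refl ; (suc (suc n)) → refl }

  d-σ : ∀ p → d (σ p) ≈ᴾ σ (d p)
  d-σ []      = R.refl
  d-σ (a ∷ p) = begin
    d (const a +ᴾ s-1 *ᴾ σ p)                 ≈⟨ d-+ (const a) (s-1 *ᴾ σ p) ⟩
    d (const a) +ᴾ d (s-1 *ᴾ σ p)             ≈⟨ R.+-cong (d-const a) (d-* s-1 (σ p)) ⟩
    d s-1 *ᴾ σ p +ᴾ s-1 *ᴾ d (σ p)            ≈⟨ R.+-cong (R.trans (R.*-congʳ {σ p} d-s-1) (R.*-identityˡ (σ p))) (R.*-congˡ {s-1} (d-σ p)) ⟩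
    σ p +ᴾ s-1 *ᴾ σ (d p)                     ≈⟨ R.+-congˡ {σ p} (σ-shift (d p)) ⟨
    σ p +ᴾ σ (shift (d p))                    ≈⟨ σ-+ p (shift (d p)) ⟨
    σ (p +ᴾ shift (d p))                      ∎
    where open SetoidReasoning R.setoid

  module _ (h : ℕ → A.W) where

    hᴾ : ℕ → W
    hᴾ a = const ∘ h a

    -- The vector field whose time-s flow is the word function of monotone moments.
    V : W → W
    V X = X ⋆ D (λ z → Sub X (hᴾ z) ⋆ X)

    -- `D` consumes a letter, so the value of `V X` at w involves X at shorter words only. The
    -- differential equation is thus triangular, and its solution is found word by word by
    -- integration.
    V-local : ∀ {X Y} w → (∀ v → length v < length w → X v ≈ᴾ Y v) → V X w ≈ᴾ V Y w
    V-local {X} {Y} w e = ⋆-cong< {X} {Y} w e λ z v lt →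
      let e′ = λ u le → e u (ℕₚ.≤-<-trans le lt) in
      ⋆-cong≤ {Sub X (hᴾ z)} {Sub Y (hᴾ z)} {X} {Y} v
        (λ u le → Sub-cong≤ {X} {Y} u (λ t le′ → e′ t (ℕₚ.≤-trans le′ le)) (hᴾ z)) e′

    ode-unique : ∀ {X Y} → d ∘ X ≐ V X → d ∘ Y ≐ V Y → (∀ w → ev₀ (X w) ≈ ev₀ (Y w)) → X ≐ Y
    ode-unique {X} {Y} x y e w = length-ind (λ w → X w ≈ᴾ Y w) step w
      where
      step : ∀ w → (∀ v → length v < length w → X v ≈ᴾ Y v) → X w ≈ᴾ Y w
      step w ih = d-unique (X w) (Y w) (R.trans (x w) (R.trans (V-local w ih) (R.sym (y w))))
        (trans (sym (ev₀-coef (X w))) (trans (e w) (ev₀-coef (Y w))))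

    module _ (M : W) (M-eq : M ≐ δ ⊞ (D (λ a → ∫ ∘ Sub M (hᴾ a)) ⋆ M)) where
      private
        t i : ℕ → W
        t a = Sub M (hᴾ a)
        i a = ∫ ∘ t a

        -- The position of the flow at time -1, regarded as constant in s, from which the flow is
        -- started again.
        C : W
        C = const ∘ ev₋ ∘ M

        C-constant : Constant C
        C-constant w = d-const (ev₋ (M w))

        δ-constant : Constant δ
        δ-constant []      = shift-[]
        δ-constant (_ ∷ _) = R.refl

        linear-unique : ∀ A Y Z → Y ≐ A ⊞ (D i ⋆ Y) → Z ≐ A ⊞ (D i ⋆ Z) → Y ≐ Z
        linear-unique A Y Z y z w = go w w ℕₚ.≤-refl
          where
          -- The list n serves only as a bound on the length of w, so that the recursion is
          -- structural.
          go : ∀ n w → length w ≤ length n → Y w ≈ᴾ Z w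
          go n []      _  = R.trans (y []) (R.sym (z []))
          go (_ ∷ n) (a ∷ w) (s≤s le) = R.trans (y (a ∷ w)) (R.trans
            (R.+-congˡ {A (a ∷ w)} (⋆-cong≤ {i a} {i a} {Y} {Z} w (λ _ _ → R.refl) (λ v le′ → go n v (ℕₚ.≤-trans le′ le))))
            (R.sym (z (a ∷ w))))

        -- Differentiating M = 1 + Di M gives dM = Dt M + Di dM. Multiplying the same equation by Dt
        -- M shows that M Dt M satisfies this linear equation as well, and its solution is unique.
        -- The integrals are thereby eliminated and an autonomous equation remains.
        dM : d ∘ M ≐ V M
        dM = ≐-trans (linear-unique (D t ⋆ M) (d ∘ M) (M ⋆ (D t ⋆ M)) eq₁ eq₂) (⋆-congˡ {M} (D-⋆ t M))
          where
          open ≐-Reasoning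
          d-D : d ∘ D i ≐ D t
          d-D []      = R.refl
          d-D (a ∷ w) = d-∫ (t a w)
          eq₁ : d ∘ M ≐ (D t ⋆ M) ⊞ (D i ⋆ (d ∘ M))
          eq₁ = begin
            d ∘ M                                  ≈⟨ (λ w → d-cong (M-eq w)) ⟩
            d ∘ (δ ⊞ (D i ⋆ M))                    ≈⟨ (λ w → d-+ (δ w) _) ⟩
            (d ∘ δ) ⊞ (d ∘ (D i ⋆ M))              ≈⟨ ⊞-cong δ-constant (d-⋆ (D i) M) ⟩
            ((d ∘ D i) ⋆ M) ⊞ (D i ⋆ (d ∘ M))      ≈⟨ ⊞-cong (⋆-congʳ {Q = M} d-D) (≐-refl {D i ⋆ (d ∘ M)}) ⟩
            (D t ⋆ M) ⊞ (D i ⋆ (d ∘ M))            ∎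
          eq₂ : M ⋆ (D t ⋆ M) ≐ (D t ⋆ M) ⊞ (D i ⋆ (M ⋆ (D t ⋆ M)))
          eq₂ = begin
            M ⋆ (D t ⋆ M)                              ≈⟨ ⋆-congʳ {Q = D t ⋆ M} M-eq ⟩
            (δ ⊞ (D i ⋆ M)) ⋆ (D t ⋆ M)                ≈⟨ ⋆-distribʳ δ (D i ⋆ M) (D t ⋆ M) ⟩
            (δ ⋆ (D t ⋆ M)) ⊞ ((D i ⋆ M) ⋆ (D t ⋆ M))  ≈⟨ ⊞-cong (⋆-identityˡ (D t ⋆ M)) (⋆-assoc (D i) M (D t ⋆ M)) ⟩
            (D t ⋆ M) ⊞ (D i ⋆ (M ⋆ (D t ⋆ M)))        ∎

        ev₀-M : ev₀ ∘ M A.≐ A.δ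
        ev₀-M w = trans (ev₀-cong (M-eq w)) (trans (+-homo (δ w) _) (trans
          (+-cong (H₀.hom-δ w) (trans (H₀.hom-⋆ (D i) M w) (trans (A.⋆-congʳ {Q = ev₀ ∘ M} ev₀-D w) (A.⋆-zeroˡ (ev₀ ∘ M) w))))
          (+-identityʳ _)))
          where
          open IsRingHomomorphism ev₀-hom renaming (⟦⟧-cong to ev₀-cong)
          ev₀-D : ev₀ ∘ D i A.≐ A.0ʷ
          ev₀-D []      = refl
          ev₀-D (a ∷ w) = ev₀-coef (i a w)

        -- The flow started at time -1, in two ways: X uses the composition law, Y a time shift.
        X Y : W
        X = Sub C M ⋆ C
        Y = σ ∘ M

        -- V is invariant under composition with a constant series on the right: d passes through
        -- `Sub C`, and `Sub-∘` turns `Sub C (t z)` into `Sub X (hᴾ z)`.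
        dX : d ∘ X ≐ V X
        dX = begin
          d ∘ (Sub C M ⋆ C)                                        ≈⟨ d-⋆ (Sub C M) C ⟩
          ((d ∘ Sub C M) ⋆ C) ⊞ (Sub C M ⋆ (d ∘ C))                  ≈⟨ ⊞-cong (≐-refl {(d ∘ Sub C M) ⋆ C}) (≐-trans (⋆-congˡ {Sub C M} C-constant) (⋆-zeroʳ (Sub C M))) ⟩
          ((d ∘ Sub C M) ⋆ C) ⊞ 0ʷ                                 ≈⟨ (λ w → R.+-identityʳ (((d ∘ Sub C M) ⋆ C) w)) ⟩
          (d ∘ Sub C M) ⋆ C                                        ≈⟨ ⋆-congʳ {Q = C} (≐-trans (d-S C-constant δ-constant M C-constant δ-constant) (Sub-cong {C} ≐-refl dM)) ⟩
          Sub C (M ⋆ D (λ z → t z ⋆ M)) ⋆ C                        ≈⟨ ⋆-congʳ {Q = C} (≐-trans (Sub-⋆ C M (D (λ z → t z ⋆ M)))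
                                                                      (⋆-congˡ {Sub C M} (Sub-D C (λ z → t z ⋆ M)))) ⟩
          (Sub C M ⋆ (C ⋆ D (λ z → Sub C (t z ⋆ M)))) ⋆ C            ≈⟨ ⋆-congʳ {Q = C} (≐-sym (⋆-assoc (Sub C M) C (D (λ z → Sub C (t z ⋆ M))))) ⟩
          (X ⋆ D (λ z → Sub C (t z ⋆ M))) ⋆ C                      ≈⟨ ⋆-assoc X (D (λ z → Sub C (t z ⋆ M))) C ⟩
          X ⋆ (D (λ z → Sub C (t z ⋆ M)) ⋆ C)                      ≈⟨ ⋆-congˡ {X} (D-⋆ (λ z → Sub C (t z ⋆ M)) C) ⟩
          X ⋆ D (λ z → Sub C (t z ⋆ M) ⋆ C)                        ≈⟨ ⋆-congˡ {X} (D-cong λ z →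
            ≐-trans (⋆-congʳ {Q = C} (≐-trans (Sub-⋆ C (t z) M) (⋆-congʳ {Q = Sub C M} (Sub-∘ M C (hᴾ z)))))
                    (⋆-assoc (Sub X (hᴾ z)) (Sub C M) C)) ⟩
          X ⋆ D (λ z → Sub X (hᴾ z) ⋆ X)                           ∎
          where
          open ≐-Reasoning

        -- A time shift preserves solutions because s - 1 has derivative 1 and the coefficients of V
        -- are constant in s, hence fixed by σ.
        dY : d ∘ Y ≐ V Y
        dY = begin
          d ∘ σ ∘ M                                        ≈⟨ (λ w → d-σ (M w)) ⟩
          σ ∘ d ∘ M                                        ≈⟨ (λ w → ⟦⟧-cong (dM w)) ⟩
          σ ∘ (M ⋆ D (λ z → t z ⋆ M))                      ≈⟨ Hσ.hom-⋆ M (D (λ z → t z ⋆ M)) ⟩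
          Y ⋆ (σ ∘ D (λ z → t z ⋆ M))                      ≈⟨ ⋆-congˡ {Y} (Hσ.hom-D (λ z → t z ⋆ M)) ⟩
          Y ⋆ D (λ z → σ ∘ (t z ⋆ M))                      ≈⟨ ⋆-congˡ {Y} (D-cong λ z → ≐-trans (Hσ.hom-⋆ (t z) M)
            (⋆-congʳ {Q = Y} (≐-trans (Hσ.hom-Sub M (hᴾ z)) (Sub-cong {Y} ≐-refl (λ w → σ-const (h z w)))))) ⟩
          Y ⋆ D (λ z → Sub Y (hᴾ z) ⋆ Y)                     ∎
          where
          open ≐-Reasoning
          open IsRingHomomorphism σ-hom

      flow-inverse : A.Sub (ev₋ ∘ M) (ev₁ ∘ M) A.⋆ (ev₋ ∘ M) A.≐ A.δ
      flow-inverse w = begin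
        (A.Sub N (ev₁ ∘ M) A.⋆ N) w                    ≈⟨ A.⋆-cong (A.Sub-cong {ev₁ ∘ C} {N} {ev₁ ∘ M} (λ v → ev-const 1# (N v)) A.≐-refl) (λ v → ev-const 1# (N v)) w ⟨
        (A.Sub (ev₁ ∘ C) (ev₁ ∘ M) A.⋆ (ev₁ ∘ C)) w    ≈⟨ A.⋆-congʳ {Q = ev₁ ∘ C} (H₁.hom-Sub C M) w ⟨
        ((ev₁ ∘ Sub C M) A.⋆ (ev₁ ∘ C)) w              ≈⟨ H₁.hom-⋆ (Sub C M) C w ⟨
        ev₁ (X w)                                    ≈⟨ ⟦⟧-cong (ode-unique dX dY initial w) ⟩
        ev₁ (Y w)                                    ≈⟨ ev₁-σ (M w) ⟩
        ev₀ (M w)                                    ≈⟨ ev₀-M w ⟩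
        A.δ w                                        ∎
        where
        open SetoidReasoning setoid
        open IsRingHomomorphism ev₁-hom
        N : A.W
        N = ev₋ ∘ M
        initial : ∀ w → ev₀ (X w) ≈ ev₀ (Y w)
        initial w = begin
          ev₀ (X w)                                   ≈⟨ H₀.hom-⋆ (Sub C M) C w ⟩
          ((ev₀ ∘ Sub C M) A.⋆ (ev₀ ∘ C)) w             ≈⟨ A.⋆-cong (A.≐-trans (H₀.hom-Sub C M) (A.≐-trans
                                                           (A.Sub-cong {ev₀ ∘ C} A.≐-refl ev₀-M) (A.Sub-δ (ev₀ ∘ C)))) (λ v → ev-const 0# (N v)) w ⟩
          (A.δ A.⋆ N) w                               ≈⟨ A.⋆-identityˡ N w ⟩
          ev₋ (M w)                                   ≈⟨ ev₀-σ (M w) ⟨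
          ev₀ (Y w)                                   ∎

-- Relations between cumulants

nth : List ℕ → ℕ → ℕ
nth []      _       = 0
nth (a ∷ w) zero    = a
nth (a ∷ w) (suc i) = nth w i

-- The elements of [n] start at 1, the positions of a list at 0; hence the predecessor.
relabelling : List ℕ → ℕ → ℕ
relabelling w i = nth w (ℕ.pred i)

map-relabelling : ∀ w → map (relabelling w) (range (length w)) ≡ w
map-relabelling w = ≡.trans (≡.sym (map-∘ (upTo (length w))))
  (≡.trans (map-applyUpTo id (relabelling w ∘ suc) (length w)) (applyUpTo-nth w))
  where
  applyUpTo-nth : ∀ w → applyUpTo (nth w) (length w) ≡ w
  applyUpTo-nth []      = ≡.refl
  applyUpTo-nth (a ∷ w) = cong (a ∷_) (applyUpTo-nth w)

module _ (y : ℕ → ℕ) where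
  open Relabel y

  size-relabel : ∀ F → size (relabel F) ≡ size F
  size-relabel F = ≡.trans (cong length (flatten-relabel F)) (length-map (map y) (flatten F))

  innerSize-relabel : ∀ g → innerSize (relabelᴳ g) ≡ innerSize g
  innerSize-relabel (end F)     = ≡.refl
  innerSize-relabel (mid F x g) = cong₂ ℕ._+_ (size-relabel F) (innerSize-relabel g)

  treeFactorial-relabel  : ∀ F → treeFactorial (relabel F) ≡ treeFactorial F
  treeFactorialᴳ-relabel : ∀ g → treeFactorialᴳ (relabelᴳ g) ≡ treeFactorialᴳ g
  treeFactorial-relabel ε          = ≡.refl
  treeFactorial-relabel (node a g) = cong₂ (λ m n → suc m ℕ.* n) (innerSize-relabel g) (treeFactorialᴳ-relabel g)
  treeFactorialᴳ-relabel (end F)     = treeFactorial-relabel F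
  treeFactorialᴳ-relabel (mid F x g) = cong₂ ℕ._*_ (treeFactorial-relabel F) (treeFactorialᴳ-relabel g)

module CumulantRelations {c ℓ : Level} (R : CommutativeRing c ℓ)
  (recip : ℕ → CommutativeRing.Carrier R) (is-recip : Scalars.IsReciprocal R recip) where
  open CommutativeRing R
  open WordAlgebra R
  open Sums R
  open Scalars R using (sgn)
  open Polynomials R using (Poly; mono; _≈ᴾ_; polyRing; module Integration)
  open Integration recip is-recip using (∫)
  open MonotoneFlow R recip is-recip
  open import Algebra.Properties.Ring ring using (-1*x≈-x; -‿distribˡ-*; -‿involutive)
  open import Algebra.Solver.Ring.NaturalCoefficients.Default commutativeSemiring
    using (solve; _:+_; _:*_; _:=_)

  ev₁-mono : ∀ n a → ev₁ (mono n a) ≈ a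
  ev₁-mono zero    a = ev-const 1# a
  ev₁-mono (suc n) a = trans (+-identityˡ _) (trans (*-identityˡ _) (ev₁-mono n a))

  ev₋-mono : ∀ n a → ev₋ (mono n a) ≈ sgn n * a
  ev₋-mono zero    a = trans (ev-const (- 1#) a) (sym (*-identityˡ _))
  ev₋-mono (suc n) a = trans (+-identityˡ _) (trans (-1*x≈-x _) (trans (-‿cong (ev₋-mono n a)) (-‿distribˡ-* _ _)))

  Σ-hom : ∀ (η : Poly → Carrier) → IsRingHomomorphism (CommutativeRing.rawRing polyRing) rawRing η
        → ∀ {X : Set} (xs : List X) f → η (Scalars.ΣK polyRing xs f) ≈ ΣK xs (η ∘ f)
  Σ-hom η η-hom []       f = IsRingHomomorphism.0#-homo η-hom
  Σ-hom η η-hom (x ∷ xs) f = trans (IsRingHomomorphism.+-homo η-hom _ _) (+-congˡ (Σ-hom η η-hom xs f))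

  Σ-NC : ∀ n (Φ : Partition → Carrier) {Ψ : Forest → Carrier} → (∀ {F} → Spans 1 (suc n) F → Φ (flatten F) ≈ Ψ F)
       → ΣK (NC n) Φ ≈ ΣK (insertAll (range n) ε) Ψ
  Σ-NC n Φ {Ψ} e = begin
    ΣK (NC n) Φ                             ≈⟨ reflexive (cong (λ πs → ΣK πs Φ) (NC-forests n)) ⟩
    ΣK (map flatten (forests n)) Φ          ≈⟨ Σ-map flatten (forests n) Φ ⟩
    ΣK (forests n) (Φ ∘ flatten)            ≈⟨ Σ-local (All.map e (forests-spans n)) ⟩
    ΣK (forests n) Ψ                        ≈⟨ reflexive (cong (λ Fs → ΣK Fs Ψ) (forests-insertAll n)) ⟩
    ΣK (insertAll (range n) ε) Ψ            ∎
    where open SetoidReasoning setoid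

  Σ-NCirr : ∀ n (Φ : Partition → Carrier) {Ψ : Forest → Carrier} → (∀ {F} → Spans 1 (suc (suc n)) F → Φ (flatten F) ≈ Ψ F)
          → ΣK (NCirr (suc n)) Φ ≈ ΣK (filterᵇ irreducible (insertAll (range (suc n)) ε)) Ψ
  Σ-NCirr n Φ {Ψ} e = begin
    ΣK (NCirr (suc n)) Φ                                          ≈⟨ reflexive (cong (λ πs → ΣK πs Φ) (NCirr-forests n)) ⟩
    ΣK (map flatten (filterᵇ irreducible (forests (suc n)))) Φ    ≈⟨ Σ-map flatten (filterᵇ irreducible (forests (suc n))) Φ ⟩
    ΣK (filterᵇ irreducible (forests (suc n))) (Φ ∘ flatten)      ≈⟨ Σ-local (All.map e (Allₚ.filter⁺ (T? ∘ irreducible) (forests-spans (suc n)))) ⟩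
    ΣK (filterᵇ irreducible (forests (suc n))) Ψ                  ≈⟨ reflexive (cong (λ Fs → ΣK (filterᵇ irreducible Fs) Ψ) (forests-insertAll (suc n))) ⟩
    ΣK (filterᵇ irreducible (insertAll (range (suc n)) ε)) Ψ      ∎
    where open SetoidReasoning setoid

  Π-relabel : ∀ y F f → ΠK (flatten (Relabel.relabel y F)) f ≈ ΠK (flatten F) (f ∘ map y)
  Π-relabel y F f = trans (reflexive (cong (λ π → ΠK π f) (Relabel.flatten-relabel y F))) (Π-map (map y) (flatten F) f)

  free-moment : ∀ κ n y → ΣK (NC n) (λ π → ΠK π (κ ∘ map y)) ≈ FreeMoments.moment R κ (map y (range n))
  free-moment κ n y = begin
    ΣK (NC n) (λ π → ΠK π (κ ∘ map y))                         ≈⟨ Σ-NC n _ (λ {F} _ → sym (trans (weight-Π (relabel F)) (Π-relabel y F κ))) ⟩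
    ΣK (insertAll (range n) ε) (weight ∘ relabel)              ≈⟨ Σ-map relabel (insertAll (range n) ε) weight ⟨
    ΣK (map relabel (insertAll (range n) ε)) weight            ≈⟨ reflexive (cong (λ Fs → ΣK Fs weight) (insertAll-relabel (range n))) ⟨
    moment (map y (range n))                                   ∎
    where
    open SetoidReasoning setoid
    open FreeMoments R κ
    open Relabel y

  interval-moment : ∀ κ n y → ΣK (Int n) (λ π → ΠK π (κ ∘ map y)) ≈ IntervalMoments.moment R κ (map y (range n))
  interval-moment κ n y = begin
    ΣK (Int n) (λ π → ΠK π (κ ∘ map y))                              ≈⟨ reflexive (cong (λ πs → ΣK πs Φ) (≡.trans (Int-intervals n) (intervals-appendAll n))) ⟩
    ΣK (appendAll (range n) []) (λ π → ΠK π (κ ∘ map y))             ≈⟨ Σ-cong (appendAll (range n) []) (λ π → Π-map (map y) π κ) ⟨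
    ΣK (appendAll (range n) []) (λ π → ΠK (map (map y) π) κ)         ≈⟨ Σ-map (map (map y)) (appendAll (range n) []) (λ π → ΠK π κ) ⟨
    ΣK (map (map (map y)) (appendAll (range n) [])) (λ π → ΠK π κ)   ≈⟨ reflexive (cong (λ πs → ΣK πs (λ π → ΠK π κ)) (Relabel.appendAll-relabel y (range n))) ⟨
    moment (map y (range n))                                         ∎
    where
    open SetoidReasoning setoid
    open IntervalMoments R κ
    Φ : Partition → Carrier
    Φ π = ΠK π (κ ∘ map y)

  module _ (h : W) where
    open MonotoneMoments R recip is-recip h

    ev₁-weight : ∀ {lo hi F} → Spans lo hi F → ∀ y
               → recip (τ! (flatten F)) * ΠK (flatten F) (h ∘ map y) ≈ ev₁ (weight (Relabel.relabel y F))
    ev₁-weight {F = F} s y = sym (trans (⟦⟧-cong (weight-mono (relabel F))) (trans (ev₁-mono (size (relabel F)) _)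
      (*-cong (reflexive (cong recip (≡.trans (treeFactorial-relabel y F) (≡.sym (τ!-treeFactorial s))))) (Π-relabel y F h))))
      where
      open Relabel y
      open IsRingHomomorphism ev₁-hom

    monotone-moment : ∀ n y → ΣK (NC n) (λ π → recip (τ! π) * ΠK π (h ∘ map y)) ≈ ev₁ (moment (map y (range n)))
    monotone-moment n y = begin
      ΣK (NC n) (λ π → recip (τ! π) * ΠK π (h ∘ map y))               ≈⟨ Σ-NC n _ (λ s → ev₁-weight s y) ⟩
      ΣK (insertAll (range n) ε) (ev₁ ∘ weight ∘ relabel)             ≈⟨ Σ-map relabel (insertAll (range n) ε) (ev₁ ∘ weight) ⟨
      ΣK (map relabel (insertAll (range n) ε)) (ev₁ ∘ weight)         ≈⟨ reflexive (cong (λ Fs → ΣK Fs (ev₁ ∘ weight)) (insertAll-relabel (range n))) ⟨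
      ΣK (insertAll (map y (range n)) ε) (ev₁ ∘ weight)               ≈⟨ Σ-hom ev₁ ev₁-hom (insertAll (map y (range n)) ε) weight ⟨
      ev₁ (moment (map y (range n)))                                  ∎
      where
      open SetoidReasoning setoid
      open Relabel y

  -- Free, Boolean and monotone cumulants with common moments

  module _ (r b h : W) (m : ℕ → (ℕ → ℕ) → Carrier)
    (free     : ∀ n → 1 ≤ n → ∀ y → m n y ≈ ΣK (NC n) (λ π → ΠK π (r ∘ map y)))
    (boolean  : ∀ n → 1 ≤ n → ∀ y → m n y ≈ ΣK (Int n) (λ π → ΠK π (b ∘ map y)))
    (monotone : ∀ n → 1 ≤ n → ∀ y → m n y ≈ ΣK (NC n) (λ π → recip (τ! π) * ΠK π (h ∘ map y)))
    where
    private
      module F  = FreeMoments R r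
      module B  = IntervalMoments R b
      module M  = MonotoneMoments R recip is-recip h
      -- The free moments of the cumulants -b are the compositional inverse of the moments.
      module F₋ = FreeMoments R (- 1# · b)
      open IsRingHomomorphism ev₁-hom using () renaming (⟦⟧-cong to ev₁-cong)
      open IsRingHomomorphism ev₋-hom using () renaming (⟦⟧-cong to ev₋-cong)
      module H₁ = WordHom polyRing R ev₁ ev₁-hom
      module H₋ = WordHom polyRing R ev₋ ev₋-hom
      module Aᴾ = WordAlgebra polyRing

      ∂h : ℕ → W
      ∂h a = ∂ a h

    ev-moment-equation : ∀ (η : Poly → Carrier) → IsRingHomomorphism (CommutativeRing.rawRing polyRing) rawRing η
      → η ∘ M.moment ≐ δ ⊞ (D (λ a → η ∘ ∫ ∘ Aᴾ.Sub M.moment (hᴾ ∂h a)) ⋆ (η ∘ M.moment))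
    ev-moment-equation η η-hom w = trans (⟦⟧-cong (M.moment-equation w)) (trans (+-homo (Aᴾ.δ w) _) (+-cong (hom-δ w)
      (trans (hom-⋆ (Aᴾ.D i) M.moment w) (⋆-congʳ {Q = η ∘ M.moment} (hom-D i) w))))
      where
      open IsRingHomomorphism η-hom
      open WordHom polyRing R η η-hom
      i : ℕ → Aᴾ.W
      i a = ∫ ∘ Aᴾ.Sub M.moment (hᴾ ∂h a)

    equation-[] : ∀ {F P} → P ≐ δ ⊞ (D F ⋆ P) → P [] ≈ 1#
    equation-[] e = trans (e []) (trans (+-congˡ (zeroˡ _)) (+-identityʳ _))

    -- Every nonempty word is the image of 1, ..., n under the relabelling that reads off its
    -- letters, so relations for all relabellings reach all words. At [] both series have the value
    -- 1.
    equal-moments : ∀ {F G P Q} → P ≐ δ ⊞ (D F ⋆ P) → Q ≐ δ ⊞ (D G ⋆ Q)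
                  → (∀ n → 1 ≤ n → ∀ y → P (map y (range n)) ≈ Q (map y (range n))) → P ≐ Q
    equal-moments p q e []        = trans (equation-[] p) (sym (equation-[] q))
    equal-moments {P = P} {Q} p q e w@(_ ∷ _) =
      ≡.subst (λ v → P v ≈ Q v) (map-relabelling w) (e (length w) (s≤s z≤n) (relabelling w))

    free≐interval : F.moment ≐ B.moment
    free≐interval = equal-moments F.moment-equation B.moment-equation (λ n le y →
      trans (sym (free-moment r n y)) (trans (sym (free n le y)) (trans (boolean n le y) (interval-moment b n y))))

    monotone≐interval : ev₁ ∘ M.moment ≐ B.moment
    monotone≐interval = equal-moments (ev-moment-equation ev₁ ev₁-hom) B.moment-equation (λ n le y →
      trans (sym (monotone-moment h n y)) (trans (sym (monotone n le y)) (trans (boolean n le y) (interval-moment b n y))))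

    -- The moment series has constant term 1 and can be cancelled on the right, so it determines the
    -- first-block factor in its equation.
    same-first-block : ∀ {F P} → P ≐ δ ⊞ (D F ⋆ P) → P ≐ B.moment → ∀ a → ∂ a b ≐ F a
    same-first-block {F} {P} p e a w = cancel (a ∷ w)
      where
      open import Algebra.Properties.Group +-group using (∙-cancelˡ)
      cancel : D (λ a → ∂ a b) ≐ D F
      cancel = ⋆-cancelʳ (D (λ a → ∂ a b)) (D F) B.moment (equation-[] B.moment-equation) (λ v → ∙-cancelˡ (δ v) _ _
        (trans (sym (B.moment-equation v)) (trans (sym (e v)) (trans (p v) (+-congˡ (⋆-congˡ {D F} e v))))))

    boolean-free : ∀ a → ∂ a b ≐ Sub F.moment (∂ a r)
    boolean-free = same-first-block F.moment-equation free≐interval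

    boolean-monotone : ∀ a → ∂ a b ≐ ev₁ ∘ ∫ ∘ Aᴾ.Sub M.moment (hᴾ ∂h a)
    boolean-monotone = same-first-block (ev-moment-equation ev₁ ev₁-hom) monotone≐interval

    -- Serves for both candidates for the inverse: the free moments of -b and the monotone moments
    -- at s = -1.
    negated-inverse : ∀ {G N ρ} → N ≐ δ ⊞ (D G ⋆ N) → (∀ a → G a ≐ - 1# · ρ a) → (δ ⊞ D ρ) ⋆ N ≐ δ
    negated-inverse {G} {N} {ρ} n g w = begin
      ((δ ⊞ D ρ) ⋆ N) w                            ≈⟨ ⋆-distribʳ δ (D ρ) N w ⟩
      (δ ⋆ N) w + (D ρ ⋆ N) w                      ≈⟨ +-congʳ (trans (⋆-identityˡ N w) (n w)) ⟩
      (δ w + (D G ⋆ N) w) + (D ρ ⋆ N) w            ≈⟨ +-congʳ (+-congˡ (trans (⋆-congʳ {Q = N} D-neg w) (trans (·-⋆ (- 1#) (D ρ) N w) (-1*x≈-x _)))) ⟩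
      (δ w + - (D ρ ⋆ N) w) + (D ρ ⋆ N) w          ≈⟨ trans (+-assoc _ _ _) (trans (+-congˡ (-‿inverseˡ _)) (+-identityʳ _)) ⟩
      δ w                                          ∎
      where
      open SetoidReasoning setoid
      D-neg : D G ≐ - 1# · D ρ
      D-neg []      = sym (zeroʳ _)
      D-neg (a ∷ v) = g a v

    M-equation : F.moment ≐ δ ⊞ (D (λ a → ∂ a b) ⋆ F.moment)
    M-equation w = trans (F.moment-equation w) (+-congˡ (⋆-congʳ {Q = F.moment} (D-cong (λ a → ≐-sym (boolean-free a))) w))

    free-boolean : ∀ a → ∂ a r ≐ Sub F₋.moment (∂ a b)
    free-boolean = inversion F.moment F₋.moment (λ a → ∂ a r) (λ a → ∂ a b) (λ a → Sub F₋.moment (∂ a b))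
      M-equation boolean-free
      (negated-inverse {ρ = λ a → Sub F₋.moment (∂ a b)} F₋.moment-equation (λ a → Sub-· F₋.moment (- 1#) (∂ a b)))
      (λ _ → ≐-refl)

    -- N consists of the monotone moments at s = -1, whose first-block factor is -ρ. That N inverts
    -- the moments is not derived from ρ here but comes from the flow, through `free≐interval` and
    -- `monotone≐interval`.
    free-monotone : ∀ a → ∂ a r ≐ λ w → - ev₋ (∫ (Aᴾ.Sub M.moment (hᴾ ∂h a) w))
    free-monotone = inversion-from-inverse F.moment N (λ a → ∂ a r) (λ a → ∂ a b) (λ a w → - ev₋ (∫ (Aᴾ.Sub M.moment (hᴾ ∂h a) w)))
      M-equation boolean-free
      (negated-inverse (ev-moment-equation ev₋ ev₋-hom) (λ a w → trans (sym (-‿involutive _)) (sym (-1*x≈-x _))))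
      (≐-trans (⋆-congʳ {Q = N} (Sub-cong {N} ≐-refl (≐-trans free≐interval (≐-sym monotone≐interval))))
        (flow-inverse ∂h M.moment M.moment-equation))
      where
      N : W
      N = ev₋ ∘ M.moment

    -- A forest spanning a nonempty range has a first block, so the truncated subtraction is exact.
    sgn-pred : ∀ {n F} → Spans 1 (suc (suc n)) F → sgn (size F ∸ 1) ≈ - 1# * sgn (size F)
    sgn-pred (node _) = sym (trans (-1*x≈-x _) (-‿involutive _))

    Π-neg : ∀ (π : Partition) → ΠK π (- 1# · b) ≈ sgn (length π) * ΠK π b
    Π-neg []      = sym (*-identityˡ _)
    Π-neg (V ∷ π) = trans (*-cong (-1*x≈-x _) (Π-neg π)) (trans (sym (-‿distribˡ-* _ _))
      (trans (-‿cong (solve 3 (λ x y z → x :* (y :* z) := y :* (x :* z)) refl _ _ _)) (-‿distribˡ-* _ _)))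

    -- Chosen so that `range (suc n)` is definitionally `1 ∷ range-tail n`.
    range-tail : ℕ → List ℕ
    range-tail n = map suc (applyUpTo suc n)

    boolean-from-free : ∀ n → b (range (suc n)) ≈ ΣK (NCirr (suc n)) (λ π → ΠK π r)
    boolean-from-free n = sym (trans (Σ-NCirr n _ (λ {F} _ → sym (F.weight-Π F)))
      (trans (F.irreducible-sum 1 (range-tail n)) (sym (boolean-free 1 (range-tail n)))))

    free-from-boolean : ∀ n → r (range (suc n)) ≈ ΣK (NCirr (suc n)) (λ π → sgn (length π ∸ 1) * ΠK π b)
    free-from-boolean n = sym (begin
      ΣK (NCirr (suc n)) (λ π → sgn (length π ∸ 1) * ΠK π b)   ≈⟨ Σ-NCirr n _ term ⟩
      ΣK Fs (λ F → - 1# * F₋.weight F)                         ≈⟨ Σ-*ˡ (- 1#) Fs F₋.weight ⟩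
      - 1# * ΣK Fs F₋.weight                                   ≈⟨ *-congˡ (trans (F₋.irreducible-sum 1 (range-tail n)) (Sub-· F₋.moment (- 1#) (∂ 1 b) (range-tail n))) ⟩
      -- One sign is the shift from |π| to |π| - 1, the other comes from the first block of -b; they
      -- cancel.
      - 1# * (- 1# * Sub F₋.moment (∂ 1 b) (range-tail n))                  ≈⟨ trans (-1*x≈-x _) (trans (-‿cong (-1*x≈-x _)) (-‿involutive _)) ⟩
      Sub F₋.moment (∂ 1 b) (range-tail n)                                  ≈⟨ free-boolean 1 (range-tail n) ⟨
      r (range (suc n))                                        ∎)
      where
      open SetoidReasoning setoid
      Fs = filterᵇ irreducible (insertAll (range (suc n)) ε)
      term : ∀ {F} → Spans 1 (suc (suc n)) F → sgn (size F ∸ 1) * ΠK (flatten F) b ≈ - 1# * F₋.weight F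
      term {F} s = trans (*-congʳ (sgn-pred s)) (trans (*-assoc _ _ _)
        (*-congˡ (sym (trans (F₋.weight-Π F) (Π-neg (flatten F))))))

    boolean-from-monotone : ∀ n → b (range (suc n)) ≈ ΣK (NCirr (suc n)) (λ π → recip (τ! π) * ΠK π h)
    boolean-from-monotone n = sym (trans (Σ-NCirr n _ term)
      (trans (sym (Σ-hom ev₁ ev₁-hom (filterᵇ irreducible (insertAll (range (suc n)) ε)) M.weight))
      (trans (ev₁-cong (M.irreducible-sum 1 (range-tail n))) (sym (boolean-monotone 1 (range-tail n))))))
      where
      term : ∀ {F} → Spans 1 (suc (suc n)) F → recip (τ! (flatten F)) * ΠK (flatten F) h ≈ ev₁ (M.weight F)
      term {F} s = sym (trans (ev₁-cong (M.weight-mono F)) (trans (ev₁-mono (size F) _)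
        (*-congʳ (reflexive (cong recip (≡.sym (τ!-treeFactorial s)))))))

    free-from-monotone : ∀ n → r (range (suc n)) ≈ ΣK (NCirr (suc n)) (λ π → (sgn (length π ∸ 1) * recip (τ! π)) * ΠK π h)
    free-from-monotone n = sym (begin
      ΣK (NCirr (suc n)) (λ π → (sgn (length π ∸ 1) * recip (τ! π)) * ΠK π h)   ≈⟨ Σ-NCirr n _ term ⟩
      ΣK Fs (λ F → - 1# * ev₋ (M.weight F))                                     ≈⟨ Σ-*ˡ (- 1#) Fs (ev₋ ∘ M.weight) ⟩
      - 1# * ΣK Fs (ev₋ ∘ M.weight)                                             ≈⟨ *-congˡ (Σ-hom ev₋ ev₋-hom Fs M.weight) ⟨
      - 1# * ev₋ (Scalars.ΣK polyRing Fs M.weight)                              ≈⟨ trans (*-congˡ (ev₋-cong (M.irreducible-sum 1 (range-tail n)))) (-1*x≈-x _) ⟩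
      - ev₋ (∫ (Aᴾ.Sub M.moment (hᴾ ∂h 1) (range-tail n)))                                   ≈⟨ free-monotone 1 (range-tail n) ⟨
      r (range (suc n))                                                         ∎)
      where
      open SetoidReasoning setoid
      Fs = filterᵇ irreducible (insertAll (range (suc n)) ε)
      term : ∀ {F} → Spans 1 (suc (suc n)) F
           → (sgn (size F ∸ 1) * recip (τ! (flatten F))) * ΠK (flatten F) h ≈ - 1# * ev₋ (M.weight F)
      term {F} s = trans (*-congʳ (*-cong (sgn-pred s) (reflexive (cong recip (τ!-treeFactorial s)))))
        (trans (solve 4 (λ x y z t → ((x :* y) :* z) :* t := x :* (y :* (z :* t))) refl _ _ _ _)
        (*-congˡ (sym (trans (ev₋-cong (M.weight-mono F)) (ev₋-mono (size F) _)))))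

-- Infinitesimal cumulants

-- The dual numbers K[ε] / (ε²), with (a , a′) standing for a + ε a′.
module DualNumbers {c ℓ : Level} (K : CommutativeRing c ℓ) where
  open CommutativeRing K
  open import Algebra.Solver.Ring.NaturalCoefficients.Default commutativeSemiring
    using (solve; _:+_; _:*_; _:=_)

  dualRing : CommutativeRing c ℓ
  dualRing = record
    { Carrier = Carrier × Carrier
    ; _≈_ = λ (a , a′) (b , b′) → a ≈ b × a′ ≈ b′
    ; _+_ = λ (a , a′) (b , b′) → a + b , a′ + b′
    ; _*_ = λ (a , a′) (b , b′) → a * b , a′ * b + a * b′
    ; -_ = λ (a , a′) → - a , - a′
    ; 0# = 0# , 0#
    ; 1# = 1# , 0#
    ; isCommutativeRing = record
      { isRing = record
        { +-isAbelianGroup = record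
          { isGroup = record
            { isMonoid = record
              { isSemigroup = record
                { isMagma = record
                  { isEquivalence = record
                    { refl = refl , refl
                    ; sym = λ (e , e′) → sym e , sym e′
                    ; trans = λ (e , e′) (f , f′) → trans e f , trans e′ f′ }
                  ; ∙-cong = λ (e , e′) (f , f′) → +-cong e f , +-cong e′ f′ }
                ; assoc = λ _ _ _ → +-assoc _ _ _ , +-assoc _ _ _ }
              ; identity = (λ _ → +-identityˡ _ , +-identityˡ _) , (λ _ → +-identityʳ _ , +-identityʳ _) }
            ; inverse = (λ _ → -‿inverseˡ _ , -‿inverseˡ _) , (λ _ → -‿inverseʳ _ , -‿inverseʳ _)
            ; ⁻¹-cong = λ (e , e′) → -‿cong e , -‿cong e′ }
          ; comm = λ _ _ → +-comm _ _ , +-comm _ _ }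
        ; *-cong = λ (e , e′) (f , f′) → *-cong e f , +-cong (*-cong e′ f) (*-cong e f′)
        ; *-assoc = λ _ _ _ → *-assoc _ _ _ ,
            solve 6 (λ a a′ b b′ c c′ → (a′ :* b :+ a :* b′) :* c :+ (a :* b) :* c′
                                     := a′ :* (b :* c) :+ a :* (b′ :* c :+ b :* c′)) refl _ _ _ _ _ _
        ; *-identity = (λ _ → *-identityˡ _ , trans (+-cong (zeroˡ _) (*-identityˡ _)) (+-identityˡ _))
                     , (λ _ → *-identityʳ _ , trans (+-cong (*-identityʳ _) (zeroʳ _)) (+-identityʳ _))
        ; distrib = (λ _ _ _ → distribˡ _ _ _ ,
                      solve 6 (λ a a′ b b′ c c′ → a′ :* (b :+ c) :+ a :* (b′ :+ c′)
                                               := (a′ :* b :+ a :* b′) :+ (a′ :* c :+ a :* c′)) refl _ _ _ _ _ _)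
                  , (λ _ _ _ → distribʳ _ _ _ ,
                      solve 6 (λ a a′ b b′ c c′ → (b′ :+ c′) :* a :+ (b :+ c) :* a′
                                               := (b′ :* a :+ b :* a′) :+ (c′ :* a :+ c :* a′)) refl _ _ _ _ _ _)
        }
      ; *-comm = λ _ _ → *-comm _ _ , solve 4 (λ a a′ b b′ → a′ :* b :+ a :* b′ := b′ :* a :+ b :* a′) refl _ _ _ _ } }

  private
    module ε = CommutativeRing dualRing
    module Sε = Scalars dualRing
  open Scalars K
  open import Algebra.Properties.Ring ring using (-0#≈0#)

  inject : Carrier → ε.Carrier
  inject a = a , 0#

  inject-* : ∀ k x → (inject k ε.* x) ε.≈ (k * proj₁ x , k * proj₂ x)
  inject-* k x = refl , trans (+-congʳ (zeroˡ _)) (+-identityˡ _)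

  fromℕ-dual : ∀ n → Sε.fromℕ n ε.≈ inject (fromℕ n)
  fromℕ-dual zero    = refl , refl
  fromℕ-dual (suc n) = +-congˡ (proj₁ (fromℕ-dual n)) , trans (+-identityˡ _) (proj₂ (fromℕ-dual n))

  sgn-dual : ∀ n → Sε.sgn n ε.≈ inject (sgn n)
  sgn-dual zero    = refl , refl
  sgn-dual (suc n) = -‿cong (proj₁ (sgn-dual n)) , trans (-‿cong (proj₂ (sgn-dual n))) -0#≈0#

  -- The dual numbers are not a field, but inverses of positive integers are inherited from K, and
  -- these are all that monotone cumulants call for.
  reciprocal-dual : ∀ {recip} → IsReciprocal recip → Sε.IsReciprocal (inject ∘ recip)
  reciprocal-dual {recip} is-recip m m≢0 = ε.trans (ε.*-congʳ {inject (recip m)} (fromℕ-dual m))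
    (is-recip m m≢0 , trans (+-cong (zeroˡ _) (zeroʳ _)) (+-identityˡ _))

  ΣK-dual : ∀ {X : Set} (xs : List X) (f : X → ε.Carrier) → Sε.ΣK xs f ε.≈ (ΣK xs (proj₁ ∘ f) , ΣK xs (proj₂ ∘ f))
  ΣK-dual []       f = refl , refl
  ΣK-dual (x ∷ xs) f = +-congˡ (proj₁ (ΣK-dual xs f)) , +-congˡ (proj₂ (ΣK-dual xs f))

  -- The ε-part of a product is the derivation ∂ of the paper.
  ΠK-dual : ∀ (π : Partition) (f f′ : Block → Carrier)
          → Sε.ΠK π (λ V → f V , f′ V) ε.≈ (ΠK π f , ΣK (select π) (λ { (V , rest) → f′ V * ΠK rest f }))
  ΠK-dual []      f f′ = refl , refl
  ΠK-dual (V ∷ π) f f′ = *-congˡ (proj₁ (ΠK-dual π f f′)) ,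
    +-cong (*-congˡ (proj₁ (ΠK-dual π f f′))) (trans (*-congˡ (proj₂ (ΠK-dual π f f′))) (scale (select π)))
    where
    scale : ∀ (xs : List (Block × Partition)) → f V * ΣK xs (λ { (W , rest) → f′ W * ΠK rest f })
          ≈ ΣK (map (λ { (W , rest) → W , V ∷ rest }) xs) (λ { (W , rest) → f′ W * ΠK rest f })
    scale []                 = zeroʳ _
    scale ((W , rest) ∷ xs)  = trans (distribˡ _ _ _) (+-cong
      (solve 3 (λ x y z → x :* (y :* z) := y :* (x :* z)) refl _ _ _) (scale xs))

module InfinitesimalRelations {c ℓ a ℓa : Level} (K : CommutativeRing c ℓ)
  (recip : ℕ → CommutativeRing.Carrier K) (is-recip : Scalars.IsReciprocal K recip) (P : InfProbSpace K a ℓa) where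
  open CommutativeRing K
  open Over K P
  open InfProbSpace P using (Carrierᴹ; φ; φ′)
  open DualNumbers K
  private
    module ε = CommutativeRing dualRing
    module Sε = Scalars dualRing

  -- For fixed arguments x, a family and its infinitesimal companion form one word function over the
  -- dual numbers, a letter i standing for x i.
  dual : Family → Family → (ℕ → Carrierᴹ) → List ℕ → ε.Carrier
  dual f f′ x V = f (map x V) , f′ (map x V)

  Σ-dual : ∀ (πs : List Partition) {Φ : Partition → ε.Carrier} {A B : Partition → Carrier}
         → (∀ π → Φ π ε.≈ (A π , B π)) → Sε.ΣK πs Φ ε.≈ (ΣK πs A , ΣK πs B)
  Σ-dual πs {Φ} e = ε.trans (ΣK-dual πs Φ) (Sums.Σ-cong K πs (proj₁ ∘ e) , Sums.Σ-cong K πs (proj₂ ∘ e))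

  Π-dual : ∀ f f′ x π → Sε.ΠK π (dual f f′ x) ε.≈ ([ f ] π at x , ∂[ f , f′ ] π at x)
  Π-dual f f′ x π = ΠK-dual π (f ∘ map x) (f′ ∘ map x)

  Π-dual-∘ : ∀ f f′ x y π → Sε.ΠK π (dual f f′ x ∘ map y) ε.≈ ([ f ] π at (x ∘ y) , ∂[ f , f′ ] π at (x ∘ y))
  Π-dual-∘ f f′ x y π = ε.trans
    (Sums.Π-cong dualRing π (λ V → ε.reflexive (≡.cong (λ v → f v , f′ v) (≡.sym (map-∘ V)))))
    (Π-dual f f′ (x ∘ y) π)

  scaled : ∀ k {X A B} → X ε.≈ (A , B) → (inject k ε.* X) ε.≈ (k * A , k * B)
  scaled k e = ε.trans (ε.*-congˡ {inject k} e) (inject-* k _)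

  signed : ∀ n {X A B} → X ε.≈ (A , B) → (Sε.sgn n ε.* X) ε.≈ (sgn n * A , sgn n * B)
  signed n {X} e = ε.trans (ε.*-congʳ {X} (sgn-dual n)) (scaled (sgn n) e)

  module _ (r r′ b b′ h h′ : Family) (free : AreFreeCumulants r r′) (boolean : AreBooleanCumulants b b′)
    (monotone : AreMonotoneCumulants recip h h′) (x : ℕ → Carrierᴹ) where

    open CumulantRelations dualRing (inject ∘ recip) (reciprocal-dual is-recip)

    private
      rε bε hε : List ℕ → ε.Carrier
      rε = dual r r′ x
      bε = dual b b′ x
      hε = dual h h′ x

      -- The hypotheses are applied to the sequences `x ∘ y`, which provides the joint moments of
      -- the arguments in any order and with repetitions.
      moment : ℕ → (ℕ → ℕ) → ε.Carrier
      moment n y = φ (prodA (x ∘ y) n) , φ′ (prodA (x ∘ y) n)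

      freeε : ∀ n → 1 ≤ n → ∀ y → moment n y ε.≈ Sε.ΣK (NC n) (λ π → Sε.ΠK π (rε ∘ map y))
      freeε n le y = ε.trans (free n le (x ∘ y)) (ε.sym (Σ-dual (NC n) (Π-dual-∘ r r′ x y)))

      booleanε : ∀ n → 1 ≤ n → ∀ y → moment n y ε.≈ Sε.ΣK (Int n) (λ π → Sε.ΠK π (bε ∘ map y))
      booleanε n le y = ε.trans (boolean n le (x ∘ y)) (ε.sym (Σ-dual (Int n) (Π-dual-∘ b b′ x y)))

      monotoneε : ∀ n → 1 ≤ n → ∀ y → moment n y ε.≈ Sε.ΣK (NC n) (λ π → inject (recip (τ! π)) ε.* Sε.ΠK π (hε ∘ map y))
      monotoneε n le y = ε.trans (monotone n le (x ∘ y))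
        (ε.sym (Σ-dual (NC n) (λ π → scaled (recip (τ! π)) (Π-dual-∘ h h′ x y π))))

    b′-from-free : ∀ n → b′ (args x (suc n)) ≈ ΣK (NCirr (suc n)) (λ π → ∂[ r , r′ ] π at x)
    b′-from-free n = proj₂ (ε.trans (boolean-from-free rε bε hε moment freeε booleanε monotoneε n)
      (Σ-dual (NCirr (suc n)) (Π-dual r r′ x)))

    r′-from-boolean : ∀ n → r′ (args x (suc n)) ≈ ΣK (NCirr (suc n)) (λ π → sgn (length π ∸ 1) * ∂[ b , b′ ] π at x)
    r′-from-boolean n = proj₂ (ε.trans (free-from-boolean rε bε hε moment freeε booleanε monotoneε n)
      (Σ-dual (NCirr (suc n)) (λ π → signed (length π ∸ 1) (Π-dual b b′ x π))))

    b′-from-monotone : ∀ n → b′ (args x (suc n)) ≈ ΣK (NCirr (suc n)) (λ π → recip (τ! π) * ∂[ h , h′ ] π at x)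
    b′-from-monotone n = proj₂ (ε.trans (boolean-from-monotone rε bε hε moment freeε booleanε monotoneε n)
      (Σ-dual (NCirr (suc n)) (λ π → scaled (recip (τ! π)) (Π-dual h h′ x π))))

    r′-from-monotone : ∀ n → r′ (args x (suc n))
                     ≈ ΣK (NCirr (suc n)) (λ π → (sgn (length π ∸ 1) * recip (τ! π)) * ∂[ h , h′ ] π at x)
    r′-from-monotone n = proj₂ (ε.trans (free-from-monotone rε bε hε moment freeε booleanε monotoneε n)
      (Σ-dual (NCirr (suc n)) (λ π →
        ε.trans (ε.*-assoc (Sε.sgn (length π ∸ 1)) (inject (recip (τ! π))) (Sε.ΠK π hε))
        (ε.trans (signed (length π ∸ 1) (scaled (recip (τ! π)) (Π-dual h h′ x π)))
          (sym (*-assoc _ _ _) , sym (*-assoc _ _ _))))))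

theorem1p1 : {c ℓ a ℓa : Level} (K : CommutativeRing c ℓ)
    → (recip : ℕ → CommutativeRing.Carrier K)
    → Scalars.IsReciprocal K recip
    → (P : InfProbSpace K a ℓa)
    → (r r′ b b′ h h′ : Over.Family K P)
    → Over.AreFreeCumulants K P r r′
    → Over.AreBooleanCumulants K P b b′
    → Over.AreMonotoneCumulants K P recip h h′
    → (n : ℕ) → 1 ≤ n → (x : ℕ → InfProbSpace.Carrierᴹ P)
    → CommutativeRing._≈_ K (b′ (Over.args K P x n))
    (Scalars.ΣK K (NCirr n) (λ π → Over.∂[_,_]_at_ K P r r′ π x))
    × CommutativeRing._≈_ K (r′ (Over.args K P x n))
    (Scalars.ΣK K (NCirr n) (λ π → CommutativeRing._*_ K (Scalars.sgn K (Data.List.length π Data.Nat.∸ 1)) (Over.∂[_,_]_at_ K P b b′ π x)))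
    × CommutativeRing._≈_ K (b′ (Over.args K P x n))
    (Scalars.ΣK K (NCirr n) (λ π → CommutativeRing._*_ K (recip (τ! π)) (Over.∂[_,_]_at_ K P h h′ π x)))
    × CommutativeRing._≈_ K (r′ (Over.args K P x n))
    (Scalars.ΣK K (NCirr n) (λ π → CommutativeRing._*_ K (CommutativeRing._*_ K (Scalars.sgn K (Data.List.length π Data.Nat.∸ 1)) (recip (τ! π))) (Over.∂[_,_]_at_ K P h h′ π x)))
theorem1p1 K recip is-recip P r r′ b b′ h h′ free boolean monotone (suc n) _ x =
  b′-from-free r r′ b b′ h h′ free boolean monotone x n
  , r′-from-boolean r r′ b b′ h h′ free boolean monotone x n
  , b′-from-monotone r r′ b b′ h h′ free boolean monotone x n
  , r′-from-monotone r r′ b b′ h h′ free boolean monotone x n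
  where open InfinitesimalRelations K recip is-recip P
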